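{- For every prime power $q$, there exists an $(r \times c, v)$-unordered triple array with $r = \frac{q^3 - 1}{q - 1}$, $c = \frac{q^4 - 1}{q - 1}$ and $v = \frac{(q^4 - 1)(q^3 - 1)}{(q^2 - 1)(q - 1)}$.
   Context: An $(r \times c, v)$-unordered triple array on a set $V$ of $v$ symbols is a collection of $c$-subsets $R_1, \dots, R_r \subseteq V$ (row-sets) and $r$-subsets $C_1, \dots, C_c \subseteq V$ (column-sets) such that, for some integers $e, \lambda_{rc}, \lambda_{rr}, \lambda_{cc}$, each symbol lies in exactly $e$ row-sets and exactly $e$ column-sets, $|R_i \cap C_j| = \lambda_{rc}$ for all $i,j$, $|R_i \cap R_s| = \lambda_{rr}$ for all $i \neq s$, and $|C_j \cap C_t| = \lambda_{cc}$ for all $j \neq t$. -}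

module Defs where

open import Data.Nat using (ℕ; zero; suc; _*_; _^_; _≤_)
open import Data.Nat.Primality using (Prime)
open import Data.Fin using (Fin) renaming (zero to fzero; suc to fsuc)
open import Relation.Nullary using (yes; no)
open import Data.Fin.Subset using (Subset; _∈_; _∩_; ∣_∣)
open import Data.Fin.Subset.Properties using (_∈?_)
open import Data.Product using (Σ; ∃; _×_)
open import Relation.Binary.PropositionalEquality using (_≡_; _≢_)

IsPrimePower : ℕ → Set
IsPrimePower q = Σ ℕ λ p → Σ ℕ λ k → Prime p × (1 ≤ k) × (q ≡ p ^ k)

count : ∀ {v m} → (Fin m → Subset v) → Fin v → ℕ
count {m = 0} F x = 0
count {m = suc m} F x with x ∈? F fzero
... | yes _ = suc (count (λ i → F (fsuc i)) x)
... | no _ = count (λ i → F (fsuc i)) x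

record UnorderedTripleArray (r c v : ℕ) : Set where
  field
    R : Fin r → Subset v
    C : Fin c → Subset v
    R-size : ∀ i → ∣ R i ∣ ≡ c
    C-size : ∀ j → ∣ C j ∣ ≡ r
    e λrc λrr λcc : ℕ
    rowRep : ∀ x → count R x ≡ e
    colRep : ∀ x → count C x ≡ e
    rc-int : ∀ i j → ∣ R i ∩ C j ∣ ≡ λrc
    rr-int : ∀ i s → i ≢ s → ∣ R i ∩ R s ∣ ≡ λrr
    cc-int : ∀ j t → j ≢ t → ∣ C j ∩ C t ∣ ≡ λcc

{-# OPTIONS --safe #-}

-- The symbols are the lines of PG(3,q), partitioned into q² + q + 1 spreads (a parallelism); the spreads
-- are identified with the points of PG(2,q). A column is the set of lines through a point of PG(3,q), and
-- a row is the union of the spreads lying on a line of PG(2,q). Then e = λrc = q + 1, λcc = 1 and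
-- λrr = q² + 1.
--
-- For q > 2 the parallelism is Johnson's. Let K be the quadratic extension of F = GF(q), so that the
-- points of PG(3,q) are the F-lines of K². One spread consists of the K-lines. Another Desarguesian
-- spread meeting it exactly in a regulus through x = 0 has that regulus replaced by the opposite one, and
-- is moved around by the maps (x , y) ↦ (α x , y + β x), which fix the first spread. For q = 2 no
-- such second spread exists, and a Kirkman triple system of order 15 is used instead.
--
-- GF(p^k) is cut out of A = 𝔽ₚ[X]/(X^q - X), where every element satisfies y^q = y, by a minimal
-- idempotent below the support of ∏_{0<d<k} (X^(p^d) - X), which is nonzero for reasons of degree. In the
-- resulting field X has k distinct conjugates, so 1, X, …, X^(k-1) are independent over 𝔽ₚ, while the
-- roots of Y^q - Y number at most q.
module Submission where

-- Any bijection between the spreads and the points of PG(2,q) serves: a row is a union of whole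
-- spreads and a column takes one line from each spread, so every count is made either in the plane
-- or in the parallelism alone. The maps with α and β in F preserve the second spread. Its images
-- are therefore indexed by K*/F* and K/F, and these q(q + 1) spreads together with the K-lines make
-- q² + q + 1. For q = 2 the obstacle is `norms-differ`: every nonzero element of GF(4) has norm 1,
-- so norm (a₀ + t) ≠ norm b₀ would force a₀ + t = 0 for both values of t. No irreducible polynomial
-- of degree k is searched for. In a ring with y^q = y the power y^(q-1) is idempotent, so below a
-- minimal idempotent every element is either zero or invertible with inverse y^(q-2).

-- Identities in an arbitrary commutative ring, solved with integer coefficients.

module Solver where
  open import Algebra.Bundles using (CommutativeRing)
  open import Data.Integer as ℤ using (ℤ; +_; -[1+_])
  import Data.Integer.Properties as ℤ
  open import Data.Nat as ℕ using (ℕ; zero; suc)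
  open import Data.Maybe using (Maybe; just; nothing)
  open import Relation.Nullary using (yes; no)
  import Relation.Binary.PropositionalEquality as ≡

  module IntegerSolver {c ℓ} (R : CommutativeRing c ℓ) where
    open CommutativeRing R
    open import Algebra.Solver.Ring.AlmostCommutativeRing using (_-Raw-AlmostCommutative⟶_; fromCommutativeRing)
    open import Algebra.Properties.Semiring.Mult.TCOptimised semiring using (_×_; ×-homo-+; ×1-homo-*; ×-cong; 1+×)
    open import Algebra.Properties.Ring ring using (-‿distribˡ-*; -‿distribʳ-*; -0#≈0#; -‿involutive; -‿+-comm)
    open import Relation.Binary.Reasoning.Setoid setoid

    private
      -- With the optimised multiple, `ι 0` and `ι 1` reduce to `0#` and `1#`, so literals in solver
      -- equations match the ring constants by computation.
      ι : ℕ → Carrier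
      ι n = n × 1#

      ⟦_⟧ : ℤ → Carrier
      ⟦ + n ⟧ = ι n
      ⟦ -[1+ n ] ⟧ = - ι (suc n)

      +-interchange-neg : ∀ a b → (1# + a) + - (1# + b) ≈ a + - b
      +-interchange-neg a b = begin
        (1# + a) + - (1# + b)        ≈⟨ +-cong (+-comm 1# a) (sym (-‿+-comm 1# b)) ⟩
        (a + 1#) + (- 1# + - b)      ≈⟨ +-assoc a 1# _ ⟩
        a + (1# + (- 1# + - b))      ≈⟨ +-congˡ (sym (+-assoc 1# (- 1#) (- b))) ⟩
        a + ((1# + - 1#) + - b)      ≈⟨ +-congˡ (+-congʳ (-‿inverseʳ 1#)) ⟩
        a + (0# + - b)               ≈⟨ +-congˡ (+-identityˡ (- b)) ⟩
        a + - b                      ∎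

      ⊖-homo : ∀ m n → ⟦ m ℤ.⊖ n ⟧ ≈ ι m + - ι n
      ⊖-homo zero zero = sym (-‿inverseʳ 0#)
      ⊖-homo zero (suc n) = sym (+-identityˡ _)
      ⊖-homo (suc m) zero = sym (trans (+-congˡ -0#≈0#) (+-identityʳ _))
      ⊖-homo (suc m) (suc n) rewrite ℤ.[1+m]⊖[1+n]≡m⊖n m n =
        trans (⊖-homo m n) (trans (sym (+-interchange-neg (ι m) (ι n))) (sym (+-cong (1+× m 1#) (-‿cong (1+× n 1#)))))

      +-homo : ∀ i j → ⟦ i ℤ.+ j ⟧ ≈ ⟦ i ⟧ + ⟦ j ⟧
      +-homo (+ m) (+ n) = ×-homo-+ 1# m n
      +-homo (+ m) -[1+ n ] = ⊖-homo m (suc n)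
      +-homo -[1+ m ] (+ n) = trans (⊖-homo n (suc m)) (+-comm _ _)
      +-homo -[1+ m ] -[1+ n ] = begin
        - ι (suc (suc (m ℕ.+ n)))      ≈⟨ -‿cong (×-cong (≡.sym (≡.cong suc (ℕ.+-suc m n))) refl) ⟩
        - ι (suc m ℕ.+ suc n)          ≈⟨ -‿cong (×-homo-+ 1# (suc m) (suc n)) ⟩
        - (ι (suc m) + ι (suc n))      ≈⟨ -‿+-comm _ _ ⟨
        - ι (suc m) + - ι (suc n)      ∎
        where import Data.Nat.Properties as ℕ

      -‿homo : ∀ i → ⟦ ℤ.- i ⟧ ≈ - ⟦ i ⟧
      -‿homo (+ zero) = sym -0#≈0#
      -‿homo (+ suc n) = refl
      -‿homo -[1+ n ] = sym (-‿involutive _)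

      *-homo⁺ : ∀ m n → ⟦ + m ℤ.* + n ⟧ ≈ ι m * ι n
      *-homo⁺ m n rewrite ≡.sym (ℤ.pos-* m n) = ×1-homo-* m n

      *-homo : ∀ i j → ⟦ i ℤ.* j ⟧ ≈ ⟦ i ⟧ * ⟦ j ⟧
      *-homo (+ m) (+ n) = *-homo⁺ m n
      *-homo (+ m) -[1+ n ] rewrite ≡.sym (ℤ.neg-distribʳ-* (+ m) (+ suc n)) =
        trans (-‿homo (+ m ℤ.* + suc n)) (trans (-‿cong (*-homo⁺ m (suc n))) (-‿distribʳ-* _ _))
      *-homo -[1+ m ] (+ n) rewrite ≡.sym (ℤ.neg-distribˡ-* (+ suc m) (+ n)) =
        trans (-‿homo (+ suc m ℤ.* + n)) (trans (-‿cong (*-homo⁺ (suc m) n)) (-‿distribˡ-* _ _))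
      *-homo -[1+ m ] -[1+ n ] = begin
        ⟦ + suc m ℤ.* + suc n ⟧            ≈⟨ *-homo⁺ (suc m) (suc n) ⟩
        ι (suc m) * ι (suc n)              ≈⟨ -‿involutive _ ⟨
        - - (ι (suc m) * ι (suc n))        ≈⟨ -‿cong (-‿distribʳ-* _ _) ⟩
        - (ι (suc m) * - ι (suc n))        ≈⟨ -‿distribˡ-* _ _ ⟩
        - ι (suc m) * - ι (suc n)          ∎

      morphism : ℤ.+-*-rawRing -Raw-AlmostCommutative⟶ fromCommutativeRing R
      morphism = record
        { ⟦_⟧ = ⟦_⟧ ; +-homo = +-homo ; *-homo = *-homo ; -‿homo = -‿homo
        ; 0-homo = refl ; 1-homo = refl }

      _coeff≟_ : ∀ i j → Maybe (⟦ i ⟧ ≈ ⟦ j ⟧)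
      i coeff≟ j with i ℤ.≟ j
      ... | yes ≡.refl = just refl
      ... | no _ = nothing

    open import Algebra.Solver.Ring ℤ.+-*-rawRing (fromCommutativeRing R) morphism _coeff≟_ public

-- Finite cardinalities and the passage from sets to arrays.

module Counting where
  open import Defs
  open import Data.Nat as ℕ using (ℕ; zero; suc)
  import Data.Nat.Properties as ℕ
  open import Data.Fin as Fin using (Fin; zero; suc)
  import Data.Fin.Properties as Fin
  open import Data.Fin.Subset using (Subset; _∈_; _∩_; ∣_∣; inside; outside)
  open import Data.Fin.Subset.Properties using (_∈?_; x∈p∩q⁺; x∈p∩q⁻; drop-there)
  open import Data.Vec using ([]; _∷_; tabulate; here; there)
  open import Data.Vec.Properties using (lookup∘tabulate; []=⇒lookup; lookup⇒[]=)
  open import Data.Product using (∃; _×_; _,_; proj₁; proj₂)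
  open import Function using (_∘_; id)
  open import Function.Bundles using (_↔_; Inverse)
  open import Function.Properties.Inverse using (↔-refl; ↔-sym; ↔-trans)
  open import Data.Product.Function.NonDependent.Propositional using (_×-cong_)
  open import Relation.Nullary using (¬_; Dec; yes; no; does; contradiction)
  open import Relation.Nullary.Decidable using (dec-true)
  import Relation.Nullary.Decidable as Dec
  open import Relation.Unary using (Decidable)
  open import Relation.Binary.PropositionalEquality using (_≡_; _≢_; refl; sym; trans; cong; cong₂; subst)

  -- A bijection with the type of pairs (x , P x) would count proofs of P. Here distinctness
  -- concerns only the elements, so P may have several proofs at one element.
  record Size {X : Set} (P : X → Set) (n : ℕ) : Set where
    field
      elem : Fin n → X
      sound : ∀ i → P (elem i)
      injective : ∀ {i j} → elem i ≡ elem j → i ≡ j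
      complete : ∀ x → P x → ∃ λ i → elem i ≡ x

  open Size

  size-≤ : ∀ {X : Set} {P : X → Set} {m n} → Size P m → Size P n → m ℕ.≤ n
  size-≤ S T = Fin.injective⇒≤ {f = f} f-inj
    where
    f = λ i → proj₁ (complete T (elem S i) (sound S i))
    f-inj : ∀ {i j} → f i ≡ f j → i ≡ j
    f-inj {i} {j} eq = injective S (trans (sym (proj₂ (complete T _ (sound S i))))
      (trans (cong (elem T) eq) (proj₂ (complete T _ (sound S j)))))

  size-unique : ∀ {X : Set} {P : X → Set} {m n} → Size P m → Size P n → m ≡ n
  size-unique S T = ℕ.≤-antisym (size-≤ S T) (size-≤ T S)

  size-image : ∀ {A X : Set} {P : X → Set} {n} → Fin n ↔ A → (f : A → X) →
               (∀ a → P (f a)) → (∀ {a b} → f a ≡ f b → a ≡ b) →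
               (∀ x → P x → ∃ λ a → f a ≡ x) → Size P n
  size-image E f f-sound f-inj f-complete = record
    { elem = f ∘ to
    ; sound = f-sound ∘ to
    ; injective = λ {i} {j} eq → trans (sym (strictlyInverseʳ i))
        (trans (cong from (f-inj eq)) (strictlyInverseʳ j))
    ; complete = λ x Px → let a , fa≡x = f-complete x Px in
        from a , trans (cong f (strictlyInverseˡ a)) fa≡x
    }
    where open Inverse E

  size-one : ∀ {X : Set} {P : X → Set} (x : X) → P x → (∀ y → P y → x ≡ y) → Size P 1
  size-one x Px unique = record
    { elem = λ _ → x ; sound = λ _ → Px
    ; injective = λ { {zero} {zero} _ → refl }
    ; complete = λ y Py → zero , unique y Py }

  size-reindex : ∀ {X Y : Set} {P : X → Set} {Q : Y → Set} {n} (E : Y ↔ X) →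
                 (∀ y → P (Inverse.to E y) → Q y) → (∀ y → Q y → P (Inverse.to E y)) →
                 Size P n → Size Q n
  size-reindex {P = P} {Q} E P⇒Q Q⇒P S = record
    { elem = from ∘ elem S
    ; sound = λ i → P⇒Q _ (subst P (sym (strictlyInverseˡ _)) (sound S i))
    ; injective = λ eq → injective S
        (trans (sym (strictlyInverseˡ _)) (trans (cong to eq) (strictlyInverseˡ _)))
    ; complete = λ y Qy → let i , eq = complete S (to y) (Q⇒P y Qy) in
        i , trans (cong from eq) (strictlyInverseʳ y)
    }
    where open Inverse E

  size-⇔ : ∀ {X : Set} {P Q : X → Set} {n} →
           (∀ {x} → P x → Q x) → (∀ {x} → Q x → P x) → Size P n → Size Q n
  size-⇔ P⇒Q Q⇒P = size-reindex ↔-refl (λ _ → P⇒Q) (λ _ → Q⇒P)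

  private
    size-zero : {P : Fin 0 → Set} → Size P 0
    size-zero = record { elem = λ () ; sound = λ () ; injective = λ { {()} } ; complete = λ () }

    size-suc-yes : ∀ {m n} {P : Fin (suc m) → Set} → P zero → Size (P ∘ suc) n → Size P (suc n)
    size-suc-yes {P = P} P0 S = record
      { elem = f ; sound = λ { zero → P0 ; (suc i) → sound S i }
      ; injective = f-inj
      ; complete = λ { zero _ → zero , refl
                     ; (suc x) Px → let i , eq = complete S x Px in suc i , cong suc eq } }
      where
      f : Fin _ → Fin _
      f zero = zero
      f (suc i) = suc (elem S i)
      f-inj : ∀ {i j} → f i ≡ f j → i ≡ j
      f-inj {zero} {zero} _ = refl
      f-inj {zero} {suc j} ()
      f-inj {suc i} {zero} ()
      f-inj {suc i} {suc j} eq = cong suc (injective S (Fin.suc-injective eq))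

    size-suc-no : ∀ {m n} {P : Fin (suc m) → Set} → ¬ P zero → Size (P ∘ suc) n → Size P n
    size-suc-no ¬P0 S = record
      { elem = suc ∘ elem S ; sound = sound S
      ; injective = injective S ∘ Fin.suc-injective
      ; complete = λ { zero P0 → contradiction P0 ¬P0
                     ; (suc x) Px → let i , eq = complete S x Px in i , cong suc eq } }

  -- Links `∣_∣` to enumerations: by `size-unique`, any other enumeration of the same subset then
  -- computes its cardinality.
  size-∣∣ : ∀ {v} (S : Subset v) → Size (_∈ S) ∣ S ∣
  size-∣∣ [] = size-zero
  size-∣∣ (inside ∷ S) = size-suc-yes here (size-⇔ there drop-there (size-∣∣ S))
  size-∣∣ (outside ∷ S) = size-suc-no (λ ()) (size-⇔ there drop-there (size-∣∣ S))

  size-count : ∀ {v m} (F : Fin m → Subset v) x → Size (λ i → x ∈ F i) (count F x)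
  size-count {m = zero} F x = size-zero
  size-count {m = suc m} F x with x ∈? F zero
  ... | yes x∈F = size-suc-yes x∈F (size-count (F ∘ suc) x)
  ... | no x∉F = size-suc-no x∉F (size-count (F ∘ suc) x)

  ⟪_⟫ : ∀ {v} {P : Fin v → Set} → Decidable P → Subset v
  ⟪ P? ⟫ = tabulate (does ∘ P?)

  ∈⟪⟫⁺ : ∀ {v} {P : Fin v → Set} (P? : Decidable P) {i} → P i → i ∈ ⟪ P? ⟫
  ∈⟪⟫⁺ P? {i} Pi = lookup⇒[]= i ⟪ P? ⟫ (trans (lookup∘tabulate (does ∘ P?) i) (dec-true (P? i) Pi))

  ∈⟪⟫⁻ : ∀ {v} {P : Fin v → Set} (P? : Decidable P) {i} → i ∈ ⟪ P? ⟫ → P i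
  ∈⟪⟫⁻ P? {i} i∈ with P? i | trans (sym (lookup∘tabulate (does ∘ P?) i)) ([]=⇒lookup i∈)
  ... | yes Pi | _ = Pi
  ... | no _ | ()

  -- Lets symbols, rows and columns live in arbitrary enumerated types. Every number in the record
  -- is found by comparing two enumerations of one set.
  tripleArray : ∀ {X Row Col : Set} {r c v e λrc λrr λcc}
    (symbols : Fin v ↔ X) (rows : Fin r ↔ Row) (cols : Fin c ↔ Col)
    {R : Row → X → Set} {C : Col → X → Set} →
    (∀ i → Decidable (R i)) → (∀ j → Decidable (C j)) →
    (∀ i → Size (R i) c) → (∀ j → Size (C j) r) →
    (∀ x → Size (λ i → R i x) e) → (∀ x → Size (λ j → C j x) e) →
    (∀ i j → Size (λ x → R i x × C j x) λrc) →
    (∀ i s → i ≢ s → Size (λ x → R i x × R s x) λrr) →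
    (∀ j t → j ≢ t → Size (λ x → C j x × C t x) λcc) →
    UnorderedTripleArray r c v
  tripleArray {X} {e = e} {λrc} {λrr} {λcc} symbols rows cols {R} {C} R? C? R-size C-size R-rep C-rep RC RR CC = record
    { R = λ i → set (R? (row i)) ; C = λ j → set (C? (col j))
    ; R-size = λ i → card (R? (row i)) (R-size (row i))
    ; C-size = λ j → card (C? (col j)) (C-size (col j))
    ; e = e ; λrc = λrc ; λrr = λrr ; λcc = λcc
    ; rowRep = λ x → rep rows R R? x (R-rep (sym′ x))
    ; colRep = λ x → rep cols C C? x (C-rep (sym′ x))
    ; rc-int = λ i j → card-∩ (R? (row i)) (C? (col j)) (RC (row i) (col j))
    ; rr-int = λ i s i≢s → card-∩ (R? (row i)) (R? (row s)) (RR (row i) (row s) (i≢s ∘ to-injective rows))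
    ; cc-int = λ j t j≢t → card-∩ (C? (col j)) (C? (col t)) (CC (col j) (col t) (j≢t ∘ to-injective cols))
    }
    where
    sym′ = Inverse.to symbols
    row = Inverse.to rows
    col = Inverse.to cols

    to-injective : ∀ {n} {A : Set} (E : Fin n ↔ A) {i j} → Inverse.to E i ≡ Inverse.to E j → i ≡ j
    to-injective E eq = trans (sym (strictlyInverseʳ _)) (trans (cong from eq) (strictlyInverseʳ _))
      where open Inverse E

    set : {P : X → Set} → Decidable P → Subset _
    set P? = ⟪ P? ∘ sym′ ⟫

    card : ∀ {P : X → Set} {n} (P? : Decidable P) → Size P n → ∣ set P? ∣ ≡ n
    card P? S = size-unique (size-∣∣ (set P?))
      (size-reindex symbols (λ _ → ∈⟪⟫⁺ (P? ∘ sym′)) (λ _ → ∈⟪⟫⁻ (P? ∘ sym′)) S)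

    card-∩ : ∀ {P Q : X → Set} {n} (P? : Decidable P) (Q? : Decidable Q) →
             Size (λ x → P x × Q x) n → ∣ set P? ∩ set Q? ∣ ≡ n
    card-∩ P? Q? S = size-unique (size-∣∣ (set P? ∩ set Q?))
      (size-reindex symbols
        (λ _ (p , q) → x∈p∩q⁺ (∈⟪⟫⁺ (P? ∘ sym′) p , ∈⟪⟫⁺ (Q? ∘ sym′) q))
        (λ _ i∈ → let p , q = x∈p∩q⁻ (set P?) (set Q?) i∈ in
          ∈⟪⟫⁻ (P? ∘ sym′) p , ∈⟪⟫⁻ (Q? ∘ sym′) q) S)

    rep : ∀ {n m} {A : Set} (E : Fin n ↔ A) (P : A → X → Set) (P? : ∀ a → Decidable (P a)) x →
          Size (λ a → P a (sym′ x)) m → count (λ i → set (P? (Inverse.to E i))) x ≡ m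
    rep E P P? x S = size-unique (size-count (λ i → set (P? (Inverse.to E i))) x)
      (size-reindex E (λ i → ∈⟪⟫⁺ (P? (Inverse.to E i) ∘ sym′))
                      (λ i → ∈⟪⟫⁻ (P? (Inverse.to E i) ∘ sym′)) S)

  -- A triple array from a projective plane and a resolvable design.

  record ProjectivePlane (n e : ℕ) : Set₁ where
    infix 4 _on_ _on?_
    field
      Point Line : Set
      points : Fin n ↔ Point
      lines : Fin n ↔ Line
      _on_ : Point → Line → Set
      _on?_ : ∀ p l → Dec (p on l)
      line-size : ∀ l → Size (_on l) e
      pencil-size : ∀ p → Size (p on_) e
      meet : ∀ l l′ → l ≢ l′ → Size (λ p → p on l × p on l′) 1

  -- A class is given by the function sending each point to the label of its block, so it partitions
  -- the points by construction. A block is a pair of a class and a label.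
  record ResolvedDesign (n s c e : ℕ) : Set₁ where
    field
      Class Label Point : Set
      classes : Fin n ↔ Class
      labels : Fin s ↔ Label
      points : Fin c ↔ Point
      block : Class → Point → Label
      block-size : ∀ m x → Size (λ P → block m P ≡ x) e
      join : ∀ P P′ → P ≢ P′ → Size (λ m → block m P ≡ block m P′) 1

  size-× : ∀ {A B : Set} {P : A → Set} {m n} → Size P m → Fin n ↔ B →
           Size {A × B} (P ∘ proj₁) (m ℕ.* n)
  size-× S E = size-image (↔-trans Fin.*↔× (↔-refl ×-cong E))
    (λ (i , b) → elem S i , b) (λ (i , _) → sound S i)
    (λ eq → cong₂ _,_ (injective S (cong proj₁ eq)) (cong proj₂ eq))
    (λ (a , b) Pa → let i , eq = complete S a Pa in (i , b) , cong (_, b) eq)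

  size-graph : ∀ {A B : Set} {P : A → Set} {m} (f : A → B) → Size P m →
               Size {A × B} (λ (a , b) → P a × f a ≡ b) m
  size-graph f S = size-image ↔-refl
    (λ i → elem S i , f (elem S i)) (λ i → sound S i , refl)
    (injective S ∘ cong proj₁)
    (λ { (a , _) (Pa , refl) → let i , eq = complete S a Pa in i , cong (λ a → a , f a) eq })

  ≟-via : ∀ {n} {A : Set} → Fin n ↔ A → (x y : A) → Dec (x ≡ y)
  ≟-via E x y = Dec.map′ (λ eq → trans (sym (strictlyInverseˡ x)) (trans (cong to eq) (strictlyInverseˡ y)))
    (cong from) (from x Fin.≟ from y)
    where open Inverse E

  -- Symbols are the pairs (class, label). A column is the graph of `λ m → block m P`, so counting
  -- in it means counting classes. A row consists of all pairs over the points of a line, so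
  -- counting in rows means counting points of the plane and multiplying by s.
  plane×design⇒tripleArray : ∀ {n s c e} → ProjectivePlane n e → ResolvedDesign n s c e →
                             e ℕ.* s ≡ c → UnorderedTripleArray n c (n ℕ.* s)
  plane×design⇒tripleArray {n} {s} {c} {e} plane design es≡c = tripleArray
    (↔-trans Fin.*↔× (classes ×-cong labels)) lines points
    {R = λ l (m , _) → pt m on l} {C = λ P (m , x) → block m P ≡ x}
    (λ l (m , _) → pt m on? l) (λ P (m , x) → ≟-via labels (block m P) x)
    (λ l → subst (Size _) es≡c (size-× (on-line l) labels))
    (λ P → size-⇔ proj₂ (λ eq → refl , eq) (size-graph (λ m → block m P) all-classes))
    (λ (m , _) → pencil-size (pt m))
    (λ (m , x) → block-size m x)
    (λ l P → size-graph (λ m → block m P) (on-line l))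
    (λ l l′ l≢l′ → size-× (size-reindex E (λ _ → id) (λ _ → id) (meet l l′ l≢l′)) labels)
    (λ P P′ P≢P′ → size-⇔ (λ (eq , eq′) → eq′ , trans (sym eq) eq′) (λ (eq , eq′) → trans eq (sym eq′) , eq)
       (size-graph (λ m → block m P) (join P P′ P≢P′)))
    where
    open ProjectivePlane plane hiding (points)
    open ResolvedDesign design hiding (Point)
    E : Class ↔ Point
    E = ↔-trans (↔-sym classes) (ProjectivePlane.points plane)
    pt = Inverse.to E
    on-line : ∀ l → Size (λ m → pt m on l) e
    on-line l = size-reindex E (λ _ → id) (λ _ → id) (line-size l)
    all-classes : Size {Class} (λ m → m ≡ m) n
    all-classes = size-image classes id (λ _ → refl) id (λ m _ → m , refl)

-- Fields with decidable equality.

module Fields where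
  open Solver
  open import Algebra.Bundles using (CommutativeRing)
  open import Algebra.Structures using (IsCommutativeRing)
  open import Data.Sum using (_⊎_; inj₁; inj₂)
  open import Data.Product using (_×_; _,_)
  open import Function using (_∘_)
  open import Function.Bundles using (_↔_; mk↔ₛ′)
  open import Relation.Nullary using (Dec; yes; no)
  open import Relation.Binary.PropositionalEquality
  open import Relation.Nullary.Decidable using (_×-dec_; map′)
  open import Level using (0ℓ)
  import Data.Integer as ℤ

  record Field : Set₁ where
    infix 8 -_ _⁻¹
    infixl 7 _*_
    infixl 6 _+_
    infix 4 _≟_
    field
      Carrier : Set
      _+_ _*_ : Carrier → Carrier → Carrier
      -_ _⁻¹ : Carrier → Carrier
      0# 1# : Carrier
      isCommutativeRing : IsCommutativeRing _≡_ _+_ _*_ -_ 0# 1#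
      inverseʳ : ∀ {x} → x ≢ 0# → x * x ⁻¹ ≡ 1#
      1≢0 : 1# ≢ 0#
      _≟_ : (x y : Carrier) → Dec (x ≡ y)

  module FieldProperties (𝔽 : Field) where
    open Field 𝔽 public

    commutativeRing : CommutativeRing 0ℓ 0ℓ
    commutativeRing = record { isCommutativeRing = isCommutativeRing }

    open CommutativeRing commutativeRing public
      using (+-assoc; +-comm; +-identityˡ; +-identityʳ; *-assoc; *-comm; *-identityˡ; *-identityʳ;
             zeroˡ; zeroʳ; distribˡ; distribʳ; -‿inverseˡ; -‿inverseʳ; _-_)
    open IntegerSolver commutativeRing public using (solve; _:+_; _:*_; _:-_; :-_; _:=_; con)
    open ≡-Reasoning

    x-y≡0⇒x≡y : ∀ {x y} → x - y ≡ 0# → x ≡ y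
    x-y≡0⇒x≡y {x} {y} eq = begin
      x            ≡⟨ solve 2 (λ x y → x := x :- y :+ y) refl x y ⟩
      x - y + y    ≡⟨ cong (_+ y) eq ⟩
      0# + y       ≡⟨ +-identityˡ y ⟩
      y            ∎

    x≡y⇒x-y≡0 : ∀ {x y} → x ≡ y → x - y ≡ 0#
    x≡y⇒x-y≡0 {x} refl = -‿inverseʳ x

    *-cancelʳ : ∀ {x y z} → z ≢ 0# → x * z ≡ y * z → x ≡ y
    *-cancelʳ {x} {y} {z} z≢0 eq = begin
      x                ≡⟨ *-identityʳ x ⟨
      x * 1#           ≡⟨ cong (x *_) (inverseʳ z≢0) ⟨
      x * (z * z ⁻¹)   ≡⟨ *-assoc x z _ ⟨
      x * z * z ⁻¹     ≡⟨ cong (_* z ⁻¹) eq ⟩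
      y * z * z ⁻¹     ≡⟨ *-assoc y z _ ⟩
      y * (z * z ⁻¹)   ≡⟨ cong (y *_) (inverseʳ z≢0) ⟩
      y * 1#           ≡⟨ *-identityʳ y ⟩
      y                ∎

    *-cancelˡ : ∀ {x y z} → z ≢ 0# → z * x ≡ z * y → x ≡ y
    *-cancelˡ {x} {y} {z} z≢0 eq = *-cancelʳ z≢0 (trans (*-comm x z) (trans eq (*-comm z y)))

    *-nonzero : ∀ {x y} → x ≢ 0# → y ≢ 0# → x * y ≢ 0#
    *-nonzero {x} {y} x≢0 y≢0 eq = x≢0 (*-cancelʳ y≢0 (trans eq (sym (zeroˡ y))))

    ⁻¹-nonzero : ∀ {x} → x ≢ 0# → x ⁻¹ ≢ 0#
    ⁻¹-nonzero {x} x≢0 eq = 1≢0 (trans (sym (inverseʳ x≢0)) (trans (cong (x *_) eq) (zeroʳ x)))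

    x*y≡0⇒y≡0 : ∀ {x y} → x ≢ 0# → x * y ≡ 0# → y ≡ 0#
    x*y≡0⇒y≡0 {x} x≢0 eq = *-cancelˡ x≢0 (trans eq (sym (zeroʳ x)))

    [x*y⁻¹]*y≡x : ∀ x {y} → y ≢ 0# → x * y ⁻¹ * y ≡ x
    [x*y⁻¹]*y≡x x {y} y≢0 = trans (*-assoc x _ y)
      (trans (cong (x *_) (trans (*-comm _ y) (inverseʳ y≢0))) (*-identityʳ x))

    x²≡y²⇒ : ∀ {x y} → x * x ≡ y * y → x ≡ y ⊎ x ≡ - y
    x²≡y²⇒ {x} {y} eq with x ≟ y
    ... | yes x≡y = inj₁ x≡y
    ... | no x≢y = inj₂ (x-y≡0⇒x≡y (x*y≡0⇒y≡0 (x≢y ∘ x-y≡0⇒x≡y)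
      (trans (solve 2 (λ x y → (x :- y) :* (x :- (:- y)) := x :* x :- y :* y) refl x y) (x≡y⇒x-y≡0 eq))))

    -- The identities from here on are stated for an abstract field, so that they apply to a base
    -- field and to its quadratic extension alike.
    *-interchange : ∀ x y z t → x * y * (z * t) ≡ x * z * (y * t)
    *-interchange = solve 4 (λ x y z t → x :* y :* (z :* t) := x :* z :* (y :* t)) refl

    xyz≡xzy : ∀ x y z → x * y * z ≡ x * z * y
    xyz≡xzy = solve 3 (λ x y z → x :* y :* z := x :* z :* y) refl

    xyz≡y[xz] : ∀ x y z → x * y * z ≡ y * (x * z)
    xyz≡y[xz] = solve 3 (λ x y z → x :* y :* z := y :* (x :* z)) refl

    x-[x+y]≡-y : ∀ x y → x - (x + y) ≡ - y
    x-[x+y]≡-y = solve 2 (λ x y → x :- (x :+ y) := :- y) refl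

    y≡x+y-x : ∀ x y → y ≡ x + y - x
    y≡x+y-x = solve 2 (λ x y → y := x :+ y :- x) refl

    x+y-x≡y : ∀ x y → x + y - x ≡ y
    x+y-x≡y = solve 2 (λ x y → x :+ y :- x := y) refl

    x+y-y≡x : ∀ x y → x + y - y ≡ x
    x+y-y≡x = solve 2 (λ x y → x :+ y :- y := x) refl

    x≡x-y+y : ∀ x y → x ≡ x - y + y
    x≡x-y+y = solve 2 (λ x y → x := x :- y :+ y) refl

    x-y+y≡x : ∀ x y → x - y + y ≡ x
    x-y+y≡x = solve 2 (λ x y → x :- y :+ y := x) refl

    y[xz]≡xyz : ∀ x y z → y * (x * z) ≡ x * y * z
    y[xz]≡xyz = solve 3 (λ x y z → y :* (x :* z) := x :* y :* z) refl

    yxz≡xyz : ∀ x y z → y * x * z ≡ x * y * z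
    yxz≡xyz = solve 3 (λ x y z → y :* x :* z := x :* y :* z) refl

    [x-y]z≡xz-yz : ∀ x y z → (x - y) * z ≡ x * z - y * z
    [x-y]z≡xz-yz = solve 3 (λ x y z → (x :- y) :* z := x :* z :- y :* z) refl

    x[zy]≡xyz : ∀ x y z → x * (z * y) ≡ x * y * z
    x[zy]≡xyz = solve 3 (λ x y z → x :* (z :* y) := x :* y :* z) refl

    affine-difference : ∀ s a b x y z → s * (a + b * (x * z)) - s * (a + b * (y * z)) ≡ s * (b * (x - y)) * z
    affine-difference = solve 6 (λ s a b x y z → s :* (a :+ b :* (x :* z)) :- s :* (a :+ b :* (y :* z)) := s :* (b :* (x :- y)) :* z) refl

    x-z≡x-y-z+y : ∀ x y z → x - z ≡ x - y - z + y
    x-z≡x-y-z+y = solve 3 (λ x y z → x :- z := x :- y :- z :+ y) refl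

    x+y-y+z≡x+z : ∀ x y z → x + y - y + z ≡ x + z
    x+y-y+z≡x+z = solve 3 (λ x y z → x :+ y :- y :+ z := x :+ z) refl

    yz-t≡xz-t-[x-y]z : ∀ x y z t → y * z - t ≡ x * z - t - (x - y) * z
    yz-t≡xz-t-[x-y]z = solve 4 (λ x y z t → y :* z :- t := x :* z :- t :- (x :- y) :* z) refl

    x+y-[y-z]≡x+z : ∀ x y z → x + y - (y - z) ≡ x + z
    x+y-[y-z]≡x+z = solve 3 (λ x y z → x :+ y :- (y :- z) := x :+ z) refl

    [x-y]z≡[xz-t]-[yz-t] : ∀ x y z t → (x - y) * z ≡ (x * z - t) - (y * z - t)
    [x-y]z≡[xz-t]-[yz-t] = solve 4 (λ x y z t → (x :- y) :* z := (x :* z :- t) :- (y :* z :- t)) refl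

    [x+y]-[x+z]≡y-z : ∀ x y z → (x + y) - (x + z) ≡ y - z
    [x+y]-[x+z]≡y-z = solve 3 (λ x y z → (x :+ y) :- (x :+ z) := y :- z) refl

  -- The quadratic extension by a root of T² = τ T + μ.

  module QuadraticExtension (𝔽 : Field) (τ μ : Field.Carrier 𝔽)
    (irreducible : ∀ t → Field._*_ 𝔽 t t ≢ Field._+_ 𝔽 (Field._*_ 𝔽 τ t) μ) where
    private module F = FieldProperties 𝔽
    open F using (solve; _:+_; _:*_; _:-_; :-_; _:=_; con)
    open ≡-Reasoning

    -- `⟦ a , b ⟧` stands for a + b ω with ω² = τ ω + μ. The other root is τ - ω, whence the formula
    -- for `conj`, and `norm z` is z times its conjugate. The linear term is there for
    -- characteristic 2, where finite fields have no nonsquares.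
    data K : Set where
      ⟦_,_⟧ : F.Carrier → F.Carrier → K

    re im : K → F.Carrier
    re ⟦ a , _ ⟧ = a
    im ⟦ _ , b ⟧ = b

    infix 8 -ᴷ_ _⁻¹ᴷ
    infixl 7 _*ᴷ_
    infixl 6 _+ᴷ_

    _+ᴷ_ _*ᴷ_ : K → K → K
    ⟦ a , b ⟧ +ᴷ ⟦ c , d ⟧ = ⟦ a F.+ c , b F.+ d ⟧
    ⟦ a , b ⟧ *ᴷ ⟦ c , d ⟧ = ⟦ a F.* c F.+ μ F.* (b F.* d) , a F.* d F.+ b F.* c F.+ τ F.* (b F.* d) ⟧

    -ᴷ_ conj : K → K
    -ᴷ ⟦ a , b ⟧ = ⟦ F.- a , F.- b ⟧
    conj ⟦ a , b ⟧ = ⟦ a F.+ τ F.* b , F.- b ⟧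

    ι : F.Carrier → K
    ι a = ⟦ a , F.0# ⟧

    norm : K → F.Carrier
    norm ⟦ a , b ⟧ = a F.* a F.+ τ F.* (a F.* b) F.- μ F.* (b F.* b)

    -- If b ≠ 0, dividing a vanishing norm by b² shows that -a/b is a root of T² = τ T + μ. If b =
    -- 0, the norm is a².
    norm≢0 : ∀ {z} → z ≢ ι F.0# → norm z ≢ F.0#
    norm≢0 {⟦ a , b ⟧} z≢0 N≡0 with b F.≟ F.0#
    ... | yes refl = z≢0 (cong ι a≡0)
      where
      a²≡0 : a F.* a ≡ F.0#
      a²≡0 = trans (trans (solve 4 (λ a b t m → a :* a := a :* a :+ t :* (a :* con (ℤ.+ 0)) :- m :* (con (ℤ.+ 0) :* con (ℤ.+ 0))) refl a F.0# τ μ) N≡0) refl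
      a≡0 : a ≡ F.0#
      a≡0 with a F.≟ F.0#
      ... | yes eq = eq
      ... | no a≢0 = F.x*y≡0⇒y≡0 a≢0 a²≡0
    ... | no b≢0 = irreducible t (F.x-y≡0⇒x≡y eq)
      where
      t = F.- (a F.* b F.⁻¹)
      a≡ : a ≡ F.- (t F.* b)
      a≡ = trans (sym (F.[x*y⁻¹]*y≡x a b≢0)) (solve 2 (λ c b → c :* b := :- (:- c :* b)) refl (a F.* b F.⁻¹) b)
      eq : t F.* t F.- (τ F.* t F.+ μ) ≡ F.0#
      eq = F.x*y≡0⇒y≡0 (F.*-nonzero b≢0 b≢0) (begin
        b F.* b F.* (t F.* t F.- (τ F.* t F.+ μ))
          ≡⟨ solve 4 (λ b t τ μ → b :* b :* (t :* t :- (τ :* t :+ μ)) :=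
               (:- (t :* b)) :* (:- (t :* b)) :+ τ :* ((:- (t :* b)) :* b) :- μ :* (b :* b)) refl b t τ μ ⟩
        norm ⟦ F.- (t F.* b) , b ⟧     ≡⟨ cong (λ a → norm ⟦ a , b ⟧) a≡ ⟨
        norm ⟦ a , b ⟧                 ≡⟨ N≡0 ⟩
        F.0#                         ∎)

    _⁻¹ᴷ : K → K
    z ⁻¹ᴷ = conj z *ᴷ ι (norm z F.⁻¹)

    *ᴷ-conj : ∀ z → z *ᴷ conj z ≡ ι (norm z)
    *ᴷ-conj ⟦ a , b ⟧ = cong₂ ⟦_,_⟧
      (solve 4 (λ a b τ μ → a :* (a :+ τ :* b) :+ μ :* (b :* (:- b)) := a :* a :+ τ :* (a :* b) :- μ :* (b :* b)) refl a b τ μ)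
      (solve 4 (λ a b τ μ → a :* (:- b) :+ b :* (a :+ τ :* b) :+ τ :* (b :* (:- b)) := con (ℤ.+ 0)) refl a b τ μ)

    *ᴷ-assoc : ∀ x y z → (x *ᴷ y) *ᴷ z ≡ x *ᴷ (y *ᴷ z)
    *ᴷ-assoc ⟦ a , b ⟧ ⟦ c , d ⟧ ⟦ e , f ⟧ = cong₂ ⟦_,_⟧
      (solve 8 (λ a b c d e f τ μ →
        (a :* c :+ μ :* (b :* d)) :* e :+ μ :* ((a :* d :+ b :* c :+ τ :* (b :* d)) :* f) :=
        a :* (c :* e :+ μ :* (d :* f)) :+ μ :* (b :* (c :* f :+ d :* e :+ τ :* (d :* f)))) refl a b c d e f τ μ)
      (solve 8 (λ a b c d e f τ μ →
        (a :* c :+ μ :* (b :* d)) :* f :+ (a :* d :+ b :* c :+ τ :* (b :* d)) :* e :+ τ :* ((a :* d :+ b :* c :+ τ :* (b :* d)) :* f) :=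
        a :* (c :* f :+ d :* e :+ τ :* (d :* f)) :+ b :* (c :* e :+ μ :* (d :* f)) :+ τ :* (b :* (c :* f :+ d :* e :+ τ :* (d :* f)))) refl a b c d e f τ μ)

    private
      0ᴷ = ι F.0#
      1ᴷ = ι F.1#

    *ᴷ-comm : ∀ x y → x *ᴷ y ≡ y *ᴷ x
    *ᴷ-comm ⟦ a , b ⟧ ⟦ c , d ⟧ = cong₂ ⟦_,_⟧
      (solve 5 (λ a b c d μ → a :* c :+ μ :* (b :* d) := c :* a :+ μ :* (d :* b)) refl a b c d μ)
      (solve 5 (λ a b c d τ → a :* d :+ b :* c :+ τ :* (b :* d) := c :* b :+ d :* a :+ τ :* (d :* b)) refl a b c d τ)

    ι-* : ∀ f a b → ι f *ᴷ ⟦ a , b ⟧ ≡ ⟦ f F.* a , f F.* b ⟧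
    ι-* f a b = cong₂ ⟦_,_⟧
      (solve 4 (λ f a b μ → f :* a :+ μ :* (con (ℤ.+ 0) :* b) := f :* a) refl f a b μ)
      (solve 4 (λ f a b τ → f :* b :+ con (ℤ.+ 0) :* a :+ τ :* (con (ℤ.+ 0) :* b) := f :* b) refl f a b τ)

    *ᴷ-identityˡ : ∀ x → 1ᴷ *ᴷ x ≡ x
    *ᴷ-identityˡ ⟦ a , b ⟧ = trans (ι-* F.1# a b) (cong₂ ⟦_,_⟧ (F.*-identityˡ a) (F.*-identityˡ b))

    *ᴷ-distribˡ : ∀ x y z → x *ᴷ (y +ᴷ z) ≡ x *ᴷ y +ᴷ x *ᴷ z
    *ᴷ-distribˡ ⟦ a , b ⟧ ⟦ c , d ⟧ ⟦ e , f ⟧ = cong₂ ⟦_,_⟧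
      (solve 7 (λ a b c d e f μ → a :* (c :+ e) :+ μ :* (b :* (d :+ f)) :=
        (a :* c :+ μ :* (b :* d)) :+ (a :* e :+ μ :* (b :* f))) refl a b c d e f μ)
      (solve 7 (λ a b c d e f τ → a :* (d :+ f) :+ b :* (c :+ e) :+ τ :* (b :* (d :+ f)) :=
        (a :* d :+ b :* c :+ τ :* (b :* d)) :+ (a :* f :+ b :* e :+ τ :* (b :* f))) refl a b c d e f τ)

    _≟ᴷ_ : (x y : K) → Dec (x ≡ y)
    ⟦ a , b ⟧ ≟ᴷ ⟦ c , d ⟧ = map′ (λ (p , q) → cong₂ ⟦_,_⟧ p q) (λ eq → cong re eq , cong im eq)
      ((a F.≟ c) ×-dec (b F.≟ d))

    field-K : Field
    field-K = record
      { Carrier = K ; _+_ = _+ᴷ_ ; _*_ = _*ᴷ_ ; -_ = -ᴷ_ ; _⁻¹ = _⁻¹ᴷ ; 0# = 0ᴷ ; 1# = 1ᴷ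
      ; isCommutativeRing = record
        { isRing = record
          { +-isAbelianGroup = record
            { isGroup = record
              { isMonoid = record
                { isSemigroup = record
                  { isMagma = record { isEquivalence = isEquivalence ; ∙-cong = cong₂ _+ᴷ_ }
                  ; assoc = λ { ⟦ a , b ⟧ ⟦ c , d ⟧ ⟦ e , f ⟧ → cong₂ ⟦_,_⟧ (F.+-assoc a c e) (F.+-assoc b d f) } }
                ; identity = (λ { ⟦ a , b ⟧ → cong₂ ⟦_,_⟧ (F.+-identityˡ a) (F.+-identityˡ b) })
                           , (λ { ⟦ a , b ⟧ → cong₂ ⟦_,_⟧ (F.+-identityʳ a) (F.+-identityʳ b) }) }
              ; inverse = (λ { ⟦ a , b ⟧ → cong₂ ⟦_,_⟧ (F.-‿inverseˡ a) (F.-‿inverseˡ b) })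
                        , (λ { ⟦ a , b ⟧ → cong₂ ⟦_,_⟧ (F.-‿inverseʳ a) (F.-‿inverseʳ b) })
              ; ⁻¹-cong = cong -ᴷ_ }
            ; comm = λ { ⟦ a , b ⟧ ⟦ c , d ⟧ → cong₂ ⟦_,_⟧ (F.+-comm a c) (F.+-comm b d) } }
          ; *-cong = cong₂ _*ᴷ_
          ; *-assoc = *ᴷ-assoc
          ; *-identity = *ᴷ-identityˡ , λ x → trans (*ᴷ-comm x 1ᴷ) (*ᴷ-identityˡ x)
          ; distrib = *ᴷ-distribˡ
                    , λ x y z → trans (*ᴷ-comm (y +ᴷ z) x)
                        (trans (*ᴷ-distribˡ x y z) (cong₂ _+ᴷ_ (*ᴷ-comm x y) (*ᴷ-comm x z))) }
        ; *-comm = *ᴷ-comm }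
      ; inverseʳ = λ {z} z≢0 → begin
          z *ᴷ (conj z *ᴷ ι (norm z F.⁻¹))    ≡⟨ *ᴷ-assoc z _ _ ⟨
          (z *ᴷ conj z) *ᴷ ι (norm z F.⁻¹)    ≡⟨ cong (_*ᴷ ι (norm z F.⁻¹)) (*ᴷ-conj z) ⟩
          ι (norm z) *ᴷ ι (norm z F.⁻¹)       ≡⟨ ι-* (norm z) _ _ ⟩
          ⟦ norm z F.* norm z F.⁻¹ , norm z F.* F.0# ⟧
            ≡⟨ cong₂ ⟦_,_⟧ (F.inverseʳ (norm≢0 z≢0)) (F.zeroʳ _) ⟩
          1ᴷ                                  ∎
      ; 1≢0 = F.1≢0 ∘ cong re
      ; _≟_ = _≟ᴷ_ }

    conj-* : ∀ x y → conj (x *ᴷ y) ≡ conj x *ᴷ conj y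
    conj-* ⟦ a , b ⟧ ⟦ c , d ⟧ = cong₂ ⟦_,_⟧
      (solve 6 (λ a b c d τ μ → a :* c :+ μ :* (b :* d) :+ τ :* (a :* d :+ b :* c :+ τ :* (b :* d)) :=
        (a :+ τ :* b) :* (c :+ τ :* d) :+ μ :* ((:- b) :* (:- d))) refl a b c d τ μ)
      (solve 6 (λ a b c d τ μ → :- (a :* d :+ b :* c :+ τ :* (b :* d)) :=
        (a :+ τ :* b) :* (:- d) :+ (:- b) :* (c :+ τ :* d) :+ τ :* ((:- b) :* (:- d))) refl a b c d τ μ)

    conj-involutive : ∀ x → conj (conj x) ≡ x
    conj-involutive ⟦ a , b ⟧ = cong₂ ⟦_,_⟧
      (solve 3 (λ a b τ → a :+ τ :* b :+ τ :* (:- b) := a) refl a b τ)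
      (solve 1 (λ b → :- (:- b) := b) refl b)

    conj-ι : ∀ f → conj (ι f) ≡ ι f
    conj-ι f = cong₂ ⟦_,_⟧
      (solve 2 (λ f τ → f :+ τ :* con (ℤ.+ 0) := f) refl f τ)
      (solve 0 (:- con (ℤ.+ 0) := con (ℤ.+ 0)) refl)

    norm-conj : ∀ z → norm (conj z) ≡ norm z
    norm-conj ⟦ a , b ⟧ =
      solve 4 (λ a b τ μ → (a :+ τ :* b) :* (a :+ τ :* b) :+ τ :* ((a :+ τ :* b) :* (:- b)) :- μ :* ((:- b) :* (:- b)) :=
        a :* a :+ τ :* (a :* b) :- μ :* (b :* b)) refl a b τ μ

    norm-neg : ∀ z → norm (-ᴷ z) ≡ norm z
    norm-neg ⟦ a , b ⟧ =
      solve 4 (λ a b τ μ → (:- a) :* (:- a) :+ τ :* ((:- a) :* (:- b)) :- μ :* ((:- b) :* (:- b)) :=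
        a :* a :+ τ :* (a :* b) :- μ :* (b :* b)) refl a b τ μ

    norm-* : ∀ x y → norm (x *ᴷ y) ≡ norm x F.* norm y
    norm-* ⟦ a , b ⟧ ⟦ c , d ⟧ =
      solve 6 (λ a b c d τ μ →
        (a :* c :+ μ :* (b :* d)) :* (a :* c :+ μ :* (b :* d))
          :+ τ :* ((a :* c :+ μ :* (b :* d)) :* (a :* d :+ b :* c :+ τ :* (b :* d)))
          :- μ :* ((a :* d :+ b :* c :+ τ :* (b :* d)) :* (a :* d :+ b :* c :+ τ :* (b :* d))) :=
        (a :* a :+ τ :* (a :* b) :- μ :* (b :* b)) :* (c :* c :+ τ :* (c :* d) :- μ :* (d :* d))) refl a b c d τ μ

    K↔F×F : (F.Carrier × F.Carrier) ↔ K
    K↔F×F = mk↔ₛ′ (λ (a , b) → ⟦ a , b ⟧) (λ z → re z , im z) (λ { ⟦ a , b ⟧ → refl }) (λ _ → refl)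

    K-ext : ∀ {x y} → re x ≡ re y → im x ≡ im y → x ≡ y
    K-ext {⟦ _ , _ ⟧} {⟦ _ , _ ⟧} = cong₂ ⟦_,_⟧

    re-+ : ∀ x y → re (x +ᴷ y) ≡ re x F.+ re y
    re-+ ⟦ _ , _ ⟧ ⟦ _ , _ ⟧ = refl

    im-+ : ∀ x y → im (x +ᴷ y) ≡ im x F.+ im y
    im-+ ⟦ _ , _ ⟧ ⟦ _ , _ ⟧ = refl

    im-neg : ∀ x → im (-ᴷ x) ≡ F.- im x
    im-neg ⟦ _ , _ ⟧ = refl

    re-ι* : ∀ f z → re (ι f *ᴷ z) ≡ f F.* re z
    re-ι* f ⟦ a , b ⟧ = cong re (ι-* f a b)

    im-ι* : ∀ f z → im (ι f *ᴷ z) ≡ f F.* im z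
    im-ι* f ⟦ a , b ⟧ = cong im (ι-* f a b)

-- Johnson's parallelism of PG(3,q).

module Spreads where
  open Solver
  open Counting
  open Fields
  open import Data.Nat as ℕ using (ℕ; zero; suc)
  open import Data.Fin as Fin using (Fin)
  import Data.Fin.Properties as Fin
  open import Data.Maybe using (Maybe; just; nothing)
  open import Data.Maybe.Properties using (just-injective)
  import Data.Maybe.Properties as Maybe
  open import Data.Product using (∃; _×_; _,_; proj₁; proj₂)
  open import Data.Product.Function.NonDependent.Propositional using (_×-cong_)
  open import Function using (_∘_)
  open import Function.Bundles using (_↔_; Inverse; mk↔ₛ′)
  open import Function.Properties.Inverse using (↔-trans)
  open import Relation.Nullary using (Dec; yes; no; contradiction)
  open import Relation.Binary.PropositionalEquality
  import Data.Integer as ℤ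

  Maybe↔ : ∀ {n} {A : Set} → Fin n ↔ A → Fin (suc n) ↔ Maybe A
  Maybe↔ E = mk↔ₛ′
    (λ { Fin.zero → nothing ; (Fin.suc i) → just (to i) })
    (λ { nothing → Fin.zero ; (just a) → Fin.suc (from a) })
    (λ { nothing → refl ; (just a) → cong just (strictlyInverseˡ a) })
    (λ { Fin.zero → refl ; (Fin.suc i) → cong Fin.suc (strictlyInverseʳ i) })
    where open Inverse E

  ×↔ : ∀ {m n} {A B : Set} → Fin m ↔ A → Fin n ↔ B → Fin (m ℕ.* n) ↔ (A × B)
  ×↔ E E′ = ↔-trans Fin.*↔× (E ×-cong E′)

  record SpreadData (𝔽 : Field) : Set where
    open FieldProperties 𝔽
    field
      τ μ : Carrier
      irreducible : ∀ t → t * t ≢ τ * t + μ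
      -- Either of τ ≠ 0 and 2 ≠ 0 yields this; it makes F the fixed field of `conj`.
      separable : ∀ {b} → τ * b ≡ 0# → b + b ≡ 0# → b ≡ 0#
    open QuadraticExtension 𝔽 τ μ irreducible public
    field
      a₀ b₀ : K
      b₀≢0 : b₀ ≢ ι 0#
      -- Equivalently, x ↦ a₀ x + b₀ conj x maps no nonzero x to an F-multiple of itself.
      norms-differ : ∀ t → norm (a₀ +ᴷ ι t) ≢ norm b₀

  module Parallelism (𝔽 : Field) (S : SpreadData 𝔽) where
    open SpreadData S
    private
      module F = FieldProperties 𝔽
      module 𝕂 = FieldProperties field-K
    open F using () renaming (Carrier to F)
    open 𝕂 using (_+_; _*_; -_; _-_; _⁻¹; 0#; 1#)
    open ≡-Reasoning

    -- Arithmetic in K*/F*.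

    real≡ι : ∀ {z} → im z ≡ F.0# → z ≡ ι (re z)
    real≡ι = K-ext refl

    ι-nonzero : ∀ {f} → f ≢ F.0# → ι f ≢ 0#
    ι-nonzero f≢0 = f≢0 ∘ cong re

    ι-homo-* : ∀ f g → ι f * ι g ≡ ι (f F.* g)
    ι-homo-* f g = trans (ι-* f g F.0#) (cong ⟦ f F.* g ,_⟧ (F.zeroʳ f))

    conj-nonzero : ∀ {z} → z ≢ 0# → conj z ≢ 0#
    conj-nonzero {z} z≢0 eq = z≢0 (trans (sym (conj-involutive z)) (trans (cong conj eq) (conj-ι F.0#)))

    -- Equality in K*/F*.
    infix 4 _~_
    _~_ : K → K → Set
    z ~ w = ∃ λ f → f ≢ F.0# × z ≡ ι f * w

    ~-refl : ∀ {z} → z ~ z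
    ~-refl {z} = F.1# , F.1≢0 , sym (𝕂.*-identityˡ z)

    ~-trans : ∀ {x y z} → x ~ y → y ~ z → x ~ z
    ~-trans {z = z} (f , f≢0 , refl) (g , g≢0 , refl) = f F.* g , F.*-nonzero f≢0 g≢0 ,
      trans (sym (𝕂.*-assoc (ι f) (ι g) z)) (cong (_* z) (ι-homo-* f g))

    ~-sym : ∀ {x y} → x ~ y → y ~ x
    ~-sym {y = y} (f , f≢0 , refl) = f F.⁻¹ , F.⁻¹-nonzero f≢0 , sym (begin
      ι (f F.⁻¹) * (ι f * y)      ≡⟨ 𝕂.*-assoc (ι (f F.⁻¹)) (ι f) y ⟨
      ι (f F.⁻¹) * ι f * y        ≡⟨ cong (_* y) (ι-homo-* (f F.⁻¹) f) ⟩
      ι (f F.⁻¹ F.* f) * y        ≡⟨ cong (λ g → ι g * y) (trans (F.*-comm _ f) (F.inverseʳ f≢0)) ⟩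
      1# * y                      ≡⟨ 𝕂.*-identityˡ y ⟩
      y                           ∎)

    ~-* : ∀ {x y x′ y′} → x ~ y → x′ ~ y′ → x * x′ ~ y * y′
    ~-* {y = y} {y′ = y′} (f , f≢0 , refl) (g , g≢0 , refl) = f F.* g , F.*-nonzero f≢0 g≢0 ,
      trans (𝕂.*-interchange (ι f) y (ι g) y′)
            (cong (_* (y * y′)) (ι-homo-* f g))

    ≡⇒~ : ∀ {x y} → x ≡ y → x ~ y
    ≡⇒~ refl = ~-refl

    ~-conj : ∀ {x y} → x ~ y → conj x ~ conj y
    ~-conj {y = y} (f , f≢0 , refl) = f , f≢0 , trans (conj-* (ι f) y) (cong (_* conj y) (conj-ι f))

    real⇒~1 : ∀ {z} → z ≢ 0# → im z ≡ F.0# → z ~ 1#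
    real⇒~1 {z} z≢0 eq = re z , (λ re≡0 → z≢0 (K-ext re≡0 eq)) , trans (real≡ι eq) (sym (𝕂.*-identityʳ _))

    ~1⇒real : ∀ {z} → z ~ 1# → im z ≡ F.0#
    ~1⇒real (f , _ , refl) = trans (im-ι* f 1#) (F.zeroʳ f)

    -- Since the norm lies in F, the conjugate is the inverse in K*/F*. Quotients of classes are
    -- therefore written with `conj` below.
    z*conj~1 : ∀ {z} → z ≢ 0# → z * conj z ~ 1#
    z*conj~1 {z} z≢0 = norm z , norm≢0 z≢0 , trans (*ᴷ-conj z) (sym (𝕂.*-identityʳ _))

    x*y*conj~x : ∀ {x y} → y ≢ 0# → x * y * conj y ~ x
    x*y*conj~x {x} {y} y≢0 = ~-trans (≡⇒~ (𝕂.*-assoc x y _))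
      (~-trans (~-* (~-refl {x}) (z*conj~1 y≢0)) (≡⇒~ (𝕂.*-identityʳ x)))

    x*conj*y~x : ∀ {x y} → y ≢ 0# → x * conj y * y ~ x
    x*conj*y~x {x} {y} y≢0 = ~-trans (≡⇒~ (𝕂.xyz≡xzy x (conj y) y)) (x*y*conj~x y≢0)

    x*conj~1⇒~ : ∀ {x y} → y ≢ 0# → x * conj y ~ 1# → x ~ y
    x*conj~1⇒~ {x} {y} y≢0 r = ~-trans (~-sym (x*conj*y~x y≢0))
      (~-trans (~-* r (~-refl {y})) (≡⇒~ (𝕂.*-identityˡ y)))

    ~-cancelʳ : ∀ {x y z} → z ≢ 0# → x * z ~ y * z → x ~ y
    ~-cancelʳ {x} {y} {z} z≢0 r = ~-trans (~-sym (x*y*conj~x z≢0))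
      (~-trans (~-* r (~-refl {conj z})) (x*y*conj~x z≢0))

    -- The q + 1 elements of K*/F*, seen as the projective line over F: `nothing` is the class of F*
    -- itself and `just f` that of f + ω.
    U : Set
    U = Maybe F

    rep : U → K
    rep nothing = 1#
    rep (just f) = ⟦ f , F.1# ⟧

    cls : K → U
    cls ⟦ x , y ⟧ with y F.≟ F.0#
    -- Zero, which has no class, also receives this value.
    ... | yes _ = nothing
    ... | no _ = just (x F.* y F.⁻¹)

    rep≢0 : ∀ u → rep u ≢ 0#
    rep≢0 nothing = F.1≢0 ∘ cong re
    rep≢0 (just f) = F.1≢0 ∘ cong im

    cls-nothing : ∀ {x y} → y ≡ F.0# → cls ⟦ x , y ⟧ ≡ nothing
    cls-nothing {y = y} y≡0 with y F.≟ F.0#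
    ... | yes _ = refl
    ... | no neq = contradiction y≡0 neq

    cls-just : ∀ {x y f} → y ≢ F.0# → f F.* y ≡ x → cls ⟦ x , y ⟧ ≡ just f
    cls-just {x} {y} y≢0 eq with y F.≟ F.0#
    ... | yes y≡0 = contradiction y≡0 y≢0
    ... | no neq = cong just (F.*-cancelʳ neq (trans (F.[x*y⁻¹]*y≡x x neq) (sym eq)))

    cls-ι*rep : ∀ {f} u → f ≢ F.0# → cls (ι f * rep u) ≡ u
    cls-ι*rep {f} nothing f≢0 = trans (cong cls (ι-* f F.1# F.0#)) (cls-nothing (F.zeroʳ f))
    cls-ι*rep {f} (just g) f≢0 = trans (cong cls (ι-* f g F.1#))
      (cls-just (λ eq → f≢0 (trans (sym (F.*-identityʳ f)) eq))
        (trans (cong (g F.*_) (F.*-identityʳ f)) (F.*-comm g f)))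

    ~rep-cls : ∀ {z} → z ≢ 0# → z ~ rep (cls z)
    ~rep-cls {⟦ x , y ⟧} z≢0 with y F.≟ F.0#
    ... | yes eq = real⇒~1 z≢0 eq
    ... | no y≢0 = y , y≢0 , sym (trans (ι-* y _ F.1#)
          (cong₂ ⟦_,_⟧ (trans (F.*-comm y _) (F.[x*y⁻¹]*y≡x x y≢0)) (F.*-identityʳ y)))

    ~rep⇒cls : ∀ {z u} → z ~ rep u → cls z ≡ u
    ~rep⇒cls {u = u} (f , f≢0 , refl) = cls-ι*rep u f≢0

    rep-injective : ∀ {u v} → rep u ~ rep v → u ≡ v
    rep-injective r = trans (sym (~rep⇒cls ~-refl)) (~rep⇒cls r)

    θ : K → K
    θ z = conj z * z ⁻¹

    θ*z : ∀ {z} → z ≢ 0# → θ z * z ≡ conj z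
    θ*z {z} z≢0 = 𝕂.[x*y⁻¹]*y≡x (conj z) z≢0

    θ-unique : ∀ {z t} → z ≢ 0# → t * z ≡ conj z → t ≡ θ z
    θ-unique z≢0 eq = 𝕂.*-cancelʳ z≢0 (trans eq (sym (θ*z z≢0)))

    θ-* : ∀ {x y} → x ≢ 0# → y ≢ 0# → θ (x * y) ≡ θ x * θ y
    θ-* {x} {y} x≢0 y≢0 = sym (θ-unique (𝕂.*-nonzero x≢0 y≢0) (begin
      θ x * θ y * (x * y)     ≡⟨ 𝕂.*-interchange (θ x) (θ y) x y ⟩
      θ x * x * (θ y * y)     ≡⟨ cong₂ _*_ (θ*z x≢0) (θ*z y≢0) ⟩
      conj x * conj y         ≡⟨ conj-* x y ⟨
      conj (x * y)            ∎))

    θ-cong : ∀ {x y} → y ≢ 0# → x ~ y → θ x ≡ θ y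
    θ-cong {y = y} y≢0 (f , f≢0 , refl) = trans (θ-* (ι-nonzero f≢0) y≢0)
      (trans (cong (_* θ y) (sym (θ-unique (ι-nonzero f≢0) (trans (𝕂.*-identityˡ (ι f)) (sym (conj-ι f))))))
             (𝕂.*-identityˡ (θ y)))

    fixed⇒real : ∀ {z} → conj z ≡ z → im z ≡ F.0#
    fixed⇒real {⟦ a , b ⟧} eq = separable
      (trans (F.solve 2 (λ a c → c F.:= a F.:+ c F.:- a) refl a (τ F.* b)) (F.x≡y⇒x-y≡0 (cong re eq)))
      (trans (F.solve 1 (λ b → b F.:+ b F.:= b F.:- (F.:- b)) refl b) (F.x≡y⇒x-y≡0 (sym (cong im eq))))

    -- Equal quotients make x conj y fixed by `conj`, hence an element of F*, and conj y is inverse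
    -- to y modulo F*.
    θ-injective : ∀ {x y} → x ≢ 0# → y ≢ 0# → θ x ≡ θ y → x ~ y
    θ-injective {x} {y} x≢0 y≢0 eq = x*conj~1⇒~ y≢0
      (real⇒~1 (𝕂.*-nonzero x≢0 (conj-nonzero y≢0)) (fixed⇒real (begin
        conj (x * conj y)          ≡⟨ conj-* x (conj y) ⟩
        conj x * conj (conj y)     ≡⟨ cong (conj x *_) (conj-involutive y) ⟩
        conj x * y                 ≡⟨ cong (_* y) (θ*z x≢0) ⟨
        θ x * x * y                ≡⟨ cong (λ t → t * x * y) eq ⟩
        θ y * x * y                ≡⟨ 𝕂.xyz≡y[xz] (θ y) x y ⟩
        x * (θ y * y)              ≡⟨ cong (x *_) (θ*z y≢0) ⟩
        x * conj y                 ∎)))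

    norm-θ : ∀ {z} → z ≢ 0# → norm (θ z) ≡ F.1#
    norm-θ {z} z≢0 = F.*-cancelʳ (norm≢0 z≢0) (begin
      norm (θ z) F.* norm z   ≡⟨ norm-* (θ z) z ⟨
      norm (θ z * z)          ≡⟨ cong norm (θ*z z≢0) ⟩
      norm (conj z)           ≡⟨ norm-conj z ⟩
      norm z                  ≡⟨ F.*-identityˡ _ ⟨
      F.1# F.* norm z         ∎)

    -- On the F-line spanned by v, the map x ↦ a₀ x + b₀ conj x is multiplication by `h v`.
    h : K → K
    h v = a₀ + b₀ * θ v

    -- If h v were some t in F, then a₀ - t would equal -(b₀ θ v). As θ v has norm 1, taking norms
    -- contradicts `norms-differ` at -t.
    im-h≢0 : ∀ {v} → v ≢ 0# → im (h v) ≢ F.0#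
    im-h≢0 {v} v≢0 eq = norms-differ (F.- t) (begin
      norm (a₀ + ι (F.- t))               ≡⟨ cong norm a₀-t ⟩
      norm (- (b₀ * θ v))                 ≡⟨ norm-neg (b₀ * θ v) ⟩
      norm (b₀ * θ v)                     ≡⟨ norm-* b₀ (θ v) ⟩
      norm b₀ F.* norm (θ v)              ≡⟨ cong (norm b₀ F.*_) (norm-θ v≢0) ⟩
      norm b₀ F.* F.1#                    ≡⟨ F.*-identityʳ _ ⟩
      norm b₀                             ∎)
      where
      t = re (h v)
      ι-neg : ι (F.- t) ≡ - ι t
      ι-neg = cong ⟦ F.- t ,_⟧ (F.solve 0 (F.con (ℤ.+ 0) F.:= F.:- F.con (ℤ.+ 0)) refl)
      a₀-t : a₀ + ι (F.- t) ≡ - (b₀ * θ v)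
      a₀-t = begin
        a₀ + ι (F.- t)                ≡⟨ cong (a₀ +_) (trans ι-neg (cong -_ (sym (real≡ι eq)))) ⟩
        a₀ - (a₀ + b₀ * θ v)          ≡⟨ 𝕂.x-[x+y]≡-y a₀ (b₀ * θ v) ⟩
        - (b₀ * θ v)                  ∎

    h-injective : ∀ {x y} → x ≢ 0# → y ≢ 0# → h x ≡ h y → x ~ y
    h-injective {x} {y} x≢0 y≢0 eq = θ-injective x≢0 y≢0 (𝕂.*-cancelˡ b₀≢0 (begin
      b₀ * θ x           ≡⟨ 𝕂.y≡x+y-x a₀ (b₀ * θ x) ⟩
      h x - a₀           ≡⟨ cong (_- a₀) eq ⟩
      h y - a₀           ≡⟨ 𝕂.x+y-x≡y a₀ (b₀ * θ y) ⟩
      b₀ * θ y           ∎))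

    -- The regulus removed from the second spread consists of x = 0 and the graphs y = t x with t in
    -- F. Its q + 1 labels, `nothing` and those with s = 0, pass to the lines of the opposite
    -- regulus.
    ε : U → Maybe K
    ε nothing = nothing
    ε (just f) = just (ι f)

    ε-injective : ∀ {u v} → ε u ≡ ε v → u ≡ v
    ε-injective {nothing} {nothing} _ = refl
    ε-injective {just _} {just _} refl = refl

    ε≢just : ∀ {u t s} → s ≢ F.0# → ε u ≢ just ⟦ t , s ⟧
    ε≢just {just f} s≢0 refl = s≢0 refl

    -- The point (just w , u) is the F-line spanned by (u , w u) in K², and (nothing , u) the one spanned by
    -- (0 , u). On the base spread σ sends a point to the spread element containing it: (t , s) with s ≠ 0
    -- labels the graph of x ↦ t x + s (a₀ x + b₀ conj x), and ε u labels the transversal u F².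
    σ : K → U → Maybe K
    σ z v with im z F.≟ F.0#
    ... | yes _ = ε v
    ... | no _ = let s = im z F.* im (h (rep v)) F.⁻¹ in just ⟦ re z F.- s F.* re (h (rep v)) , s ⟧

    -- The ratio y / x on the graph labelled (t , s) when x lies in the class v.
    point : F → F → U → K
    point t s v = ι t + ι s * h (rep v)

    im-point : ∀ t s v → im (point t s v) ≡ s F.* im (h (rep v))
    im-point t s v = trans (im-+ (ι t) (ι s * h (rep v))) (trans (F.+-identityˡ _) (im-ι* s (h (rep v))))

    re-point : ∀ t s v → re (point t s v) ≡ t F.+ s F.* re (h (rep v))
    re-point t s v = trans (re-+ (ι t) (ι s * h (rep v))) (cong (t F.+_) (re-ι* s (h (rep v))))

    σ-real : ∀ {z v} → im z ≡ F.0# → σ z v ≡ ε v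
    σ-real {z} eq with im z F.≟ F.0#
    ... | yes _ = refl
    ... | no neq = contradiction eq neq

    σ-point : ∀ {z t s v} → s ≢ F.0# → z ≡ point t s v → σ z v ≡ just ⟦ t , s ⟧
    σ-point {z} {t} {s} {v} s≢0 z≡ with im z F.≟ F.0#
    ... | yes eq = contradiction (trans (sym (im-point t s v)) (trans (cong im (sym z≡)) eq))
                     (F.*-nonzero s≢0 (im-h≢0 (rep≢0 v)))
    ... | no _ = cong just (cong₂ ⟦_,_⟧ t≡ s≡)
      where
      i = im (h (rep v))
      r = re (h (rep v))
      s≡ : im z F.* i F.⁻¹ ≡ s
      s≡ = F.*-cancelʳ (im-h≢0 (rep≢0 v)) (trans (F.[x*y⁻¹]*y≡x (im z) (im-h≢0 (rep≢0 v)))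
             (trans (cong im z≡) (im-point t s v)))
      t≡ : re z F.- im z F.* i F.⁻¹ F.* r ≡ t
      t≡ = begin
        re z F.- im z F.* i F.⁻¹ F.* r    ≡⟨ cong₂ (λ x y → x F.- y F.* r) (trans (cong re z≡) (re-point t s v)) s≡ ⟩
        t F.+ s F.* r F.- s F.* r         ≡⟨ F.solve 2 (λ t x → t F.:+ x F.:- x F.:= t) refl t (s F.* r) ⟩
        t                                 ∎

    data View (z : K) (v : U) : Set where
      real : im z ≡ F.0# → View z v
      line : ∀ t s → s ≢ F.0# → z ≡ point t s v → View z v

    -- By `im-h≢0` the elements 1 and h (rep v) form a basis of K over F. The coefficient s is read
    -- off from the imaginary part, and then t from the real part.
    view : ∀ z v → View z v
    view z v with im z F.≟ F.0#
    ... | yes eq = real eq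
    ... | no neq = line t s (F.*-nonzero neq (F.⁻¹-nonzero i≢0)) (K-ext
        (sym (trans (re-point t s v) (F.solve 2 (λ r x → r F.:- x F.:+ x F.:= r) refl (re z) (s F.* r))))
        (sym (trans (im-point t s v) (F.[x*y⁻¹]*y≡x (im z) i≢0))))
      where
      i = im (h (rep v))
      r = re (h (rep v))
      i≢0 = im-h≢0 (rep≢0 v)
      s = im z F.* i F.⁻¹
      t = re z F.- s F.* r

    rep-cls~ : ∀ {z} → z ≢ 0# → rep (cls z) ~ z
    rep-cls~ z≢0 = ~-sym (~rep-cls z≢0)

    -- The coordinates of a point after the collineation carrying the spread (γ , β) to the base spread.
    Z : U → F → K → K
    Z γ β w = w * conj (rep γ) - ⟦ F.0# , β ⟧

    Z⁻ : U → F → K → K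
    Z⁻ γ β z = (z + ⟦ F.0# , β ⟧) * conj (rep γ) ⁻¹

    -- With g = rep γ the collineation is (x , y) ↦ (g x , norm g y - β ω g x). It multiplies u by
    -- g, and it multiplies w by norm g / g = conj g before subtracting β ω.
    V V⁻ : U → U → U
    V γ u = cls (rep u * rep γ)
    V⁻ γ v = cls (rep v * conj (rep γ))

    conj-rep≢0 : ∀ γ → conj (rep γ) ≢ 0#
    conj-rep≢0 γ = conj-nonzero (rep≢0 γ)

    Z-Z⁻ : ∀ γ β z → Z γ β (Z⁻ γ β z) ≡ z
    Z-Z⁻ γ β z = trans (cong (_- ⟦ F.0# , β ⟧) (𝕂.[x*y⁻¹]*y≡x (z + ⟦ F.0# , β ⟧) (conj-rep≢0 γ)))
      (𝕂.x+y-y≡x z ⟦ F.0# , β ⟧)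

    Z-injective : ∀ γ β {w w′} → Z γ β w ≡ Z γ β w′ → w ≡ w′
    Z-injective γ β {w} {w′} eq = 𝕂.*-cancelʳ (conj-rep≢0 γ) (begin
      w * conj (rep γ)              ≡⟨ 𝕂.x≡x-y+y (w * conj (rep γ)) ⟦ F.0# , β ⟧ ⟩
      Z γ β w + ⟦ F.0# , β ⟧          ≡⟨ cong (_+ ⟦ F.0# , β ⟧) eq ⟩
      Z γ β w′ + ⟦ F.0# , β ⟧         ≡⟨ 𝕂.x-y+y≡x (w′ * conj (rep γ)) ⟦ F.0# , β ⟧ ⟩
      w′ * conj (rep γ)             ∎)

    rep-V~ : ∀ γ u → rep (V γ u) ~ rep u * rep γ
    rep-V~ γ u = rep-cls~ (𝕂.*-nonzero (rep≢0 u) (rep≢0 γ))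

    V-V⁻ : ∀ γ v → V γ (V⁻ γ v) ≡ v
    V-V⁻ γ v = ~rep⇒cls (~-trans
      (~-* (rep-cls~ (𝕂.*-nonzero (rep≢0 v) (conj-rep≢0 γ))) ~-refl) (x*conj*y~x (rep≢0 γ)))

    V-injective : ∀ γ {u u′} → V γ u ≡ V γ u′ → u ≡ u′
    V-injective γ {u} {u′} eq = rep-injective (~-cancelʳ (rep≢0 γ)
      (~-trans (~-sym (rep-V~ γ u)) (~-trans (≡⇒~ (cong rep eq)) (rep-V~ γ u′))))

    -- `nothing` is the spread of K-lines. For the images of the second spread it suffices to shift
    -- by multiples of ω, because a shift by an element of F only changes the labels t.
    Class : Set
    Class = Maybe (U × F)

    block : Class → Maybe K × U → Maybe K
    block nothing (w , u) = w
    -- On x = 0 the collineation is multiplication by a norm, an element of F, so u does not change.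
    block (just (γ , β)) (nothing , u) = ε u
    block (just (γ , β)) (just w , u) = σ (Z γ β w) (V γ u)

    -- Separates the points of one K-line in every other spread: z and a common label (t , s)
    -- determine h, which is injective on K*/F*.
    σ-injective : ∀ {z v v′} → σ z v ≡ σ z v′ → v ≡ v′
    σ-injective {z} {v} {v′} eq with view z v | view z v′
    ... | real r | _ = ε-injective (trans (sym (σ-real r)) (trans eq (σ-real r)))
    ... | line _ _ _ _ | real r = ε-injective (trans (sym (σ-real r)) (trans eq (σ-real r)))
    ... | line t s s≢0 z≡ | line t′ s′ s′≢0 z≡′
      with refl ← just-injective (trans (sym (σ-point s≢0 z≡)) (trans eq (σ-point s′≢0 z≡′))) =
      rep-injective (h-injective (rep≢0 v) (rep≢0 v′) (𝕂.*-cancelˡ (ι-nonzero s≢0) (begin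
        ι s * h (rep v)            ≡⟨ 𝕂.y≡x+y-x (ι t) (ι s * h (rep v)) ⟩
        point t s v - ι t          ≡⟨ cong (_- ι t) (trans (sym z≡) z≡′) ⟩
        point t s v′ - ι t         ≡⟨ 𝕂.x+y-x≡y (ι t) (ι s * h (rep v′)) ⟩
        ι s * h (rep v′)           ∎)))

    module _ {q} (enum : Fin q ↔ F) where

      block-size : ∀ m x → Size (λ P → block m P ≡ x) (suc q)
      block-size nothing x = size-image (Maybe↔ enum) (x ,_) (λ _ → refl) (cong proj₂)
        (λ { (_ , u) refl → u , refl })
      block-size (just (γ , β)) x = split x
        where
        -- A transversal has one point on x = 0 and one point for each value of `Z` in F.
        real-block : ∀ u → Size (λ P → block (just (γ , β)) P ≡ ε u) (suc q)
        real-block u = size-image (Maybe↔ enum) f f-sound f-injective f-complete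
          where
          f : Maybe F → Maybe K × U
          f nothing = nothing , u
          f (just x) = just (Z⁻ γ β (ι x)) , V⁻ γ u

          f-sound : ∀ a → block (just (γ , β)) (f a) ≡ ε u
          f-sound nothing = refl
          f-sound (just x) = trans (σ-real (cong im (Z-Z⁻ γ β (ι x)))) (cong ε (V-V⁻ γ u))

          f-injective : ∀ {a b} → f a ≡ f b → a ≡ b
          f-injective {nothing} {nothing} _ = refl
          f-injective {just x} {just y} eq = cong just (cong re (begin
            ι x                            ≡⟨ Z-Z⁻ γ β (ι x) ⟨
            Z γ β (Z⁻ γ β (ι x))           ≡⟨ cong (Z γ β) (just-injective (cong proj₁ eq)) ⟩
            Z γ β (Z⁻ γ β (ι y))           ≡⟨ Z-Z⁻ γ β (ι y) ⟩
            ι y                            ∎))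

          f-complete : ∀ P → block (just (γ , β)) P ≡ ε u → ∃ λ a → f a ≡ P
          f-complete (nothing , u′) eq with refl ← ε-injective eq = nothing , refl
          f-complete (just w , u′) eq with view (Z γ β w) (V γ u′)
          ... | line t s s≢0 z≡ = contradiction (trans (sym eq) (σ-point s≢0 z≡)) (ε≢just s≢0)
          ... | real r = just (re (Z γ β w)) , cong₂ _,_
            (cong just (Z-injective γ β (trans (Z-Z⁻ γ β _) (sym (real≡ι r)))))
            (V-injective γ (trans (V-V⁻ γ u) (sym (ε-injective (trans (sym (σ-real r)) eq)))))

        line-block : ∀ t s → s ≢ F.0# → Size (λ P → block (just (γ , β)) P ≡ just ⟦ t , s ⟧) (suc q)
        line-block t s s≢0 = size-image (Maybe↔ enum) f f-sound f-injective f-complete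
          where
          f : U → Maybe K × U
          f v = just (Z⁻ γ β (point t s v)) , V⁻ γ v

          f-sound : ∀ v → block (just (γ , β)) (f v) ≡ just ⟦ t , s ⟧
          f-sound v = σ-point s≢0 (trans (Z-Z⁻ γ β (point t s v)) (cong (point t s) (sym (V-V⁻ γ v))))

          f-injective : ∀ {v v′} → f v ≡ f v′ → v ≡ v′
          f-injective {v} {v′} eq = trans (sym (V-V⁻ γ v)) (trans (cong (V γ) (cong proj₂ eq)) (V-V⁻ γ v′))

          f-complete : ∀ P → block (just (γ , β)) P ≡ just ⟦ t , s ⟧ → ∃ λ v → f v ≡ P
          f-complete (nothing , u) eq = contradiction eq (ε≢just s≢0)
          f-complete (just w , u) eq with view (Z γ β w) (V γ u)
          ... | real r = contradiction (trans (sym (σ-real r)) eq) (ε≢just s≢0)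
          ... | line t′ s′ s′≢0 z≡ with refl ← just-injective (trans (sym (σ-point s′≢0 z≡)) eq) =
            V γ u , cong₂ _,_
              (cong just (Z-injective γ β (trans (Z-Z⁻ γ β _) (sym z≡))))
              (V-injective γ (V-V⁻ γ (V γ u)))

        split : ∀ x → Size (λ P → block (just (γ , β)) P ≡ x) (suc q)
        split nothing = real-block nothing
        split (just ⟦ t , s ⟧) with s F.≟ F.0#
        ... | yes refl = real-block (just t)
        ... | no s≢0 = line-block t s s≢0

    -- Two points lie in a common block of exactly one class.

    im-- : ∀ x y → im (x - y) ≡ im x F.- im y
    im-- x y = trans (im-+ x (- y)) (cong (im x F.+_) (im-neg y))

    im-Z : ∀ γ β w → im (Z γ β w) ≡ im (w * conj (rep γ)) F.- β
    im-Z γ β w = im-- (w * conj (rep γ)) ⟦ F.0# , β ⟧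

    β⇒real : ∀ γ w {β} → im (w * conj (rep γ)) ≡ β → im (Z γ β w) ≡ F.0#
    β⇒real γ w {β} eq = trans (im-Z γ β w) (F.x≡y⇒x-y≡0 eq)

    real⇒β : ∀ γ β w → im (Z γ β w) ≡ F.0# → im (w * conj (rep γ)) ≡ β
    real⇒β γ β w eq = F.x-y≡0⇒x≡y (trans (sym (im-Z γ β w)) eq)

    -- A point on x = 0 lies only on transversals. So γ has to carry u′ to u, which makes it the
    -- class of u conj u′, and β has to make `Z` real at w.
    module JoinAtInfinity (u : U) (w : K) (u′ : U) where
      γ₀ = cls (rep u * conj (rep u′))

      class : Class
      class = just (γ₀ , im (w * conj (rep γ₀)))

      agrees : block class (nothing , u) ≡ block class (just w , u′)
      agrees = sym (trans (σ-real (β⇒real γ₀ w refl)) (cong ε (~rep⇒cls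
        (~-trans (~-* (~-refl {rep u′}) (rep-cls~ (𝕂.*-nonzero (rep≢0 u) (conj-rep≢0 u′))))
        (~-trans (≡⇒~ (𝕂.y[xz]≡xyz (rep u) (rep u′) (conj (rep u′))))
                 (x*y*conj~x (rep≢0 u′)))))))

      unique : ∀ m → block m (nothing , u) ≡ block m (just w , u′) → class ≡ m
      unique (just (γ , β)) eq with view (Z γ β w) (V γ u′)
      ... | line t s s≢0 z≡ = contradiction (trans eq (σ-point s≢0 z≡)) (ε≢just s≢0)
      ... | real r = cong just (lemma γ≡)
        where
        γ≡ : γ₀ ≡ γ
        γ≡ = ~rep⇒cls (~-trans (~-* (~-trans (≡⇒~ (cong rep (ε-injective (trans eq (σ-real r))))) (rep-V~ γ u′)) ~-refl)
          (~-trans (≡⇒~ (𝕂.yxz≡xyz (rep γ) (rep u′) (conj (rep u′))))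
                   (x*y*conj~x (rep≢0 u′))))
        lemma : ∀ {γ′} → γ′ ≡ γ → (γ′ , im (w * conj (rep γ′))) ≡ (γ , β)
        lemma refl = cong (γ ,_) (real⇒β γ β w r)

    -- With the same u, a common graph would force w = w′, so the join is a transversal. Then `Z` is
    -- real at both points, so d conj (rep γ) is real and γ is the class of d; again β makes `Z`
    -- real at w.
    module JoinParallel (w w′ : K) (w≢w′ : w ≢ w′) (u : U) where
      d = w - w′
      d≢0 : d ≢ 0#
      d≢0 = w≢w′ ∘ 𝕂.x-y≡0⇒x≡y
      γ₀ = cls d

      class : Class
      class = just (γ₀ , im (w * conj (rep γ₀)))

      agrees : block class (just w , u) ≡ block class (just w′ , u)
      agrees = trans (σ-real (β⇒real γ₀ w refl)) (sym (σ-real im≡0))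
        where
        im-d : im (d * conj (rep γ₀)) ≡ F.0#
        im-d = ~1⇒real (~-trans (~-* (~-refl {d}) (~-conj (rep-cls~ d≢0))) (z*conj~1 d≢0))
        im≡0 : im (Z γ₀ (im (w * conj (rep γ₀))) w′) ≡ F.0#
        im≡0 = β⇒real γ₀ w′ (sym (F.x-y≡0⇒x≡y (trans (sym (im-- (w * conj (rep γ₀)) (w′ * conj (rep γ₀))))
          (trans (cong im (sym (𝕂.[x-y]z≡xz-yz w w′ (conj (rep γ₀))))) im-d))))

      unique : ∀ m → block m (just w , u) ≡ block m (just w′ , u) → class ≡ m
      unique nothing eq = contradiction (just-injective eq) w≢w′
      unique (just (γ , β)) eq with view (Z γ β w) (V γ u) | view (Z γ β w′) (V γ u)
      ... | real r | line t s s≢0 z≡ = contradiction (trans (sym (σ-real r)) (trans eq (σ-point s≢0 z≡))) (ε≢just s≢0)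
      ... | line t s s≢0 z≡ | real r = contradiction (trans (sym (σ-real r)) (trans (sym eq) (σ-point s≢0 z≡))) (ε≢just s≢0)
      ... | line t s s≢0 z≡ | line t′ s′ s′≢0 z≡′
        with refl ← just-injective (trans (sym (σ-point s≢0 z≡)) (trans eq (σ-point s′≢0 z≡′))) =
        contradiction (Z-injective γ β (trans z≡ (sym z≡′))) w≢w′
      ... | real r | real r′ = cong just (lemma γ≡)
        where
        im-d : im (d * conj (rep γ)) ≡ F.0#
        im-d = trans (cong im (𝕂.[x-y]z≡xz-yz w w′ (conj (rep γ)))) (trans (im-- (w * conj (rep γ)) (w′ * conj (rep γ)))
          (F.x≡y⇒x-y≡0 (trans (real⇒β γ β w r) (sym (real⇒β γ β w′ r′)))))
        γ≡ : γ₀ ≡ γ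
        γ≡ = ~rep⇒cls (x*conj~1⇒~ (rep≢0 γ) (real⇒~1 (𝕂.*-nonzero d≢0 (conj-rep≢0 γ)) im-d))
        lemma : ∀ {γ′} → γ′ ≡ γ → (γ′ , im (w * conj (rep γ′))) ≡ (γ , β)
        lemma refl = cong (γ ,_) (real⇒β γ β w r)

    -- A common transversal would force u = u′, so both points satisfy w conj (rep γ) - β ω = t + s
    -- h with the same t and s. Subtracting the two equations and cancelling θ (rep γ) leaves d rep
    -- γ = s g. Hence γ is the class of g / d, s is the remaining factor in F, and t and β are the
    -- two coordinates of `offset`.
    module JoinSkew (w w′ : K) (w≢w′ : w ≢ w′) (u u′ : U) (u≢u′ : u ≢ u′) where
      d = w - w′
      d≢0 : d ≢ 0#
      d≢0 = w≢w′ ∘ 𝕂.x-y≡0⇒x≡y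
      g = b₀ * (θ (rep u) - θ (rep u′))
      g≢0 : g ≢ 0#
      g≢0 = 𝕂.*-nonzero b₀≢0 (λ eq → u≢u′ (rep-injective (θ-injective (rep≢0 u) (rep≢0 u′) (𝕂.x-y≡0⇒x≡y eq))))
      solution : ∃ λ γ → d * rep γ ~ g
      solution = cls (g * conj d) , ~-trans (~-* (~-refl {d}) (rep-cls~ (𝕂.*-nonzero g≢0 (conj-nonzero d≢0))))
        (~-trans (≡⇒~ (𝕂.y[xz]≡xyz g d (conj d))) (x*y*conj~x d≢0))

      offset : U → F → K
      offset γ s = w * conj (rep γ) - ι s * h (rep (V γ u))

      h-V : ∀ γ x → h (rep (V γ x)) ≡ a₀ + b₀ * (θ (rep x) * θ (rep γ))
      h-V γ x = cong (λ t → a₀ + b₀ * t)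
        (trans (θ-cong (𝕂.*-nonzero (rep≢0 x) (rep≢0 γ)) (rep-V~ γ x)) (θ-* (rep≢0 x) (rep≢0 γ)))

      h-difference : ∀ γ s → ι s * h (rep (V γ u)) - ι s * h (rep (V γ u′)) ≡ ι s * g * θ (rep γ)
      h-difference γ s = trans (cong₂ (λ x y → ι s * x - ι s * y) (h-V γ u) (h-V γ u′))
        (𝕂.affine-difference (ι s) a₀ b₀ (θ (rep u)) (θ (rep u′)) (θ (rep γ)))

      d*conj : ∀ γ → d * conj (rep γ) ≡ d * rep γ * θ (rep γ)
      d*conj γ = trans (cong (d *_) (sym (θ*z (rep≢0 γ))))
        (𝕂.x[zy]≡xyz d (rep γ) (θ (rep γ)))

      module _ (γ₀ : U) (s₀ : F) (s₀≢0 : s₀ ≢ F.0#) (eq₀ : d * rep γ₀ ≡ ι s₀ * g) where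
        class : Class
        class = just (γ₀ , im (offset γ₀ s₀))

        agrees : block class (just w , u) ≡ block class (just w′ , u′)
        agrees = trans (σ-point s₀≢0 z≡) (sym (σ-point s₀≢0 z≡′))
          where
          c = conj (rep γ₀)
          t₀ = re (offset γ₀ s₀)
          β₀ : K
          β₀ = ⟦ F.0# , im (offset γ₀ s₀) ⟧
          offset≡ : offset γ₀ s₀ ≡ ι t₀ + β₀
          offset≡ = K-ext (sym (F.+-identityʳ _)) (sym (F.+-identityˡ _))
          z≡ : w * c - β₀ ≡ point t₀ s₀ (V γ₀ u)
          z≡ = begin
            w * c - β₀
              ≡⟨ 𝕂.x-z≡x-y-z+y (w * c) (ι s₀ * h (rep (V γ₀ u))) β₀ ⟩
            offset γ₀ s₀ - β₀ + ι s₀ * h (rep (V γ₀ u))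
              ≡⟨ cong (λ x → x - β₀ + ι s₀ * h (rep (V γ₀ u))) offset≡ ⟩
            ι t₀ + β₀ - β₀ + ι s₀ * h (rep (V γ₀ u))
              ≡⟨ 𝕂.x+y-y+z≡x+z (ι t₀) β₀ (ι s₀ * h (rep (V γ₀ u))) ⟩
            point t₀ s₀ (V γ₀ u) ∎
          z≡′ : w′ * c - β₀ ≡ point t₀ s₀ (V γ₀ u′)
          z≡′ = begin
            w′ * c - β₀
              ≡⟨ 𝕂.yz-t≡xz-t-[x-y]z w w′ c β₀ ⟩
            w * c - β₀ - d * c
              ≡⟨ cong₂ _-_ z≡ (trans (d*conj γ₀) (trans (cong (_* θ (rep γ₀)) eq₀)
                   (sym (h-difference γ₀ s₀)))) ⟩
            ι t₀ + y - (y - y′)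
              ≡⟨ 𝕂.x+y-[y-z]≡x+z (ι t₀) y y′ ⟩
            point t₀ s₀ (V γ₀ u′) ∎
            where
            y = ι s₀ * h (rep (V γ₀ u))
            y′ = ι s₀ * h (rep (V γ₀ u′))

        unique : ∀ m → block m (just w , u) ≡ block m (just w′ , u′) → class ≡ m
        unique nothing eq = contradiction (just-injective eq) w≢w′
        unique (just (γ , β)) eq with view (Z γ β w) (V γ u) | view (Z γ β w′) (V γ u′)
        ... | real r | line t s s≢0 z≡ = contradiction (trans (sym (σ-real r)) (trans eq (σ-point s≢0 z≡))) (ε≢just s≢0)
        ... | line t s s≢0 z≡ | real r = contradiction (trans (sym (σ-real r)) (trans (sym eq) (σ-point s≢0 z≡))) (ε≢just s≢0)
        ... | real r | real r′ = contradiction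
          (V-injective γ (ε-injective (trans (sym (σ-real r)) (trans eq (σ-real r′))))) u≢u′
        ... | line t s s≢0 z≡ | line t′ s′ s′≢0 z≡′
          with refl ← just-injective (trans (sym (σ-point s≢0 z≡)) (trans eq (σ-point s′≢0 z≡′))) =
          cong just (lemma γ≡)
          where
          c = conj (rep γ)
          y = ι s * h (rep (V γ u))
          y′ = ι s * h (rep (V γ u′))
          d*γ≡ : d * rep γ ≡ ι s * g
          d*γ≡ = 𝕂.*-cancelʳ θ≢0 (begin
            d * rep γ * θ (rep γ)                   ≡⟨ d*conj γ ⟨
            d * c                                   ≡⟨ 𝕂.[x-y]z≡[xz-t]-[yz-t] w w′ c ⟦ F.0# , β ⟧ ⟩
            Z γ β w - Z γ β w′                      ≡⟨ cong₂ _-_ z≡ z≡′ ⟩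
            (ι t + y) - (ι t + y′)                  ≡⟨ 𝕂.[x+y]-[x+z]≡y-z (ι t) y y′ ⟩
            y - y′                                  ≡⟨ h-difference γ s ⟩
            ι s * g * θ (rep γ)                     ∎)
            where
            θ≢0 : θ (rep γ) ≢ 0#
            θ≢0 = 𝕂.*-nonzero (conj-rep≢0 γ) (𝕂.⁻¹-nonzero (rep≢0 γ))
          γ≡ : γ₀ ≡ γ
          γ≡ = rep-injective (~-cancelʳ d≢0 (~-trans (≡⇒~ (trans (𝕂.*-comm (rep γ₀) d) eq₀))
            (~-trans (s₀ , s₀≢0 , refl) (~-trans (~-sym (s , s≢0 , d*γ≡)) (≡⇒~ (𝕂.*-comm d (rep γ)))))))
          offset≡ : offset γ s ≡ ι t + ⟦ F.0# , β ⟧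
          offset≡ = begin
            w * c - y                      ≡⟨ 𝕂.x-z≡x-y-z+y (w * c) ⟦ F.0# , β ⟧ y ⟩
            Z γ β w - y + ⟦ F.0# , β ⟧       ≡⟨ cong (λ x → x - y + ⟦ F.0# , β ⟧) z≡ ⟩
            ι t + y - y + ⟦ F.0# , β ⟧       ≡⟨ 𝕂.x+y-y+z≡x+z (ι t) y ⟦ F.0# , β ⟧ ⟩
            ι t + ⟦ F.0# , β ⟧               ∎
          lemma : γ₀ ≡ γ → (γ₀ , im (offset γ₀ s₀)) ≡ (γ , β)
          lemma eq′ = cong₂ _,_ eq′ (trans (cong₂ (λ γ s → im (offset γ s)) eq′ s₀≡s)
            (trans (cong im offset≡) (F.+-identityˡ β)))
            where
            s₀≡s : s₀ ≡ s
            s₀≡s = cong re (𝕂.*-cancelʳ g≢0 (trans (sym eq₀)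
              (trans (cong (λ γ → d * rep γ) eq′) d*γ≡)))

    Joined : (P P′ : Maybe K × U) → Set
    Joined P P′ = Size (λ m → block m P ≡ block m P′) 1

    join-same : ∀ w {u u′} → u ≢ u′ → Joined (w , u) (w , u′)
    join-same w {u} {u′} u≢u′ = size-one nothing refl (unique w)
      where
      unique : ∀ w m → block m (w , u) ≡ block m (w , u′) → nothing ≡ m
      unique _ nothing _ = refl
      unique nothing (just _) eq = contradiction (ε-injective eq) u≢u′
      unique (just w) (just (γ , β)) eq = contradiction (V-injective γ (σ-injective eq)) u≢u′

    join-affine : ∀ {w w′} → w ≢ w′ → ∀ u u′ → Dec (u ≡ u′) → Joined (just w , u) (just w′ , u′)
    join-affine {w} {w′} w≢w′ u _ (yes refl) = size-one class agrees unique
      where open JoinParallel w w′ w≢w′ u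
    join-affine {w} {w′} w≢w′ u u′ (no u≢u′) = from-solution solution
      where
      open JoinSkew w w′ w≢w′ u u′ u≢u′
      from-solution : (∃ λ γ → d * rep γ ~ g) → Joined (just w , u) (just w′ , u′)
      from-solution (γ₀ , s₀ , s₀≢0 , eq₀) =
        size-one (class γ₀ s₀ s₀≢0 eq₀) (agrees γ₀ s₀ s₀≢0 eq₀) (unique γ₀ s₀ s₀≢0 eq₀)

    join-distinct : ∀ {w w′} → w ≢ w′ → ∀ u u′ → Joined (w , u) (w′ , u′)
    join-distinct {nothing} {nothing} w≢w′ u u′ = contradiction refl w≢w′
    join-distinct {nothing} {just w′} w≢w′ u u′ = size-one class agrees unique
      where open JoinAtInfinity u w′ u′
    join-distinct {just w} {nothing} w≢w′ u u′ = size-⇔ sym sym (size-one class agrees unique)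
      where open JoinAtInfinity u′ w u
    join-distinct {just w} {just w′} w≢w′ u u′ = join-affine (w≢w′ ∘ cong just) u u′ (Maybe.≡-dec F._≟_ u u′)

    join : ∀ P P′ → P ≢ P′ → Joined P P′
    join (w , u) (w′ , u′) P≢P′ with Maybe.≡-dec 𝕂._≟_ w w′
    ... | yes refl = join-same w (P≢P′ ∘ cong (w ,_))
    ... | no w≢w′ = join-distinct w≢w′ u u′

    resolvedDesign : ∀ {q} → Fin q ↔ F →
      ResolvedDesign (suc (suc q ℕ.* q)) (suc (q ℕ.* q)) (suc (q ℕ.* q) ℕ.* suc q) (suc q)
    resolvedDesign enum = record
      { classes = Maybe↔ (×↔ (Maybe↔ enum) enum)
      ; labels = Maybe↔ (↔-trans (×↔ enum enum) K↔F×F)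
      ; points = ×↔ (Maybe↔ (↔-trans (×↔ enum enum) K↔F×F)) (Maybe↔ enum)
      ; block = block
      ; block-size = block-size enum
      ; join = join }

-- The projective plane over a field.

module Planes where
  open Counting
  open Fields
  open Spreads
  open import Data.Nat as ℕ using (ℕ; suc)
  open import Data.Fin as Fin using (Fin)
  open import Data.Maybe using (Maybe; just; nothing)
  open import Data.Product using (_×_; _,_; swap)
  open import Data.Empty using (⊥)
  open import Data.Unit using (⊤; tt)
  open import Function using (_∘_)
  open import Function.Bundles using (_↔_)
  open import Relation.Nullary using (Dec; yes; no; contradiction)
  open import Relation.Binary.PropositionalEquality

  module PlaneOver (𝔽 : Field) where
    open FieldProperties 𝔽 renaming (Carrier to F)
    open ≡-Reasoning

    -- A point is nothing (vertical direction), (nothing , m) (direction of slope m) or (just x , y);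
    -- a line is nothing (at infinity), (nothing , a) (vertical x = a) or (just m , b) (y = m x + b).
    Element : Set
    Element = Maybe (Maybe F × F)

    pattern ∞ = nothing
    pattern at∞ m = just (nothing , m)
    pattern affine x y = just (just x , y)

    infix 4 _on_ _on?_
    _on_ : Element → Element → Set
    ∞ on ∞ = ⊤
    ∞ on at∞ a = ⊤
    ∞ on affine m b = ⊥
    at∞ m on ∞ = ⊤
    at∞ m on at∞ a = ⊥
    at∞ m on affine m′ b = m ≡ m′
    affine x y on ∞ = ⊥
    affine x y on at∞ a = x ≡ a
    affine x y on affine m b = y ≡ m * x + b

    _on?_ : ∀ p l → Dec (p on l)
    ∞ on? ∞ = yes tt
    ∞ on? at∞ a = yes tt
    ∞ on? affine m b = no λ ()
    at∞ m on? ∞ = yes tt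
    at∞ m on? at∞ a = no λ ()
    at∞ m on? affine m′ b = m ≟ m′
    affine x y on? ∞ = no λ ()
    affine x y on? at∞ a = x ≟ a
    affine x y on? affine m b = y ≟ m * x + b

    module _ {q} (enum : Fin q ↔ F) where
      line-size : ∀ l → Size (_on l) (suc q)
      line-size ∞ = size-image (Maybe↔ enum)
        (λ { nothing → ∞ ; (just m) → at∞ m })
        (λ { nothing → tt ; (just m) → tt })
        (λ { {nothing} {nothing} _ → refl ; {just _} {just _} refl → refl })
        (λ { ∞ _ → nothing , refl ; (at∞ m) _ → just m , refl })
      line-size (at∞ a) = size-image (Maybe↔ enum)
        (λ { nothing → ∞ ; (just y) → affine a y })
        (λ { nothing → tt ; (just y) → refl })
        (λ { {nothing} {nothing} _ → refl ; {just _} {just _} refl → refl })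
        (λ { ∞ _ → nothing , refl ; (affine x y) refl → just y , refl })
      line-size (affine m b) = size-image (Maybe↔ enum)
        (λ { nothing → at∞ m ; (just x) → affine x (m * x + b) })
        (λ { nothing → refl ; (just x) → refl })
        (λ { {nothing} {nothing} _ → refl ; {just _} {just _} refl → refl })
        (λ { (at∞ _) refl → nothing , refl ; (affine x y) refl → just x , refl })

      pencil-size : ∀ p → Size (p on_) (suc q)
      pencil-size ∞ = size-image (Maybe↔ enum)
        (λ { nothing → ∞ ; (just a) → at∞ a })
        (λ { nothing → tt ; (just a) → tt })
        (λ { {nothing} {nothing} _ → refl ; {just _} {just _} refl → refl })
        (λ { ∞ _ → nothing , refl ; (at∞ a) _ → just a , refl })
      pencil-size (at∞ m) = size-image (Maybe↔ enum)
        (λ { nothing → ∞ ; (just b) → affine m b })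
        (λ { nothing → tt ; (just b) → refl })
        (λ { {nothing} {nothing} _ → refl ; {just _} {just _} refl → refl })
        (λ { ∞ _ → nothing , refl ; (affine _ b) refl → just b , refl })
      pencil-size (affine x y) = size-image (Maybe↔ enum)
        (λ { nothing → at∞ x ; (just m) → affine m (y - m * x) })
        (λ { nothing → refl ; (just m) → solve 2 (λ y z → y := z :+ (y :- z)) refl y (m * x) })
        (λ { {nothing} {nothing} _ → refl ; {just _} {just _} refl → refl })
        (λ { (at∞ _) refl → nothing , refl
           ; (affine m b) refl → just m , cong (affine m) (x+y-x≡y (m * x) b) })

    Meet : Element → Element → Set
    Meet l l′ = Size (λ p → p on l × p on l′) 1

    meet-sym : ∀ {l l′} → Meet l l′ → Meet l′ l
    meet-sym = size-⇔ swap swap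

    meet-parallel : ∀ {m b b′} → b ≢ b′ → Meet (affine m b) (affine m b′)
    meet-parallel {m} {b} {b′} b≢b′ = size-one (at∞ m) (refl , refl)
      (λ { (at∞ _) (refl , _) → refl
         ; (affine x y) (refl , eq) → contradiction (trans (y≡x+y-x (m * x) b) (trans (cong (_- m * x) eq) (x+y-x≡y (m * x) b′))) b≢b′ })

    meet-affine : ∀ {m m′ b b′} → m ≢ m′ → Meet (affine m b) (affine m′ b′)
    meet-affine {m} {m′} {b} {b′} m≢m′ = size-one (affine x₀ (m * x₀ + b)) (refl , on-second)
      (λ { (at∞ _) (refl , eq) → contradiction eq m≢m′
         ; (affine x y) (refl , eq) → cong (λ x → affine x (m * x + b)) (unique x eq) })
      where
      d≢0 : m - m′ ≢ 0#
      d≢0 = m≢m′ ∘ x-y≡0⇒x≡y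
      x₀ = (b′ - b) * (m - m′) ⁻¹
      x₀*d : x₀ * (m - m′) ≡ b′ - b
      x₀*d = [x*y⁻¹]*y≡x (b′ - b) d≢0
      on-second : m * x₀ + b ≡ m′ * x₀ + b′
      on-second = begin
        m * x₀ + b                           ≡⟨ solve 4 (λ m m′ x b → m :* x :+ b := m′ :* x :+ (x :* (m :- m′) :+ b)) refl m m′ x₀ b ⟩
        m′ * x₀ + (x₀ * (m - m′) + b)        ≡⟨ cong (λ t → m′ * x₀ + (t + b)) x₀*d ⟩
        m′ * x₀ + (b′ - b + b)               ≡⟨ cong (m′ * x₀ +_) (x-y+y≡x b′ b) ⟩
        m′ * x₀ + b′                         ∎
      unique : ∀ x → m * x + b ≡ m′ * x + b′ → x₀ ≡ x
      unique x eq = *-cancelʳ d≢0 (trans x₀*d (begin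
        b′ - b                               ≡⟨ solve 3 (λ t b b′ → b′ :- b := t :+ b′ :- t :- b) refl (m′ * x) b b′ ⟩
        m′ * x + b′ - m′ * x - b             ≡⟨ cong (λ t → t - m′ * x - b) eq ⟨
        m * x + b - m′ * x - b               ≡⟨ solve 4 (λ m m′ x b → m :* x :+ b :- m′ :* x :- b := x :* (m :- m′)) refl m m′ x b ⟩
        x * (m - m′)                         ∎))

    meet-vertical : ∀ a m b → Meet (at∞ a) (affine m b)
    meet-vertical a m b = size-one (affine a (m * a + b)) (refl , refl)
      (λ { ∞ (_ , ()) ; (at∞ _) (() , _) ; (affine _ _) (refl , refl) → refl })

    meet-∞ : ∀ m b → Meet ∞ (affine m b)
    meet-∞ m b = size-one (at∞ m) (tt , refl)
      (λ { ∞ (_ , ()) ; (at∞ _) (_ , refl) → refl ; (affine _ _) (() , _) })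

    meet-vertical-∞ : ∀ a → Meet ∞ (at∞ a)
    meet-vertical-∞ a = size-one ∞ (tt , tt)
      (λ { ∞ _ → refl ; (at∞ _) (_ , ()) ; (affine _ _) (() , _) })

    meet : ∀ l l′ → l ≢ l′ → Meet l l′
    meet ∞ ∞ l≢l′ = contradiction refl l≢l′
    meet ∞ (at∞ a) _ = meet-vertical-∞ a
    meet ∞ (affine m b) _ = meet-∞ m b
    meet (at∞ a) ∞ _ = meet-sym (meet-vertical-∞ a)
    meet (at∞ a) (at∞ a′) l≢l′ = size-one ∞ (tt , tt)
      (λ { ∞ _ → refl ; (at∞ _) (() , _) ; (affine _ _) (refl , refl) → contradiction refl l≢l′ })
    meet (at∞ a) (affine m b) _ = meet-vertical a m b
    meet (affine m b) ∞ _ = meet-sym (meet-∞ m b)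
    meet (affine m b) (at∞ a) _ = meet-sym (meet-vertical a m b)
    meet (affine m b) (affine m′ b′) l≢l′ with m ≟ m′
    ... | yes refl = meet-parallel (l≢l′ ∘ cong (affine m))
    ... | no m≢m′ = meet-affine m≢m′

    projectivePlane : ∀ {q} → Fin q ↔ F → ProjectivePlane (suc (suc q ℕ.* q)) (suc q)
    projectivePlane enum = record
      { points = elements ; lines = elements ; _on_ = _on_ ; _on?_ = _on?_
      ; line-size = line-size enum ; pencil-size = pencil-size enum ; meet = meet }
      where elements = Maybe↔ (×↔ (Maybe↔ enum) enum)

-- Pigeonhole arguments, and the data of the second spread over a finite field.

module FiniteFields where
  open Fields
  open Spreads
  open import Data.Nat as ℕ using (ℕ; zero; suc)
  import Data.Nat.Properties as ℕ
  open import Data.Fin as Fin using (Fin; zero; suc)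
  import Data.Fin.Properties as Fin
  open import Data.Sum using (_⊎_; inj₁; inj₂; [_,_]′)
  open import Data.Product using (∃; _×_; _,_; proj₁; proj₂)
  open import Function using (_∘_; id)
  open import Function.Bundles using (_↔_; Inverse)
  open import Relation.Nullary using (¬_; Dec; yes; no; contradiction; ¬?)
  open import Relation.Nullary.Decidable using (map′; decidable-stable; _×-dec_)
  open import Relation.Unary using (Decidable)
  open import Relation.Binary.PropositionalEquality
  import Algebra.Properties.Semiring.Mult as SemiringMult
  open import Algebra.Bundles using (CommutativeRing)
  import Data.Integer as ℤ

  -- If y were missed, punching it out would inject a finite set into a smaller one.
  injective⇒surjective : ∀ {n} (f : Fin n → Fin n) → (∀ {i j} → f i ≡ f j → i ≡ j) →
                         ∀ y → ∃ λ x → f x ≡ y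
  injective⇒surjective {suc n} f f-injective y with Fin.any? (λ x → f x Fin.≟ y)
  ... | yes found = found
  ... | no missed = contradiction (Fin.injective⇒≤ {f = g} g-injective) ℕ.1+n≰n
    where
    y≢f : ∀ x → y ≢ f x
    y≢f x eq = missed (x , sym eq)
    g : Fin (suc n) → Fin n
    g x = Fin.punchOut (y≢f x)
    g-injective : ∀ {i j} → g i ≡ g j → i ≡ j
    g-injective {i} {j} = f-injective ∘ Fin.punchOut-injective (y≢f i) (y≢f j)

  module Finite {A : Set} {n} (enum : Fin n ↔ A) where
    open Inverse enum

    from-injective : ∀ {x y} → from x ≡ from y → x ≡ y
    from-injective eq = trans (sym (strictlyInverseˡ _)) (trans (cong to eq) (strictlyInverseˡ _))

    to-injective : ∀ {i j} → to i ≡ to j → i ≡ j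
    to-injective eq = trans (sym (strictlyInverseʳ _)) (trans (cong from eq) (strictlyInverseʳ _))

    any? : ∀ {P : A → Set} → Decidable P → Dec (∃ P)
    any? {P} P? = map′ (λ (i , p) → to i , p) (λ (a , p) → from a , subst P (sym (strictlyInverseˡ a)) p)
      (Fin.any? (P? ∘ to))

    injective⇒onto : (f : A → A) → (∀ {x y} → f x ≡ f y → x ≡ y) → ∀ y → ∃ λ x → f x ≡ y
    injective⇒onto f f-injective y =
      let i , eq = injective⇒surjective (from ∘ f ∘ to) (to-injective ∘ f-injective ∘ from-injective) (from y)
      in to i , from-injective eq

    -- If every value were attained, a section of f would be injective, hence onto, and f would be
    -- injective too.
    noninjective⇒misses : (_≟_ : (x y : A) → Dec (x ≡ y)) (f : A → A) → ∀ {x y} → f x ≡ f y → x ≢ y →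
                          ∃ λ z → ∀ t → f t ≢ z
    noninjective⇒misses _≟_ f {x} {y} fx≡fy x≢y with any? (λ z → ¬? (any? (λ t → f t ≟ z)))
    ... | yes (z , missed) = z , λ t eq → missed (t , eq)
    ... | no onto = contradiction x≡y x≢y
      where
      section : ∀ z → ∃ λ t → f t ≡ z
      section z = decidable-stable (any? (λ t → f t ≟ z)) (λ missed → onto (z , missed))
      g = proj₁ ∘ section
      g-injective : ∀ {a b} → g a ≡ g b → a ≡ b
      g-injective {a} {b} eq = trans (sym (proj₂ (section a))) (trans (cong f eq) (proj₂ (section b)))
      x≡y : x ≡ y
      x≡y with injective⇒onto g g-injective x | injective⇒onto g g-injective y
      ... | a , refl | b , refl = cong g (trans (sym (proj₂ (section a))) (trans fx≡fy (proj₂ (section b))))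

  record FiniteField (q : ℕ) : Set₁ where
    field
      𝔽 : Field
    open Field 𝔽 using (Carrier; 0#)
    open SemiringMult (CommutativeRing.semiring (FieldProperties.commutativeRing 𝔽)) using () renaming (_×_ to _·_) public
    field
      enum : Fin q ↔ Carrier
      p-1 : ℕ
      characteristic : ∀ x → suc p-1 · x ≡ 0#

  module Choice {q} (FF : FiniteField q) (3≤q : 3 ℕ.≤ q) where
    open FiniteField FF
    open FieldProperties 𝔽 renaming (Carrier to F)
    open Finite enum
    open ≡-Reasoning

    third-element : ∃ λ k → k ≢ 0# × k ≢ 1#
    third-element with any? (λ k → ¬? (k ≟ 0#) ×-dec ¬? (k ≟ 1#))
    ... | yes found = found
    ... | no none = contradiction (Fin.injective⇒≤ {f = f ∘ Inverse.to enum} (to-injective ∘ f-injective)) (ℕ.<⇒≱ 3≤q)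
      where
      cases : ∀ k → k ≡ 0# ⊎ k ≡ 1#
      cases k with k ≟ 0# | k ≟ 1#
      ... | yes k≡0 | _ = inj₁ k≡0
      ... | no _ | yes k≡1 = inj₂ k≡1
      ... | no k≢0 | no k≢1 = contradiction (k , k≢0 , k≢1) none
      f : F → Fin 2
      f k = [ (λ _ → zero) , (λ _ → suc zero) ]′ (cases k)
      f-injective : ∀ {k l} → f k ≡ f l → k ≡ l
      f-injective {k} {l} eq with cases k | cases l
      ... | inj₁ refl | inj₁ refl = refl
      ... | inj₂ refl | inj₂ refl = refl
      f-injective () | inj₁ _ | inj₂ _
      f-injective () | inj₂ _ | inj₁ _

    module Even (1+1≡0 : 1# + 1# ≡ 0#) where
      x+x≡0 : ∀ x → x + x ≡ 0#
      x+x≡0 x = begin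
        x + x                ≡⟨ solve 1 (λ x → x :+ x := (con (ℤ.+ 1) :+ con (ℤ.+ 1)) :* x) refl x ⟩
        (1# + 1#) * x        ≡⟨ cong (_* x) 1+1≡0 ⟩
        0# * x               ≡⟨ zeroˡ x ⟩
        0#                   ∎

      -x≡x : ∀ x → - x ≡ x
      -x≡x x = trans (y≡x+y-x x (- x)) (trans (cong (_- x) (-‿inverseʳ x))
        (trans (cong (_- x) (sym (x+x≡0 x))) (x+y-y≡x x x)))

      -- The Artin-Schreier map t ↦ t² - t sends both 0 and 1 to 0. A missed value μ makes T² = T +
      -- μ irreducible.
      missed : ∃ λ μ → ∀ t → t * t - t ≢ μ
      missed = noninjective⇒misses _≟_ (λ t → t * t - t) {1#} {0#}
        (solve 0 (con (ℤ.+ 1) :* con (ℤ.+ 1) :- con (ℤ.+ 1) := con (ℤ.+ 0) :* con (ℤ.+ 0) :- con (ℤ.+ 0)) refl) 1≢0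

      μ = proj₁ missed

      irreducible : ∀ t → t * t ≢ 1# * t + μ
      irreducible t eq = proj₂ missed t (begin
        t * t - t              ≡⟨ cong (_- t) (trans eq (cong (_+ μ) (*-identityˡ t))) ⟩
        t + μ - t              ≡⟨ x+y-x≡y t μ ⟩
        μ                      ∎)

      square-injective : ∀ {x y} → x * x ≡ y * y → x ≡ y
      square-injective {x} {y} eq = [ id , (λ x≡-y → trans x≡-y (-x≡x y)) ]′ (x²≡y²⇒ eq)

      -- As k is neither 0 nor 1, k² - k is nonzero. Squaring is onto in characteristic 2, so k² - k
      -- is the norm b² of an element b of F.
      k = proj₁ third-element
      root = injective⇒onto (λ x → x * x) square-injective (k * k - k)
      b = proj₁ root

      b≢0 : b ≢ 0#
      b≢0 b≡0 = *-nonzero k≢0 (k≢1 ∘ x-y≡0⇒x≡y) (begin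
        k * (k - 1#)       ≡⟨ solve 1 (λ k → k :* (k :- con (ℤ.+ 1)) := k :* k :- k) refl k ⟩
        k * k - k          ≡⟨ proj₂ root ⟨
        b * b              ≡⟨ cong (_* b) b≡0 ⟩
        0# * b             ≡⟨ zeroˡ b ⟩
        0#                 ∎)
        where
        k≢0 = proj₁ (proj₂ third-element)
        k≢1 = proj₂ (proj₂ third-element)

      open QuadraticExtension 𝔽 1# μ irreducible

      -- The left norm is t² + t - μ. If it were b² = k² - k, then in characteristic 2 the value μ =
      -- (t + k)² - (t + k) would be attained.
      norms-differ : ∀ t → norm (⟦ 0# , 1# ⟧ +ᴷ ι t) ≢ norm (ι b)
      norms-differ t eq = proj₂ missed (t + k) (begin
        (t + k) * (t + k) - (t + k)
          ≡⟨ solve 3 (λ t k m → (t :+ k) :* (t :+ k) :- (t :+ k) :=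
               (t :* t :+ t :- m) :+ (t :* k :+ t :* k) :+ (k :* k :- k) :+ m :- (t :+ t)) refl t k μ ⟩
        (t * t + t - μ) + (t * k + t * k) + (k * k - k) + μ - (t + t)
          ≡⟨ cong₂ (λ x y → x + y + (k * k - k) + μ - (t + t)) norm≡ (x+x≡0 (t * k)) ⟩
        (k * k - k) + 0# + (k * k - k) + μ - (t + t)
          ≡⟨ solve 3 (λ x m z → x :+ con (ℤ.+ 0) :+ x :+ m :- z := (x :+ x) :+ m :- z) refl (k * k - k) μ (t + t) ⟩
        ((k * k - k) + (k * k - k)) + μ - (t + t)
          ≡⟨ cong₂ (λ x y → x + μ - y) (x+x≡0 (k * k - k)) (x+x≡0 t) ⟩
        0# + μ - 0#
          ≡⟨ solve 1 (λ m → con (ℤ.+ 0) :+ m :- con (ℤ.+ 0) := m) refl μ ⟩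
        μ ∎)
        where
        norm≡ : t * t + t - μ ≡ k * k - k
        norm≡ = begin
          t * t + t - μ
            ≡⟨ solve 2 (λ t m → t :* t :+ t :- m := (con (ℤ.+ 0) :+ t) :* (con (ℤ.+ 0) :+ t)
                 :+ con (ℤ.+ 1) :* ((con (ℤ.+ 0) :+ t) :* (con (ℤ.+ 1) :+ con (ℤ.+ 0)))
                 :- m :* ((con (ℤ.+ 1) :+ con (ℤ.+ 0)) :* (con (ℤ.+ 1) :+ con (ℤ.+ 0)))) refl t μ ⟩
          norm (⟦ 0# , 1# ⟧ +ᴷ ι t)   ≡⟨ eq ⟩
          norm (ι b)
            ≡⟨ solve 2 (λ b m → b :* b :+ con (ℤ.+ 1) :* (b :* con (ℤ.+ 0)) :- m :* (con (ℤ.+ 0) :* con (ℤ.+ 0)) := b :* b) refl b μ ⟩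
          b * b                       ≡⟨ proj₂ root ⟩
          k * k - k                   ∎

      spreadData : SpreadData 𝔽
      spreadData = record
        { τ = 1# ; μ = μ ; irreducible = irreducible
        ; separable = λ {b} eq _ → trans (sym (*-identityˡ b)) eq
        ; a₀ = ⟦ 0# , 1# ⟧ ; b₀ = ι b ; b₀≢0 = b≢0 ∘ cong re ; norms-differ = norms-differ }

    module Odd (1+1≢0 : 1# + 1# ≢ 0#) where
      1≢-1 : 1# ≢ - 1#
      1≢-1 eq = 1+1≢0 (trans (cong (_+_ 1#) eq) (-‿inverseʳ 1#))

      -- Squaring is not injective, as 1 and -1 are distinct with equal squares.
      nonsquare : ∃ λ d → ∀ t → t * t ≢ d
      nonsquare = noninjective⇒misses _≟_ (λ t → t * t) {1#} { - 1# }
        (solve 0 (con (ℤ.+ 1) :* con (ℤ.+ 1) := (:- con (ℤ.+ 1)) :* (:- con (ℤ.+ 1))) refl) 1≢-1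

      d = proj₁ nonsquare

      Square : F → Set
      Square x = ∃ λ t → t * t ≡ x

      square? : Decidable Square
      square? x = any? (λ t → t * t ≟ x)

      -- If subtracting d never left the squares, then d = (p - 1) (- d) would be a square.
      nonsquare-norm : ∃ λ u → ¬ Square (u * u - d)
      nonsquare-norm with any? (λ u → ¬? (square? (u * u - d)))
      ... | yes found = found
      ... | no none = contradiction (proj₂ d-square) (proj₂ nonsquare (proj₁ d-square))
        where
        multiples : ∀ n → Square (n · (- d))
        multiples zero = 0# , zeroˡ 0#
        multiples (suc n) with multiples n
        ... | u , u²≡ = let t , t²≡ = decidable-stable (square? (u * u - d)) (λ ns → none (u , ns)) in
          t , trans t²≡ (trans (cong (_- d) u²≡) (+-comm (n · (- d)) (- d)))
        d-square : Square d
        d-square = let t , t²≡ = multiples p-1 in t , (begin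
          t * t                            ≡⟨ t²≡ ⟩
          p-1 · (- d)                      ≡⟨ solve 2 (λ x d → x := :- d :+ x :+ d) refl (p-1 · (- d)) d ⟩
          - d + p-1 · (- d) + d            ≡⟨ cong (_+ d) (characteristic (- d)) ⟩
          0# + d                           ≡⟨ +-identityˡ d ⟩
          d                                ∎)

      u = proj₁ nonsquare-norm

      irreducible : ∀ t → t * t ≢ 0# * t + d
      irreducible t eq = proj₂ nonsquare t (trans eq (trans (cong (_+ d) (zeroˡ t)) (+-identityˡ d)))

      open QuadraticExtension 𝔽 0# d irreducible

      -- The left norm is the square t², and the right one is u² - d, a nonsquare by the choice of
      -- u.
      norms-differ : ∀ t → norm (ι 0# +ᴷ ι t) ≢ norm ⟦ u , 1# ⟧
      norms-differ t eq = proj₂ nonsquare-norm (t , (begin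
        t * t
          ≡⟨ solve 2 (λ t d → t :* t := (con (ℤ.+ 0) :+ t) :* (con (ℤ.+ 0) :+ t)
               :+ con (ℤ.+ 0) :* ((con (ℤ.+ 0) :+ t) :* (con (ℤ.+ 0) :+ con (ℤ.+ 0)))
               :- d :* ((con (ℤ.+ 0) :+ con (ℤ.+ 0)) :* (con (ℤ.+ 0) :+ con (ℤ.+ 0)))) refl t d ⟩
        norm (ι 0# +ᴷ ι t)    ≡⟨ eq ⟩
        norm ⟦ u , 1# ⟧
          ≡⟨ solve 2 (λ u d → u :* u :+ con (ℤ.+ 0) :* (u :* con (ℤ.+ 1)) :- d :* (con (ℤ.+ 1) :* con (ℤ.+ 1)) := u :* u :- d) refl u d ⟩
        u * u - d             ∎))

      spreadData : SpreadData 𝔽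
      spreadData = record
        { τ = 0# ; μ = d ; irreducible = irreducible
        ; separable = λ {b} _ b+b≡0 → x*y≡0⇒y≡0 1+1≢0
            (trans (solve 1 (λ b → (con (ℤ.+ 1) :+ con (ℤ.+ 1)) :* b := b :+ b) refl b) b+b≡0)
        ; a₀ = ι 0# ; b₀ = ⟦ u , 1# ⟧ ; b₀≢0 = 1≢0 ∘ cong im ; norms-differ = norms-differ }

    spreadData : SpreadData 𝔽
    spreadData with 1# + 1# ≟ 0#
    ... | yes 1+1≡0 = Even.spreadData 1+1≡0
    ... | no 1+1≢0 = Odd.spreadData 1+1≢0

-- The case q = 2: a Kirkman triple system of order 15.

module Kirkman where
  open Counting
  open import Data.Nat as ℕ using (ℕ)
  open import Data.Fin as Fin using (Fin)
  import Data.Fin.Properties as Fin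
  open import Data.Fin.Patterns
  open import Data.Fin.Subset using (∣_∣)
  open import Data.Vec using (Vec; []; _∷_; lookup)
  open import Data.Sum using (_⊎_; [_,_]′)
  open import Function using (id)
  open import Function.Properties.Inverse using (↔-refl)
  open import Relation.Nullary using (contradiction)
  open import Relation.Nullary.Decidable using (from-yes; _⊎-dec_)
  open import Relation.Unary using (Decidable)
  open import Relation.Binary.PropositionalEquality

  size-⟪⟫ : ∀ {v n} {P : Fin v → Set} (P? : Decidable P) → ∣ ⟪ P? ⟫ ∣ ≡ n → Size P n
  size-⟪⟫ P? refl = size-⇔ (∈⟪⟫⁻ P?) (∈⟪⟫⁺ P?) (size-∣∣ ⟪ P? ⟫)

  -- The points 0-6 and 7-13 are two copies of ℤ/7, the point 14 is fixed, and each row is a translate of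
  -- the first.
  kirkman : Vec (Vec (Fin 5) 15) 7
  kirkman =
    (1F ∷ 1F ∷ 2F ∷ 1F ∷ 3F ∷ 4F ∷ 0F ∷ 0F ∷ 2F ∷ 4F ∷ 4F ∷ 3F ∷ 2F ∷ 3F ∷ 0F ∷ []) ∷
    (0F ∷ 1F ∷ 1F ∷ 2F ∷ 1F ∷ 3F ∷ 4F ∷ 3F ∷ 0F ∷ 2F ∷ 4F ∷ 4F ∷ 3F ∷ 2F ∷ 0F ∷ []) ∷
    (4F ∷ 0F ∷ 1F ∷ 1F ∷ 2F ∷ 1F ∷ 3F ∷ 2F ∷ 3F ∷ 0F ∷ 2F ∷ 4F ∷ 4F ∷ 3F ∷ 0F ∷ []) ∷
    (3F ∷ 4F ∷ 0F ∷ 1F ∷ 1F ∷ 2F ∷ 1F ∷ 3F ∷ 2F ∷ 3F ∷ 0F ∷ 2F ∷ 4F ∷ 4F ∷ 0F ∷ []) ∷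
    (1F ∷ 3F ∷ 4F ∷ 0F ∷ 1F ∷ 1F ∷ 2F ∷ 4F ∷ 3F ∷ 2F ∷ 3F ∷ 0F ∷ 2F ∷ 4F ∷ 0F ∷ []) ∷
    (2F ∷ 1F ∷ 3F ∷ 4F ∷ 0F ∷ 1F ∷ 1F ∷ 4F ∷ 4F ∷ 3F ∷ 2F ∷ 3F ∷ 0F ∷ 2F ∷ 0F ∷ []) ∷
    (1F ∷ 2F ∷ 1F ∷ 3F ∷ 4F ∷ 0F ∷ 1F ∷ 2F ∷ 4F ∷ 4F ∷ 3F ∷ 2F ∷ 3F ∷ 0F ∷ 0F ∷ []) ∷
    []

  -- The counts are those of a parallelism of PG(3,2): 7 classes of 5 triples on 15 points. Both
  -- conditions are verified by evaluating a decision procedure.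
  kirkmanDesign : ResolvedDesign 7 5 15 3
  kirkmanDesign = record
    { classes = ↔-refl ; labels = ↔-refl ; points = ↔-refl ; block = block
    ; block-size = λ m x → size-⟪⟫ (λ P → block m P Fin.≟ x) (sizes m x)
    ; join = λ P P′ P≢P′ → size-⟪⟫ (λ m → block m P Fin.≟ block m P′)
        ([ (λ P≡P′ → contradiction P≡P′ P≢P′) , id ]′ (joins P P′)) }
    where
    block : Fin 7 → Fin 15 → Fin 5
    block m P = lookup (lookup kirkman m) P
    sizes : ∀ m x → ∣ ⟪ (λ P → block m P Fin.≟ x) ⟫ ∣ ≡ 3
    sizes = from-yes (Fin.all? λ m → Fin.all? λ x → ∣ ⟪ (λ P → block m P Fin.≟ x) ⟫ ∣ ℕ.≟ 3)
    joins : ∀ P P′ → P ≡ P′ ⊎ ∣ ⟪ (λ m → block m P Fin.≟ block m P′) ⟫ ∣ ≡ 1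
    joins = from-yes (Fin.all? λ P → Fin.all? λ P′ →
      (P Fin.≟ P′) ⊎-dec (∣ ⟪ (λ m → block m P Fin.≟ block m P′) ⟫ ∣ ℕ.≟ 1))

-- Polynomials over the prime field as lists of exponents.

module ExponentLists where
  open import Algebra.Bundles using (CommutativeRing)
  open import Data.Nat as ℕ using (ℕ; zero; suc; _+_; _*_; _<_; _≤_; _%_; _/_; s≤s; z≤n)
  import Data.Nat.Properties as ℕ
  open import Data.Nat.DivMod
  open import Algebra.Properties.CommutativeSemigroup ℕ.+-commutativeSemigroup using (interchange; x∙yz≈y∙xz)
  open import Data.List using (List; []; _∷_; _++_; map; downFrom)
  open import Data.Fin as Fin using (Fin; toℕ; finToFun; funToFin)
  import Data.Fin.Properties as Fin
  open import Data.Product using (∃; _,_)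
  open import Function using (_∘_)
  open import Relation.Nullary using (Dec; yes; no; contradiction)
  open import Relation.Nullary.Decidable using (map′)
  open import Relation.Binary.PropositionalEquality
  open import Level using (0ℓ)

  sumOver : List ℕ → (ℕ → ℕ) → ℕ
  sumOver [] u = 0
  sumOver (i ∷ f) u = u i + sumOver f u

  sumOver-cong : ∀ f {u v} → (∀ i → u i ≡ v i) → sumOver f u ≡ sumOver f v
  sumOver-cong [] eq = refl
  sumOver-cong (i ∷ f) eq = cong₂ _+_ (eq i) (sumOver-cong f eq)

  sumOver-++ : ∀ f g u → sumOver (f ++ g) u ≡ sumOver f u + sumOver g u
  sumOver-++ [] g u = refl
  sumOver-++ (i ∷ f) g u = trans (cong (u i +_) (sumOver-++ f g u)) (sym (ℕ.+-assoc (u i) _ _))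

  sumOver-map : ∀ (h : ℕ → ℕ) f u → sumOver (map h f) u ≡ sumOver f (u ∘ h)
  sumOver-map h [] u = refl
  sumOver-map h (i ∷ f) u = cong (u (h i) +_) (sumOver-map h f u)

  sumOver-+ : ∀ f u v → sumOver f (λ i → u i + v i) ≡ sumOver f u + sumOver f v
  sumOver-+ [] u v = refl
  sumOver-+ (i ∷ f) u v = trans (cong (u i + v i +_) (sumOver-+ f u v)) (interchange (u i) (v i) (sumOver f u) (sumOver f v))

  sumOver-0 : ∀ f → sumOver f (λ _ → 0) ≡ 0
  sumOver-0 [] = refl
  sumOver-0 (_ ∷ f) = sumOver-0 f

  sumOver-swap : ∀ f g (u : ℕ → ℕ → ℕ) →
    sumOver f (λ i → sumOver g (λ j → u i j)) ≡ sumOver g (λ j → sumOver f (λ i → u i j))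
  sumOver-swap [] g u = sym (sumOver-0 g)
  sumOver-swap (i ∷ f) g u = trans (cong (sumOver g (u i) +_) (sumOver-swap f g u))
    (sym (sumOver-+ g (u i) (λ j → sumOver f (λ i → u i j))))

  infixl 7 _⊛_
  _⊛_ : List ℕ → List ℕ → List ℕ
  [] ⊛ g = []
  (i ∷ f) ⊛ g = map (i +_) g ++ f ⊛ g

  sumOver-⊛ : ∀ f g u → sumOver (f ⊛ g) u ≡ sumOver f (λ i → sumOver g (λ j → u (i + j)))
  sumOver-⊛ [] g u = refl
  sumOver-⊛ (i ∷ f) g u = trans (sumOver-++ (map (i +_) g) (f ⊛ g) u)
    (cong₂ _+_ (sumOver-map (i +_) g u) (sumOver-⊛ f g u))

  copies : ℕ → List ℕ → List ℕ
  copies zero f = []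
  copies (suc n) f = f ++ copies n f

  sumOver-copies : ∀ n f u → sumOver (copies n f) u ≡ n * sumOver f u
  sumOver-copies zero f u = refl
  sumOver-copies (suc n) f u = trans (sumOver-++ f (copies n f) u) (cong (sumOver f u +_) (sumOver-copies n f u))

  δ : ℕ → ℕ → ℕ
  δ m n with m ℕ.≟ n
  ... | yes _ = 1
  ... | no _ = 0

  δ-≡ : ∀ {m n} → m ≡ n → δ m n ≡ 1
  δ-≡ {m} {n} eq with m ℕ.≟ n
  ... | yes _ = refl
  ... | no neq = contradiction eq neq

  δ-≢ : ∀ {m n} → m ≢ n → δ m n ≡ 0
  δ-≢ {m} {n} neq with m ℕ.≟ n
  ... | yes eq = contradiction eq neq
  ... | no _ = refl

  sumOver-δ-0 : ∀ n {m} (u : ℕ → ℕ) → n ≤ m → sumOver (downFrom n) (λ i → δ m i * u i) ≡ 0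
  sumOver-δ-0 zero u _ = refl
  sumOver-δ-0 (suc n) u n<m rewrite δ-≢ (ℕ.<⇒≢ n<m ∘ sym) = sumOver-δ-0 n u (ℕ.<⇒≤ n<m)

  sumOver-δ : ∀ n {m} (u : ℕ → ℕ) → m < n → sumOver (downFrom n) (λ i → δ m i * u i) ≡ u m
  sumOver-δ (suc n) {m} u (s≤s m≤n) with m ℕ.≟ n
  ... | yes refl = trans (cong₂ _+_ (ℕ.+-identityʳ (u m)) (sumOver-δ-0 n u ℕ.≤-refl)) (ℕ.+-identityʳ (u m))
  ... | no m≢n = sumOver-δ n u (ℕ.≤∧≢⇒< m≤n m≢n)

  -- The ring 𝔽ₚ[X]/(X^q - X), where p = 2 + p₂ and q = 2 + r. A list of exponents stands for the sum of
  -- the corresponding monomials, and it is known by its pairing with the sequences u satisfying the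
  -- recurrence u (q + n) = u (1 + n).
  module TruncatedPolynomials (p₂ r : ℕ) where
    p = suc (suc p₂)
    q = suc (suc r)

    infix 4 _≋_ _≈_
    _≋_ : ℕ → ℕ → Set
    m ≋ n = m % p ≡ n % p

    ≋-+ : ∀ m m′ n n′ → m ≋ m′ → n ≋ n′ → m + n ≋ m′ + n′
    ≋-+ m m′ n n′ eq eq′ = trans (%-distribˡ-+ m n p)
      (trans (cong₂ (λ a b → (a + b) % p) eq eq′) (sym (%-distribˡ-+ m′ n′ p)))

    ≋-* : ∀ m m′ n n′ → m ≋ m′ → n ≋ n′ → m * n ≋ m′ * n′
    ≋-* m m′ n n′ eq eq′ = trans (%-distribˡ-* m n p)
      (trans (cong₂ (λ a b → (a * b) % p) eq eq′) (sym (%-distribˡ-* m′ n′ p)))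

    sumOver-≋ : ∀ f {u v} → (∀ i → u i ≋ v i) → sumOver f u ≋ sumOver f v
    sumOver-≋ [] eq = refl
    sumOver-≋ (i ∷ f) {u} {v} eq = ≋-+ (u i) (v i) (sumOver f u) (sumOver f v) (eq i) (sumOver-≋ f eq)

    Periodic : (ℕ → ℕ) → Set
    Periodic u = ∀ n → u (q + n) ≡ u (1 + n)

    -- Shifting a sequence is adjoint to multiplying by X^i, so this is what makes `_≈_` a
    -- congruence for `_⊛_`.
    shift-periodic : ∀ {u} i → Periodic u → Periodic (λ j → u (i + j))
    shift-periodic {u} i per n = trans (cong u (x∙yz≈y∙xz i q n))
      (trans (per (i + n)) (cong u (sym (ℕ.+-suc i n))))

    record _≈_ (f g : List ℕ) : Set where
      constructor mk
      field at : ∀ u → Periodic u → sumOver f u ≋ sumOver g u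
    open _≈_ public

    exact : ∀ {f g} → (∀ u → sumOver f u ≡ sumOver g u) → f ≈ g
    exact eq = mk λ u _ → cong (_% p) (eq u)

    -- In characteristic p the negative of f is p - 1 copies of f.
    neg : List ℕ → List ℕ
    neg = copies (suc p₂)

    ++-cong : ∀ {f f′ g g′} → f ≈ f′ → g ≈ g′ → f ++ g ≈ f′ ++ g′
    ++-cong {f} {f′} {g} {g′} eq eq′ = mk λ u per →
      trans (cong (_% p) (sumOver-++ f g u))
        (trans (≋-+ (sumOver f u) (sumOver f′ u) (sumOver g u) (sumOver g′ u) (at eq u per) (at eq′ u per)) (cong (_% p) (sym (sumOver-++ f′ g′ u))))

    copies-cong : ∀ n {f g} → f ≈ g → copies n f ≈ copies n g
    copies-cong zero eq = mk λ _ _ → refl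
    copies-cong (suc n) eq = ++-cong eq (copies-cong n eq)

    ⊛-comm : ∀ f g → f ⊛ g ≈ g ⊛ f
    ⊛-comm f g = exact λ u → begin
      sumOver (f ⊛ g) u                                 ≡⟨ sumOver-⊛ f g u ⟩
      sumOver f (λ i → sumOver g (λ j → u (i + j)))     ≡⟨ sumOver-swap f g (λ i j → u (i + j)) ⟩
      sumOver g (λ j → sumOver f (λ i → u (i + j)))     ≡⟨ sumOver-cong g (λ j → sumOver-cong f (λ i → cong u (ℕ.+-comm i j))) ⟩
      sumOver g (λ j → sumOver f (λ i → u (j + i)))     ≡⟨ sumOver-⊛ g f u ⟨
      sumOver (g ⊛ f) u                                 ∎
      where open ≡-Reasoning

    ≈-trans : ∀ {f g h} → f ≈ g → g ≈ h → f ≈ h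
    ≈-trans eq eq′ = mk λ u per → trans (at eq u per) (at eq′ u per)

    ⊛-congˡ : ∀ f {g g′} → g ≈ g′ → f ⊛ g ≈ f ⊛ g′
    ⊛-congˡ f {g} {g′} eq = mk λ u per → trans (cong (_% p) (sumOver-⊛ f g u))
      (trans (sumOver-≋ f (λ i → at eq _ (shift-periodic {u} i per))) (cong (_% p) (sym (sumOver-⊛ f g′ u))))

    ⊛-assoc : ∀ f g h → (f ⊛ g) ⊛ h ≈ f ⊛ (g ⊛ h)
    ⊛-assoc f g h = exact λ u → begin
      sumOver ((f ⊛ g) ⊛ h) u
        ≡⟨ sumOver-⊛ (f ⊛ g) h u ⟩
      sumOver (f ⊛ g) (λ n → sumOver h (λ k → u (n + k)))
        ≡⟨ sumOver-⊛ f g _ ⟩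
      sumOver f (λ i → sumOver g (λ j → sumOver h (λ k → u (i + j + k))))
        ≡⟨ sumOver-cong f (λ i → sumOver-cong g (λ j → sumOver-cong h (λ k → cong u (ℕ.+-assoc i j k)))) ⟩
      sumOver f (λ i → sumOver g (λ j → sumOver h (λ k → u (i + (j + k)))))
        ≡⟨ sumOver-cong f (λ i → sumOver-⊛ g h (λ n → u (i + n))) ⟨
      sumOver f (λ i → sumOver (g ⊛ h) (λ n → u (i + n)))
        ≡⟨ sumOver-⊛ f (g ⊛ h) u ⟨
      sumOver (f ⊛ (g ⊛ h)) u ∎
      where open ≡-Reasoning

    ⊛-identityˡ : ∀ f → (0 ∷ []) ⊛ f ≈ f
    ⊛-identityˡ f = exact λ u → trans (sumOver-⊛ (0 ∷ []) f u) (ℕ.+-identityʳ _)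

    ⊛-distribˡ : ∀ f g h → f ⊛ (g ++ h) ≈ f ⊛ g ++ f ⊛ h
    ⊛-distribˡ f g h = exact λ u → begin
      sumOver (f ⊛ (g ++ h)) u
        ≡⟨ sumOver-⊛ f (g ++ h) u ⟩
      sumOver f (λ i → sumOver (g ++ h) (λ j → u (i + j)))
        ≡⟨ sumOver-cong f (λ i → sumOver-++ g h _) ⟩
      sumOver f (λ i → sumOver g (λ j → u (i + j)) + sumOver h (λ j → u (i + j)))
        ≡⟨ sumOver-+ f _ _ ⟩
      sumOver f (λ i → sumOver g (λ j → u (i + j))) + sumOver f (λ i → sumOver h (λ j → u (i + j)))
        ≡⟨ cong₂ _+_ (sumOver-⊛ f g u) (sumOver-⊛ f h u) ⟨
      sumOver (f ⊛ g) u + sumOver (f ⊛ h) u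
        ≡⟨ sumOver-++ (f ⊛ g) (f ⊛ h) u ⟨
      sumOver (f ⊛ g ++ f ⊛ h) u ∎
      where open ≡-Reasoning

    ++-comm : ∀ f g → f ++ g ≈ g ++ f
    ++-comm f g = exact λ u → trans (sumOver-++ f g u) (trans (ℕ.+-comm (sumOver f u) (sumOver g u)) (sym (sumOver-++ g f u)))

    p-copies : ∀ f → copies p f ≈ []
    p-copies f = mk λ u _ → trans (cong (_% p) (trans (sumOver-copies p f u) (ℕ.*-comm p (sumOver f u))))
      (m*n%n≡0 (sumOver f u) p)

    commutativeRing : CommutativeRing 0ℓ 0ℓ
    commutativeRing = record
      { Carrier = List ℕ ; _≈_ = _≈_ ; _+_ = _++_ ; _*_ = _⊛_ ; -_ = neg ; 0# = [] ; 1# = 0 ∷ []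
      ; isCommutativeRing = record
        { isRing = record
          { +-isAbelianGroup = record
            { isGroup = record
              { isMonoid = record
                { isSemigroup = record
                  { isMagma = record
                    { isEquivalence = record
                      { refl = mk λ _ _ → refl ; sym = λ eq → mk λ u per → sym (at eq u per) ; trans = ≈-trans }
                    ; ∙-cong = ++-cong }
                  ; assoc = λ f g h → exact λ u → cong (λ l → sumOver l u) (++-assoc f g h) }
                ; identity = (λ _ → mk λ _ _ → refl) , λ f → exact λ u → cong (λ l → sumOver l u) (++-identityʳ f) }
              ; inverse = (λ f → ≈-trans (++-comm (neg f) f) (p-copies f)) , p-copies
              ; ⁻¹-cong = copies-cong (suc p₂) }
            ; comm = ++-comm }
          ; *-cong = λ {f} {f′} {g} {g′} eq eq′ → ≈-trans (⊛-congˡ f eq′)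
              (≈-trans (⊛-comm f g′) (≈-trans (⊛-congˡ g′ eq) (⊛-comm g′ f′)))
          ; *-assoc = ⊛-assoc
          ; *-identity = ⊛-identityˡ , λ f → ≈-trans (⊛-comm f (0 ∷ [])) (⊛-identityˡ f)
          ; distrib = ⊛-distribˡ , λ f g h → ≈-trans (⊛-comm (g ++ h) f)
              (≈-trans (⊛-distribˡ f g h) (++-cong (⊛-comm f g) (⊛-comm f h))) }
        ; *-comm = ⊛-comm } }
      where open import Data.List.Properties using (++-assoc; ++-identityʳ)

    -- X^q = X identifies positive exponents modulo q - 1 = 1 + r and leaves X^0 alone, so the
    -- representatives are 0 and 1, ..., q - 1.
    reduce : ℕ → ℕ
    reduce zero = zero
    reduce (suc n) = suc (n % suc r)

    reduce< : ∀ n → reduce n < q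
    reduce< zero = s≤s z≤n
    reduce< (suc n) = s≤s (m%n<n n (suc r))

    reduce-id : ∀ {n} → n < q → reduce n ≡ n
    reduce-id {zero} _ = refl
    reduce-id {suc n} (s≤s n<q-1) = cong suc (m<n⇒m%n≡m n<q-1)

    reduce-periodic : ∀ n → reduce (q + n) ≡ reduce (1 + n)
    reduce-periodic n = cong suc (trans (cong (_% suc r) (ℕ.+-comm (suc r) n)) ([m+n]%n≡m%n n (suc r)))

    periodic-multiple : ∀ u → Periodic u → ∀ a m → u (suc (a + m * suc r)) ≡ u (suc a)
    periodic-multiple u per a zero = cong (u ∘ suc) (ℕ.+-identityʳ a)
    periodic-multiple u per a (suc m) = trans (cong (u ∘ suc) (x∙yz≈y∙xz a (suc r) (m * suc r)))
      (trans (per (a + m * suc r)) (periodic-multiple u per a m))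

    periodic-reduce : ∀ u → Periodic u → ∀ n → u n ≡ u (reduce n)
    periodic-reduce u per zero = refl
    periodic-reduce u per (suc n) = trans (cong (u ∘ suc) (m≡m%n+[m/n]*n n (suc r)))
      (periodic-multiple u per (n % suc r) (n / suc r))

    coefficient : List ℕ → ℕ → ℕ
    coefficient f i = sumOver f (λ n → δ (reduce n) i)

    δ-periodic : ∀ i → Periodic (λ n → δ (reduce n) i)
    δ-periodic i n = cong (λ m → δ m i) (reduce-periodic n)

    -- A periodic sequence is determined by its first q values. Hence the q sequences that define
    -- `coefficient` detect equality, and `_≈_` is decidable.
    expand : ∀ {u} → Periodic u → ∀ f → sumOver f u ≡ sumOver (downFrom q) (λ i → coefficient f i * u i)
    expand {u} per f = begin
      sumOver f u
        ≡⟨ sumOver-cong f (λ n → trans (periodic-reduce u per n) (sym (sumOver-δ q u (reduce< n)))) ⟩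
      sumOver f (λ n → sumOver (downFrom q) (λ i → δ (reduce n) i * u i))
        ≡⟨ sumOver-swap f (downFrom q) _ ⟩
      sumOver (downFrom q) (λ i → sumOver f (λ n → δ (reduce n) i * u i))
        ≡⟨ sumOver-cong (downFrom q) (λ i → sumOver-*ʳ f _ (u i)) ⟩
      sumOver (downFrom q) (λ i → coefficient f i * u i) ∎
      where
      open ≡-Reasoning
      sumOver-*ʳ : ∀ f u c → sumOver f (λ i → u i * c) ≡ sumOver f u * c
      sumOver-*ʳ [] u c = refl
      sumOver-*ʳ (i ∷ f) u c = trans (cong (u i * c +_) (sumOver-*ʳ f u c)) (sym (ℕ.*-distribʳ-+ c (u i) (sumOver f u)))

    sumBelow-≋ : ∀ n u v → (∀ {i} → i < n → u i ≋ v i) → sumOver (downFrom n) u ≋ sumOver (downFrom n) v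
    sumBelow-≋ zero u v eq = refl
    sumBelow-≋ (suc n) u v eq = ≋-+ (u n) (v n) _ _ (eq ℕ.≤-refl) (sumBelow-≋ n u v (eq ∘ ℕ.m≤n⇒m≤1+n))

    coefficients⇒≈ : ∀ {f g} → (∀ {i} → i < q → coefficient f i ≋ coefficient g i) → f ≈ g
    coefficients⇒≈ {f} {g} eq = mk λ u per → trans (cong (_% p) (expand per f))
      (trans (sumBelow-≋ q (λ i → coefficient f i * u i) (λ i → coefficient g i * u i)
               (λ {i} i<q → ≋-* (coefficient f i) (coefficient g i) (u i) (u i) (eq i<q) refl))
             (cong (_% p) (sym (expand per g))))

    ≈⇒coefficients : ∀ {f g} → f ≈ g → ∀ i → coefficient f i ≋ coefficient g i
    ≈⇒coefficients eq i = at eq _ (δ-periodic i)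

    infix 4 _≈?_
    _≈?_ : ∀ f g → Dec (f ≈ g)
    f ≈? g = map′
      (λ eq → coefficients⇒≈ λ {i} i<q → subst (λ i → coefficient f i ≋ coefficient g i) (Fin.toℕ-fromℕ< i<q) (eq (Fin.fromℕ< i<q)))
      (λ eq i → ≈⇒coefficients eq (toℕ i))
      (Fin.all? {q} (λ i → coefficient f (toℕ i) % p ℕ.≟ coefficient g (toℕ i) % p))

    fromCoefficients : ℕ → (ℕ → ℕ) → List ℕ
    fromCoefficients zero c = []
    fromCoefficients (suc n) c = copies (c n) (n ∷ []) ++ fromCoefficients n c

    sumOver-fromCoefficients : ∀ n c u → sumOver (fromCoefficients n c) u ≡ sumOver (downFrom n) (λ i → c i * u i)
    sumOver-fromCoefficients zero c u = refl
    sumOver-fromCoefficients (suc n) c u = trans (sumOver-++ (copies (c n) (n ∷ [])) _ u)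
      (cong₂ _+_ (trans (sumOver-copies (c n) (n ∷ []) u) (cong (c n *_) (ℕ.+-identityʳ (u n))))
                 (sumOver-fromCoefficients n c u))

    -- The coefficients are the q digits of j in base p. Taking `i mod q` only makes the digit
    -- function total, since i stays below q.
    enumeration : Fin (p ℕ.^ q) → List ℕ
    enumeration j = fromCoefficients q (λ i → toℕ (finToFun {p} {q} j (i mod q)))

    enumeration-complete : ∀ f → ∃ λ j → f ≈ enumeration j
    enumeration-complete f = j , mk λ u per → trans (cong (_% p) (expand per f))
      (trans (sumBelow-≋ q (λ i → coefficient f i * u i) (λ i → toℕ (finToFun j (i mod q)) * u i)
        (λ {i} i<q → ≋-* (coefficient f i) (toℕ (finToFun j (i mod q))) (u i) (u i) (digit i<q) refl))
        (cong (_% p) (sym (sumOver-fromCoefficients q (λ i → toℕ (finToFun j (i mod q))) u))))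
      where
      digits : Fin q → Fin p
      digits i = coefficient f (toℕ i) mod p
      j = funToFin digits
      digit : ∀ {i} → i < q → coefficient f i ≋ toℕ (finToFun j (i mod q))
      digit {i} i<q = sym (begin
        toℕ (finToFun j (i mod q)) % p               ≡⟨ cong (λ d → toℕ d % p) (Fin.finToFun-funToFin digits (i mod q)) ⟩
        toℕ (digits (i mod q)) % p                   ≡⟨ cong (_% p) (Fin.toℕ-fromℕ< (m%n<n (coefficient f (toℕ (i mod q))) p)) ⟩
        coefficient f (toℕ (i mod q)) % p % p        ≡⟨ m%n%n≡m%n (coefficient f (toℕ (i mod q))) p ⟩
        coefficient f (toℕ (i mod q)) % p            ≡⟨ cong (λ i → coefficient f i % p) (trans (Fin.toℕ-fromℕ< _) (m<n⇒m%n≡m i<q)) ⟩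
        coefficient f i % p                          ∎)
        where open ≡-Reasoning

-- Frobenius, roots of polynomials, and localisation.

module RingTheory where
  open Solver
  open import Algebra.Bundles using (CommutativeRing)
  open import Data.Nat as ℕ using (ℕ; zero; suc; _<_; _≤_; s≤s; z≤n; _∸_)
  import Data.Nat.Properties as ℕ
  open import Data.Nat.Combinatorics using (_C_; nCn≡1; nCk≡nC[n∸k]; nCk≡n!/k![n-k]!; k![n∸k]!∣n!)
  open import Data.Nat using (_!)
  open import Data.Nat.Divisibility using (_∣_; divides; ∣⇒≤; m∣m*n; ∣1⇒≡1)
  open import Data.Nat.DivMod using (m/n*n≡m)
  open import Data.Nat.Primality using (Prime; euclidsLemma; ¬prime[1])
  open import Data.Nat.Coprimality using (coprime-Bézout; prime⇒coprime)
  open import Data.Nat.GCD using (module Bézout)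
  open import Data.Fin as Fin using (Fin; toℕ; inject₁; fromℕ)
  import Data.Fin.Properties as Fin
  open import Data.Vec as Vec using (Vec; []; _∷_)
  open import Data.Vec.Relation.Unary.All as All using (All; []; _∷_)
  open import Data.Sum using (inj₁; inj₂)
  open import Data.Product using (_,_)
  open import Function using (_∘_)
  open import Relation.Nullary using (¬_; contradiction)
  open import Relation.Binary.PropositionalEquality as ≡ using (_≡_)
  import Data.Integer as ℤ

  prime∣! : ∀ {p} → Prime p → ∀ n → p ∣ n ! → p ≤ n
  prime∣! pr zero p∣1 with ≡.refl ← ∣1⇒≡1 p∣1 = contradiction pr ¬prime[1]
  prime∣! pr (suc n) p∣n! with euclidsLemma (suc n) (n !) pr p∣n!
  ... | inj₁ p∣n = ∣⇒≤ p∣n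
  ... | inj₂ p∣n! = ℕ.m≤n⇒m≤1+n (prime∣! pr n p∣n!)

  -- p divides p! = (p C k) k! (p - k)!, but neither of the two factorials of numbers below p.
  prime∣binomial : ∀ {p k} → Prime p → 0 < k → k < p → p ∣ p C k
  prime∣binomial {p@(suc p′)} {k} pr 0<k k<p with euclidsLemma (p C k) (k ! ℕ.* (p ∸ k) !) pr p∣p!
    where
    instance _ = k ℕ.!* (p ∸ k) !≢0
    p∣p! : p ∣ (p C k) ℕ.* (k ! ℕ.* (p ∸ k) !)
    p∣p! = ≡.subst (p ∣_) (≡.sym (≡.trans (≡.cong (ℕ._* (k ! ℕ.* (p ∸ k) !)) (nCk≡n!/k![n-k]! (ℕ.<⇒≤ k<p)))
      (m/n*n≡m (k![n∸k]!∣n! (ℕ.<⇒≤ k<p))))) (m∣m*n (p′ !))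
  ... | inj₁ p∣C = p∣C
  ... | inj₂ p∣k![p-k]! with euclidsLemma (k !) ((p ∸ k) !) pr p∣k![p-k]!
  ... | inj₁ p∣k! = contradiction (prime∣! pr k p∣k!) (ℕ.<⇒≱ k<p)
  ... | inj₂ p∣[p-k]! = contradiction (prime∣! pr (p ∸ k) p∣[p-k]!)
    (ℕ.<⇒≱ (ℕ.∸-monoʳ-< 0<k (ℕ.<⇒≤ k<p)))

  module PrimeCharacteristic {c ℓ} (R : CommutativeRing c ℓ) where
    open CommutativeRing R
    open import Algebra.Properties.Semiring.Mult semiring using (×-assocˡ; ×-homo-1; ×-congˡ; ×1-homo-*) renaming (_×_ to _·_)
    open import Algebra.Properties.CommutativeSemiring.Exp commutativeSemiring
    open import Algebra.Properties.CommutativeSemiring.Binomial commutativeSemiring using (theorem; binomialTerm)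
    open import Algebra.Properties.Semiring.Sum semiring using (sum; sum-init-last; sum-cong-≋; sum-replicate-zero)
    open import Relation.Binary.Reasoning.Setoid setoid

    1^n≈1 : ∀ n → 1# ^ n ≈ 1#
    1^n≈1 zero = refl
    1^n≈1 (suc n) = trans (*-identityˡ _) (1^n≈1 n)

    0^n≈0 : ∀ n → 0# ^ suc n ≈ 0#
    0^n≈0 n = zeroˡ _

    module _ {p} (p-prime : Prime p) (char : ∀ x → p · x ≈ 0#) where

      ∣⇒·≈0 : ∀ {n} → p ∣ n → ∀ x → n · x ≈ 0#
      ∣⇒·≈0 (divides m ≡.refl) x = trans (×-congˡ {x} (ℕ.*-comm m p)) (trans (sym (×-assocˡ x p m)) (char (m · x)))

      frobenius-+ : ∀ x y → (x + y) ^ p ≈ x ^ p + y ^ p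
      frobenius-+ x y = go p-prime char ∣⇒·≈0
        where
        -- p is abstracted anew so that it can be matched as `suc n`, the form in which the first
        -- and last binomial terms split off.
        go : ∀ {p} → Prime p → (∀ x → p · x ≈ 0#) → (∀ {n} → p ∣ n → ∀ x → n · x ≈ 0#) → (x + y) ^ p ≈ x ^ p + y ^ p
        go {suc n} pr ch ∣⇒0 = begin
          (x + y) ^ suc n
            ≈⟨ theorem (suc n) x y ⟩
          term Fin.zero + sum (λ k → term (Fin.suc k))
            ≈⟨ +-cong first (sum-init-last (λ k → term (Fin.suc k))) ⟩
          y ^ suc n + (sum (λ k → term (Fin.suc (inject₁ k))) + term (Fin.suc (fromℕ n)))
            ≈⟨ +-congˡ (+-cong (trans (sum-cong-≋ middle) (sum-replicate-zero n)) final) ⟩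
          y ^ suc n + (0# + x ^ suc n)
            ≈⟨ trans (+-congˡ (+-identityˡ _)) (+-comm _ _) ⟩
          x ^ suc n + y ^ suc n ∎
          where
          term = binomialTerm x y (suc n)
          first : term Fin.zero ≈ y ^ suc n
          first = trans (×-congˡ {1# * y ^ suc n} (≡.trans (nCk≡nC[n∸k] {0} {suc n} z≤n) (nCn≡1 (suc n))))
            (trans (×-homo-1 _) (*-identityˡ _))
          final : term (Fin.suc (fromℕ n)) ≈ x ^ suc n
          final = top (toℕ (fromℕ n)) (Fin.toℕ-fromℕ n)
            where
            top : ∀ m → m ≡ n → (suc n C suc m) · (x ^ suc m * y ^ (n ∸ m)) ≈ x ^ suc n
            top m ≡.refl = trans (×-congˡ {x ^ suc n * y ^ (n ∸ n)} (nCn≡1 (suc n)))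
              (trans (×-homo-1 _) (trans (*-congˡ (^-congʳ y (ℕ.n∸n≡0 n))) (*-identityʳ _)))
          middle : ∀ i → term (Fin.suc (inject₁ i)) ≈ 0#
          middle i = ∣⇒0 (prime∣binomial pr (s≤s z≤n)
            (s≤s (≡.subst (_< n) (≡.sym (Fin.toℕ-inject₁ i)) (Fin.toℕ<n i)))) _

      frobenius^-+ : ∀ j x y → (x + y) ^ (p ℕ.^ j) ≈ x ^ (p ℕ.^ j) + y ^ (p ℕ.^ j)
      frobenius^-+ zero x y = trans (*-identityʳ _) (sym (+-cong (*-identityʳ x) (*-identityʳ y)))
      frobenius^-+ (suc j) x y = begin
        (x + y) ^ (p ℕ.* p ℕ.^ j)                      ≈⟨ ^-assocʳ (x + y) p (p ℕ.^ j) ⟨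
        ((x + y) ^ p) ^ (p ℕ.^ j)                      ≈⟨ ^-congˡ (p ℕ.^ j) (frobenius-+ x y) ⟩
        (x ^ p + y ^ p) ^ (p ℕ.^ j)                    ≈⟨ frobenius^-+ j (x ^ p) (y ^ p) ⟩
        (x ^ p) ^ (p ℕ.^ j) + (y ^ p) ^ (p ℕ.^ j)      ≈⟨ +-cong (^-assocʳ x p (p ℕ.^ j)) (^-assocʳ y p (p ℕ.^ j)) ⟩
        x ^ (p ℕ.* p ℕ.^ j) + y ^ (p ℕ.* p ℕ.^ j)      ∎

      frobenius-· : ∀ n → (n · 1#) ^ p ≈ n · 1#
      frobenius-· zero = go p-prime
        where
        go : ∀ {p} → Prime p → 0# ^ p ≈ 0#
        go {suc p} _ = 0^n≈0 p
      frobenius-· (suc n) = trans (frobenius-+ 1# (n · 1#)) (+-cong (1^n≈1 p) (frobenius-· n))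

      -- n and p are coprime, so a Bézout relation would turn n · 1 = 0 and p · 1 = 0 into 1 = 0.
      n·1≉0 : ¬ 1# ≈ 0# → ∀ {n} → 0 < n → n < p → ¬ n · 1# ≈ 0#
      n·1≉0 1≉0 {suc n} _ n<p n·1≈0 with coprime-Bézout (prime⇒coprime p-prime n<p)
      ... | Bézout.+- x y eq = 1≉0 (begin
        1#                                ≈⟨ +-identityʳ 1# ⟨
        1# + 0#                           ≈⟨ +-congˡ (trans (×1-homo-* y (suc n)) (trans (*-congˡ n·1≈0) (zeroʳ _))) ⟨
        (1 ℕ.+ y ℕ.* suc n) · 1#          ≈⟨ ×-congˡ {1#} eq ⟩
        (x ℕ.* p) · 1#                    ≈⟨ trans (×1-homo-* x p) (trans (*-congˡ (char 1#)) (zeroʳ _)) ⟩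
        0#                                ∎)
      ... | Bézout.-+ x y eq = 1≉0 (begin
        1#                                ≈⟨ +-identityʳ 1# ⟨
        1# + 0#                           ≈⟨ +-congˡ (trans (×1-homo-* x p) (trans (*-congˡ (char 1#)) (zeroʳ _))) ⟨
        (1 ℕ.+ x ℕ.* p) · 1#              ≈⟨ ×-congˡ {1#} eq ⟩
        (y ℕ.* suc n) · 1#                ≈⟨ trans (×1-homo-* y (suc n)) (trans (*-congˡ n·1≈0) (zeroʳ _)) ⟩
        0#                                ∎)

  module Domain {c ℓ} (R : CommutativeRing c ℓ) where
    open CommutativeRing R
    open IntegerSolver R using (solve; _:+_; _:*_; _:-_; :-_; _:=_; con)
    open import Relation.Binary.Reasoning.Setoid setoid

    x-y≈0⇒x≈y : ∀ {x y} → x - y ≈ 0# → x ≈ y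
    x-y≈0⇒x≈y {x} {y} eq = trans (solve 2 (λ x y → x := x :- y :+ y) refl x y)
      (trans (+-congʳ eq) (+-identityˡ y))

    x≈y⇒x-y≈0 : ∀ {x y} → x ≈ y → x - y ≈ 0#
    x≈y⇒x-y≈0 {x} {y} eq = trans (+-congʳ eq) (-‿inverseʳ y)

    horner : ∀ {n} → Vec Carrier n → Carrier → Carrier
    horner [] x = 0#
    horner (c ∷ cs) x = c + x * horner cs x

    horner-cong : ∀ {n} (cs : Vec Carrier n) {x y} → x ≈ y → horner cs x ≈ horner cs y
    horner-cong [] eq = refl
    horner-cong (c ∷ cs) eq = +-congˡ (*-cong eq (horner-cong cs eq))

    -- Synthetic division by x - r, with coefficients listed from the constant term upwards; the
    -- remainder is the value at r.
    quotient : ∀ {n} → Vec Carrier (suc n) → Carrier → Vec Carrier n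
    quotient (c ∷ []) r = []
    quotient (c ∷ cs@(_ ∷ _)) r = horner cs r ∷ quotient cs r

    horner-quotient : ∀ {n} (cs : Vec Carrier (suc n)) r x →
      horner cs x - horner cs r ≈ (x - r) * horner (quotient cs r) x
    horner-quotient (c ∷ []) r x =
      solve 3 (λ c r x → (c :+ x :* con (ℤ.+ 0)) :- (c :+ r :* con (ℤ.+ 0)) := (x :- r) :* con (ℤ.+ 0)) refl c r x
    horner-quotient (c ∷ cs@(_ ∷ _)) r x = begin
      (c + x * horner cs x) - (c + r * horner cs r)
        ≈⟨ solve 5 (λ c x h r k → (c :+ x :* h) :- (c :+ r :* k) := (x :- r) :* k :+ x :* (h :- k)) refl c x (horner cs x) r (horner cs r) ⟩
      (x - r) * horner cs r + x * (horner cs x - horner cs r)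
        ≈⟨ +-congˡ (*-congˡ (horner-quotient cs r x)) ⟩
      (x - r) * horner cs r + x * ((x - r) * horner (quotient cs r) x)
        ≈⟨ solve 4 (λ x r k g → (x :- r) :* k :+ x :* ((x :- r) :* g) := (x :- r) :* (k :+ x :* g)) refl x r (horner cs r) (horner (quotient cs r) x) ⟩
      (x - r) * (horner cs r + x * horner (quotient cs r) x) ∎

    quotient≈0 : ∀ {n} (cs : Vec Carrier (suc n)) r → horner cs r ≈ 0# →
      All (_≈ 0#) (quotient cs r) → All (_≈ 0#) cs
    quotient≈0 (c ∷ []) r eq [] = trans (solve 2 (λ c r → c := c :+ r :* con (ℤ.+ 0)) refl c r) eq ∷ []
    quotient≈0 (c ∷ cs@(_ ∷ _)) r eq (h≈0 ∷ zeros) = c≈0 ∷ quotient≈0 cs r h≈0 zeros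
      where
      c≈0 : c ≈ 0#
      c≈0 = begin
        c                      ≈⟨ solve 2 (λ c r → c := c :+ r :* con (ℤ.+ 0)) refl c r ⟩
        c + r * 0#             ≈⟨ +-congˡ (*-congˡ h≈0) ⟨
        c + r * horner cs r    ≈⟨ eq ⟩
        0#                     ∎

    module _ (cancel : ∀ {x y} → ¬ x ≈ 0# → x * y ≈ 0# → y ≈ 0#) where

      -- Dividing by x minus the first root leaves a polynomial that vanishes at the other roots.
      -- Once that one is zero, so is the original.
      roots⇒zero : ∀ {n} (cs : Vec Carrier n) (roots : Fin n → Carrier) →
        (∀ {i j} → roots i ≈ roots j → i ≡ j) → (∀ i → horner cs (roots i) ≈ 0#) → All (_≈ 0#) cs
      roots⇒zero [] roots distinct vanish = []
      roots⇒zero (c ∷ cs) roots distinct vanish = quotient≈0 (c ∷ cs) r (vanish Fin.zero)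
        (roots⇒zero (quotient (c ∷ cs) r) (roots ∘ Fin.suc) (Fin.suc-injective ∘ distinct) λ i →
          cancel (λ eq → Fin.0≢1+n (≡.sym (distinct (x-y≈0⇒x≈y eq))))
            (trans (sym (horner-quotient (c ∷ cs) r (roots (Fin.suc i))))
              (x≈y⇒x-y≈0 (trans (vanish (Fin.suc i)) (sym (vanish Fin.zero))))))
        where r = roots Fin.zero

  -- For an idempotent e this is the factor ring e R: x ↦ e x identifies the two. Elements and
  -- operations stay as they are and only the equality changes.
  module Localisation {c ℓ} (R : CommutativeRing c ℓ) (e : CommutativeRing.Carrier R) where
    open CommutativeRing R
    open IntegerSolver R using (solve; _:*_; _:=_)
    open import Relation.Binary.Reasoning.Setoid setoid

    infix 4 _≈ₑ_
    record _≈ₑ_ (x y : Carrier) : Set ℓ where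
      constructor mkₑ
      field times-e : e * x ≈ e * y
    open _≈ₑ_ public

    ≈⇒≈ₑ : ∀ {x y} → x ≈ y → x ≈ₑ y
    ≈⇒≈ₑ eq = mkₑ (*-congˡ eq)

    localised : CommutativeRing c ℓ
    localised = record
      { Carrier = Carrier ; _≈_ = _≈ₑ_ ; _+_ = _+_ ; _*_ = _*_ ; -_ = -_ ; 0# = 0# ; 1# = 1#
      ; isCommutativeRing = record
        { isRing = record
          { +-isAbelianGroup = record
            { isGroup = record
              { isMonoid = record
                { isSemigroup = record
                  { isMagma = record
                    { isEquivalence = record
                      { refl = mkₑ refl ; sym = λ eq → mkₑ (sym (times-e eq))
                      ; trans = λ eq eq′ → mkₑ (trans (times-e eq) (times-e eq′)) }
                    ; ∙-cong = λ eq eq′ → mkₑ (trans (distribˡ e _ _) (trans (+-cong (times-e eq) (times-e eq′)) (sym (distribˡ e _ _)))) }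
                  ; assoc = λ x y z → ≈⇒≈ₑ (+-assoc x y z) }
                ; identity = ≈⇒≈ₑ ∘ +-identityˡ , ≈⇒≈ₑ ∘ +-identityʳ }
              ; inverse = ≈⇒≈ₑ ∘ -‿inverseˡ , ≈⇒≈ₑ ∘ -‿inverseʳ
              ; ⁻¹-cong = λ {x} {y} eq → mkₑ (trans (sym (-‿distribʳ-* e x)) (trans (-‿cong (times-e eq)) (-‿distribʳ-* e y))) }
            ; comm = λ x y → ≈⇒≈ₑ (+-comm x y) }
          ; *-cong = λ {x} {x′} {y} {y′} eq eq′ → mkₑ (begin
              e * (x * y)         ≈⟨ *-assoc e x y ⟨
              (e * x) * y         ≈⟨ *-congʳ (times-e eq) ⟩
              (e * x′) * y        ≈⟨ solve 3 (λ e x y → e :* x :* y := x :* (e :* y)) refl e x′ y ⟩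
              x′ * (e * y)        ≈⟨ *-congˡ (times-e eq′) ⟩
              x′ * (e * y′)       ≈⟨ solve 3 (λ e x y → x :* (e :* y) := e :* (x :* y)) refl e x′ y′ ⟩
              e * (x′ * y′)       ∎)
          ; *-assoc = λ x y z → ≈⇒≈ₑ (*-assoc x y z)
          ; *-identity = ≈⇒≈ₑ ∘ *-identityˡ , ≈⇒≈ₑ ∘ *-identityʳ
          ; distrib = (λ x y z → ≈⇒≈ₑ (distribˡ x y z)) , (λ x y z → ≈⇒≈ₑ (distribʳ x y z)) }
        ; *-comm = λ x y → ≈⇒≈ₑ (*-comm x y) } }
      where open import Algebra.Properties.Ring ring using (-‿distribʳ-*)

-- Enumerating the field by polynomials of degree below k.

module Galois where
  open Solver
  open Fields
  open FiniteFields
  open RingTheory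
  open import Algebra.Bundles using (CommutativeRing; RawRing)
  open import Algebra.Morphism.Structures using (IsRingMonomorphism)
  import Algebra.Morphism.RingMonomorphism as RingMonomorphism
  import Algebra.Properties.CommutativeSemiring.Exp as CommutativeSemiringExp
  import Algebra.Properties.Semiring.Mult as SemiringMult
  open import Data.Nat as ℕ using (ℕ; zero; suc; _<_; _≤_; s≤s; z≤n; _∸_)
  import Data.Nat.Properties as ℕ
  open import Data.Nat.Primality using (Prime)
  open import Data.Fin as Fin using (Fin; toℕ; finToFun; funToFin; combine)
  import Data.Fin.Properties as Fin
  open import Data.Vec as Vec using (Vec; []; _∷_; tabulate)
  open import Data.Vec.Relation.Unary.All as All using (All; []; _∷_)
  open import Data.Vec.Relation.Unary.All.Properties using (tabulate⁻; tabulate⁺)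
  open import Data.Product using (∃; _×_; _,_; proj₁; proj₂)
  open import Data.Empty using (⊥-elim)
  open import Function using (_∘_)
  open import Function.Properties.Inverse using (↔-refl)
  open import Relation.Nullary using (¬_; Dec; yes; no; contradiction)
  open import Relation.Binary.Definitions using (tri<; tri≈; tri>)
  open import Relation.Binary.PropositionalEquality as ≡ using (_≡_; _≢_)
  open import Level using (0ℓ)
  import Data.Integer as ℤ

  finToFun-injective : ∀ {m n} {i j : Fin (m ℕ.^ n)} → (∀ l → finToFun {m} {n} i l ≡ finToFun j l) → i ≡ j
  finToFun-injective {m} {n} {i} {j} eq = ≡.trans (≡.sym (Fin.funToFin-finToFin {n} {m} i))
    (≡.trans (funToFin-cong eq) (Fin.funToFin-finToFin {n} {m} j))
    where
    funToFin-cong : ∀ {n} {f g : Fin n → Fin m} → (∀ l → f l ≡ g l) → funToFin f ≡ funToFin g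
    funToFin-cong {zero} eq = ≡.refl
    funToFin-cong {suc n} eq = ≡.cong₂ combine (eq Fin.zero) (funToFin-cong (eq ∘ Fin.suc))

  -- The field GF(p^k), k = suc k′, before its elements are enumerated.
  record GaloisSetoid (p k′ : ℕ) : Set₁ where
    field L : CommutativeRing 0ℓ 0ℓ
    open CommutativeRing L public
    open CommutativeSemiringExp commutativeSemiring public
    open SemiringMult semiring public using () renaming (_×_ to _·_)
    field
      p-prime : Prime p
      char : ∀ y → p · y ≈ 0#
      _≈?_ : ∀ y z → Dec (y ≈ z)
      1≉0 : ¬ 1# ≈ 0#
      inverse : ∀ {y} → ¬ y ≈ 0# → ∃ λ z → y * z ≈ 1#
      power : ∀ y → y ^ (p ℕ.^ suc k′) ≈ y
      x : Carrier
      conjugates : ∀ {d} → 0 < d → d ≤ k′ → ¬ x ^ (p ℕ.^ d) ≈ x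

  module GaloisField {p₂ k′ : ℕ} (G : GaloisSetoid (suc (suc p₂)) k′) where
    open GaloisSetoid G
    open Domain L
    open PrimeCharacteristic L
    open IntegerSolver L using (solve; _:+_; _:*_; _:-_; :-_; _:=_; con)
    open import Algebra.Properties.Semiring.Mult semiring using (×-homo-+; ×-congˡ)
    open import Relation.Binary.Reasoning.Setoid setoid

    p = suc (suc p₂)
    k = suc k′
    q = p ℕ.^ k

    cancel : ∀ {y z} → ¬ y ≈ 0# → y * z ≈ 0# → z ≈ 0#
    cancel {y} {z} y≉0 yz≈0 with inverse y≉0
    ... | y⁻¹ , yy⁻¹≈1 = begin
      z                  ≈⟨ *-identityˡ z ⟨
      1# * z             ≈⟨ *-congʳ yy⁻¹≈1 ⟨
      y * y⁻¹ * z        ≈⟨ solve 3 (λ y i z → y :* i :* z := i :* (y :* z)) refl y y⁻¹ z ⟩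
      y⁻¹ * (y * z)      ≈⟨ *-congˡ yz≈0 ⟩
      y⁻¹ * 0#           ≈⟨ zeroʳ y⁻¹ ⟩
      0#                 ∎

    -- The p-th power map respects sums and products and fixes the coefficients, so it commutes with
    -- evaluation.
    horner-frobenius : ∀ {n} {cs : Vec Carrier n} → All (λ c → c ^ p ≈ c) cs → ∀ y →
      horner cs (y ^ p) ≈ horner cs y ^ p
    horner-frobenius [] y = sym (0^n≈0 (suc p₂))
    horner-frobenius {cs = c ∷ cs} (c^p≈c ∷ fixed) y = begin
      c + y ^ p * horner cs (y ^ p)        ≈⟨ +-cong (sym c^p≈c) (*-congˡ (horner-frobenius fixed y)) ⟩
      c ^ p + y ^ p * horner cs y ^ p      ≈⟨ +-congˡ (^-distrib-* y (horner cs y) p) ⟨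
      c ^ p + (y * horner cs y) ^ p        ≈⟨ frobenius-+ p-prime char c (y * horner cs y) ⟨
      (c + y * horner cs y) ^ p            ∎

    horner-sub : ∀ {n} (c d : Fin n → Carrier) y →
      horner (tabulate (λ i → c i - d i)) y ≈ horner (tabulate c) y - horner (tabulate d) y
    horner-sub {zero} c d y = sym (-‿inverseʳ 0#)
    horner-sub {suc n} c d y = trans (+-congˡ (*-congˡ (horner-sub (c ∘ Fin.suc) (d ∘ Fin.suc) y)))
      (solve 5 (λ c d y g h → (c :- d) :+ y :* (g :- h) := (c :+ y :* g) :- (d :+ y :* h)) refl
        (c Fin.zero) (d Fin.zero) y (horner (tabulate (c ∘ Fin.suc)) y) (horner (tabulate (d ∘ Fin.suc)) y))

    conjugate : ℕ → Carrier
    conjugate n = x ^ (p ℕ.^ n)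

    conjugate-suc : ∀ n → conjugate (suc n) ≈ conjugate n ^ p
    conjugate-suc n = trans (^-congʳ x (ℕ.*-comm p (p ℕ.^ n))) (sym (^-assocʳ x (p ℕ.^ n) p))

    conjugate-+ : ∀ m n → conjugate (m ℕ.+ n) ≈ conjugate m ^ (p ℕ.^ n)
    conjugate-+ m n = trans (^-congʳ x (ℕ.^-distribˡ-+-* p m n)) (sym (^-assocʳ x (p ℕ.^ m) (p ℕ.^ n)))

    -- Raising to the power p^(k - i) turns conjugate i into x.
    conjugates-distinct< : ∀ {i j} → i < j → j ≤ k′ → ¬ conjugate i ≈ conjugate j
    conjugates-distinct< {i} {j} i<j j≤k′ eq = conjugates {j ∸ i} (ℕ.m<n⇒0<n∸m i<j) (ℕ.≤-trans (ℕ.m∸n≤m j i) j≤k′) (begin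
      conjugate (j ∸ i)                      ≈⟨ power (conjugate (j ∸ i)) ⟨
      conjugate (j ∸ i) ^ q                  ≈⟨ conjugate-+ (j ∸ i) k ⟨
      conjugate (j ∸ i ℕ.+ k)                ≈⟨ ^-congʳ x (≡.cong (p ℕ.^_) shift) ⟩
      conjugate (j ℕ.+ (k ∸ i))              ≈⟨ conjugate-+ j (k ∸ i) ⟩
      conjugate j ^ (p ℕ.^ (k ∸ i))          ≈⟨ ^-congˡ (p ℕ.^ (k ∸ i)) eq ⟨
      conjugate i ^ (p ℕ.^ (k ∸ i))          ≈⟨ conjugate-+ i (k ∸ i) ⟨
      conjugate (i ℕ.+ (k ∸ i))              ≈⟨ ^-congʳ x (≡.cong (p ℕ.^_) (ℕ.m+[n∸m]≡n i≤k)) ⟩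
      conjugate k                            ≈⟨ power x ⟩
      x                                      ∎)
      where
      i≤k : i ≤ k
      i≤k = ℕ.m≤n⇒m≤1+n (ℕ.≤-trans (ℕ.<⇒≤ i<j) j≤k′)
      shift : j ∸ i ℕ.+ k ≡ j ℕ.+ (k ∸ i)
      shift = ≡.trans (≡.sym (ℕ.+-∸-comm k (ℕ.<⇒≤ i<j))) (ℕ.+-∸-assoc j i≤k)

    conjugates-distinct : ∀ {i j : Fin k} → conjugate (toℕ i) ≈ conjugate (toℕ j) → i ≡ j
    conjugates-distinct {i} {j} eq with ℕ.<-cmp (toℕ i) (toℕ j)
    ... | tri< i<j _ _ = contradiction eq (conjugates-distinct< i<j (Fin.toℕ≤pred[n] j))
    ... | tri≈ _ i≡j _ = Fin.toℕ-injective i≡j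
    ... | tri> _ _ j<i = contradiction (sym eq) (conjugates-distinct< j<i (Fin.toℕ≤pred[n] i))

    ·1-injective< : ∀ {m n} → m < n → n < p → ¬ m · 1# ≈ n · 1#
    ·1-injective< {m} {n} m<n n<p eq = n·1≉0 p-prime char 1≉0 (ℕ.m<n⇒0<n∸m m<n) (ℕ.≤-<-trans (ℕ.m∸n≤m n m) n<p) (begin
      d                          ≈⟨ solve 2 (λ d m → d := m :+ d :- m) refl d (m · 1#) ⟩
      m · 1# + d - m · 1#        ≈⟨ +-congʳ (×-homo-+ 1# m (n ∸ m)) ⟨
      (m ℕ.+ (n ∸ m)) · 1# - m · 1# ≈⟨ +-congʳ (×-congˡ {1#} (ℕ.m+[n∸m]≡n (ℕ.<⇒≤ m<n))) ⟩
      n · 1# - m · 1#            ≈⟨ x≈y⇒x-y≈0 (sym eq) ⟩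
      0#                         ∎)
      where d = (n ∸ m) · 1#

    ·1-injective : ∀ {a b : Fin p} → toℕ a · 1# ≈ toℕ b · 1# → a ≡ b
    ·1-injective {a} {b} eq with ℕ.<-cmp (toℕ a) (toℕ b)
    ... | tri< a<b _ _ = contradiction eq (·1-injective< a<b (Fin.toℕ<n b))
    ... | tri≈ _ a≡b _ = Fin.toℕ-injective a≡b
    ... | tri> _ _ b<a = contradiction (sym eq) (·1-injective< b<a (Fin.toℕ<n a))

    digit : Fin q → Fin k → Carrier
    digit j i = toℕ (finToFun {p} {k} j i) · 1#

    -- The k digits of j in base p are the coefficients of a polynomial over the prime field,
    -- evaluated at x.
    decode : Fin q → Carrier
    decode j = horner (tabulate (digit j)) x

    -- Polynomials over the prime field agreeing at x agree at its k distinct conjugates.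
    decode-injective : ∀ {i j} → decode i ≈ decode j → i ≡ j
    decode-injective {i} {j} eq = finToFun-injective {p} {k} λ l → ·1-injective (x-y≈0⇒x≈y (tabulate⁻ {f = λ l → digit i l - digit j l} zeros l))
      where
      fixed : ∀ j → All (λ c → c ^ p ≈ c) (tabulate (digit j))
      fixed j = tabulate⁺ λ i → frobenius-· p-prime char (toℕ (finToFun {p} {k} j i))
      agree : ∀ n → horner (tabulate (digit i)) (conjugate n) ≈ horner (tabulate (digit j)) (conjugate n)
      agree zero = trans (horner-cong (tabulate (digit i)) (*-identityʳ x)) (trans eq (sym (horner-cong (tabulate (digit j)) (*-identityʳ x))))
      agree (suc n) = begin
        horner (tabulate (digit i)) (conjugate (suc n))   ≈⟨ horner-cong (tabulate (digit i)) (conjugate-suc n) ⟩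
        horner (tabulate (digit i)) (conjugate n ^ p)     ≈⟨ horner-frobenius (fixed i) (conjugate n) ⟩
        horner (tabulate (digit i)) (conjugate n) ^ p     ≈⟨ ^-congˡ p (agree n) ⟩
        horner (tabulate (digit j)) (conjugate n) ^ p     ≈⟨ horner-frobenius (fixed j) (conjugate n) ⟨
        horner (tabulate (digit j)) (conjugate n ^ p)     ≈⟨ horner-cong (tabulate (digit j)) (conjugate-suc n) ⟨
        horner (tabulate (digit j)) (conjugate (suc n))   ∎
      zeros : All (_≈ 0#) (tabulate (λ l → digit i l - digit j l))
      zeros = roots⇒zero cancel (tabulate (λ l → digit i l - digit j l)) (conjugate ∘ toℕ) conjugates-distinct
        λ l → trans (horner-sub (digit i) (digit j) (conjugate (toℕ l))) (x≈y⇒x-y≈0 (agree (toℕ l)))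

    monomial : ∀ n → Vec Carrier (suc n)
    monomial zero = 1# ∷ []
    monomial (suc n) = 0# ∷ monomial n

    horner-monomial : ∀ n y → horner (monomial n) y ≈ y ^ n
    horner-monomial zero y = trans (+-congˡ (zeroʳ y)) (+-identityʳ 1#)
    horner-monomial (suc n) y = trans (+-identityˡ _) (*-congˡ (horner-monomial n y))

    monomial≉0 : ∀ n → ¬ All (_≈ 0#) (monomial n)
    monomial≉0 zero (1≈0 ∷ []) = 1≉0 1≈0
    monomial≉0 (suc n) (_ ∷ zeros) = monomial≉0 n zeros

    -- Y^n - Y has n + 1 coefficients, so n + 1 distinct roots would annihilate all of them,
    -- including the leading 1. The bound 2 ≤ n keeps its two terms apart.
    too-many-elements : ∀ {n} → 2 ≤ n → (∀ y → y ^ n ≈ y) → (f : Fin (suc n) → Carrier) →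
      ¬ (∀ {i j} → f i ≈ f j → i ≡ j)
    too-many-elements {suc (suc n)} (s≤s (s≤s _)) pow f f-injective =
      monomial≉0 n (All.tail (All.tail (roots⇒zero cancel (0# ∷ (- 1#) ∷ monomial n) f f-injective vanish)))
      where
      vanish : ∀ i → horner (0# ∷ (- 1#) ∷ monomial n) (f i) ≈ 0#
      vanish i = begin
        0# + f i * (- 1# + f i * horner (monomial n) (f i))
          ≈⟨ +-congˡ (*-congˡ (+-congˡ (*-congˡ (horner-monomial n (f i))))) ⟩
        0# + f i * (- 1# + f i * f i ^ n)
          ≈⟨ solve 2 (λ y z → con (ℤ.+ 0) :+ y :* (:- con (ℤ.+ 1) :+ y :* z) := y :* (y :* z) :- y) refl (f i) (f i ^ n) ⟩
        f i ^ suc (suc n) - f i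
          ≈⟨ x≈y⇒x-y≈0 (pow (f i)) ⟩
        0# ∎

    2≤q : 2 ≤ q
    2≤q = ℕ.≤-trans (s≤s (s≤s z≤n)) (ℕ.m≤m*n p (p ℕ.^ k′) {{ℕ.m^n≢0 p k′}})

    -- A missed y, together with the q decoded elements, would give q + 1 roots of Y^q - Y.
    surjective : ∀ y → ∃ λ j → decode j ≈ y
    surjective y with Fin.any? (λ j → decode j ≈? y)
    ... | yes found = found
    ... | no missed = ⊥-elim (too-many-elements 2≤q power f f-injective)
      where
      f : Fin (suc q) → Carrier
      f Fin.zero = y
      f (Fin.suc j) = decode j
      f-injective : ∀ {i j} → f i ≈ f j → i ≡ j
      f-injective {Fin.zero} {Fin.zero} _ = ≡.refl
      f-injective {Fin.zero} {Fin.suc j} eq = contradiction (j , sym eq) missed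
      f-injective {Fin.suc i} {Fin.zero} eq = contradiction (i , eq) missed
      f-injective {Fin.suc i} {Fin.suc j} eq = ≡.cong Fin.suc (decode-injective eq)

    encode : Carrier → Fin q
    encode y = proj₁ (surjective y)

    decode-encode : ∀ y → decode (encode y) ≈ y
    decode-encode y = proj₂ (surjective y)

    -- The operations are pulled back to `Fin q`, where equality is propositional, as `Field`
    -- demands.
    rawRing′ : RawRing 0ℓ 0ℓ
    rawRing′ = record
      { Carrier = Fin q ; _≈_ = _≡_
      ; _+_ = λ i j → encode (decode i + decode j)
      ; _*_ = λ i j → encode (decode i * decode j)
      ; -_ = λ i → encode (- decode i)
      ; 0# = encode 0# ; 1# = encode 1# }

    decode-isRingMonomorphism : IsRingMonomorphism rawRing′ rawRing decode
    decode-isRingMonomorphism = record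
      { isRingHomomorphism = record
        { isSemiringHomomorphism = record
          { isNearSemiringHomomorphism = record
            { +-isMonoidHomomorphism = record
              { isMagmaHomomorphism = record
                { isRelHomomorphism = record { cong = λ { ≡.refl → refl } }
                ; homo = λ i j → decode-encode (decode i + decode j) }
              ; ε-homo = decode-encode 0# }
            ; *-homo = λ i j → decode-encode (decode i * decode j) }
          ; 1#-homo = decode-encode 1# }
        ; -‿homo = λ i → decode-encode (- decode i) }
      ; injective = decode-injective }

    inverse′ : Fin q → Fin q
    inverse′ i with decode i ≈? 0#
    -- An arbitrary value for the inverse of zero.
    ... | yes _ = i
    ... | no i≉0 = encode (proj₁ (inverse i≉0))

    galoisField : Field
    galoisField = record
      { Carrier = Fin q ; _+_ = _+′_ ; _*_ = _*′_ ; -_ = -′_ ; _⁻¹ = inverse′ ; 0# = 0′ ; 1# = 1′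
      ; isCommutativeRing = RingMonomorphism.isCommutativeRing decode-isRingMonomorphism isCommutativeRing
      ; inverseʳ = inverseʳ
      ; 1≢0 = λ eq → 1≉0 (trans (sym (decode-encode 1#)) (trans (reflexive (≡.cong decode eq)) (decode-encode 0#)))
      ; _≟_ = Fin._≟_ }
      where
      open RawRing rawRing′ using () renaming (_+_ to _+′_; _*_ to _*′_; -_ to -′_; 0# to 0′; 1# to 1′)
      inverseʳ : ∀ {i} → i ≢ 0′ → i *′ inverse′ i ≡ 1′
      inverseʳ {i} i≢0 with decode i ≈? 0#
      ... | yes i≈0 = contradiction (decode-injective (trans i≈0 (sym (decode-encode 0#)))) i≢0
      ... | no i≉0 = decode-injective (begin
        decode (encode (decode i * decode (encode (proj₁ (inverse i≉0)))))   ≈⟨ decode-encode _ ⟩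
        decode i * decode (encode (proj₁ (inverse i≉0)))                     ≈⟨ *-congˡ (decode-encode _) ⟩
        decode i * proj₁ (inverse i≉0)                                       ≈⟨ proj₂ (inverse i≉0) ⟩
        1#                                                                   ≈⟨ decode-encode 1# ⟨
        decode (encode 1#)                                                   ∎)

    finiteField : FiniteField q
    finiteField = record
      { 𝔽 = galoisField ; enum = ↔-refl ; p-1 = suc p₂
      ; characteristic = λ i → decode-injective (trans (decode-· p i) (trans (char (decode i)) (sym (decode-encode 0#)))) }
      where
      open SemiringMult (CommutativeRing.semiring (FieldProperties.commutativeRing galoisField)) using () renaming (_×_ to _·′_)
      decode-· : ∀ n i → decode (n ·′ i) ≈ n · decode i
      decode-· zero i = decode-encode 0#
      decode-· (suc n) i = trans (decode-encode _) (+-congˡ (decode-· n i))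

-- The field as a factor of the truncated polynomial ring.

module Existence where
  open Solver
  open Fields
  open FiniteFields
  open RingTheory
  open ExponentLists
  open Galois
  open import Algebra.Bundles using (CommutativeRing)
  import Algebra.Properties.CommutativeSemiring.Exp as CommutativeSemiringExp
  import Algebra.Properties.Semiring.Mult as SemiringMult
  open import Data.List using (List; []; _∷_; _++_)
  open import Data.Nat as ℕ using (ℕ; zero; suc; _<_; _≤_; s≤s; z≤n; _∸_)
  import Data.Nat.Properties as ℕ
  open import Data.Nat.Primality using (Prime)
  open import Data.Fin as Fin using (Fin)
  open import Data.Sum using (_⊎_; inj₁; inj₂; [_,_]′)
  open import Data.Product using (∃; _×_; _,_)
  open import Function using (_∘_; id)
  open import Relation.Nullary using (¬_; Dec; yes; no; contradiction)
  open import Relation.Nullary.Decidable using (map′)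
  open import Relation.Binary.PropositionalEquality as ≡ using (_≡_)

  module MinimalIdempotent {c ℓ} (R : CommutativeRing c ℓ) (r : ℕ) where
    open CommutativeRing R
    open CommutativeSemiringExp commutativeSemiring
    open IntegerSolver R using (solve; _:*_; _:=_)
    open import Relation.Binary.Reasoning.Setoid setoid

    -- x^(q-1) for q = 2 + r. When x^q = x it is idempotent and generates the same ideal as x.
    support : Carrier → Carrier
    support x = x ^ suc r

    module _ (_≈?_ : ∀ x y → Dec (x ≈ y)) (power : ∀ x → x ^ suc (suc r) ≈ x) where

      support-idempotent : ∀ x → support x * support x ≈ support x
      support-idempotent x = trans (solve 2 (λ x y → x :* y :* (x :* y) := x :* (x :* y) :* y) refl x (x ^ r)) (*-congʳ (power x))

      IsMinimal : ∀ {n} → (Fin n → Carrier) → Carrier → Set ℓ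
      IsMinimal a e = ∀ i → e * support (a i) ≈ 0# ⊎ e * support (a i) ≈ e

      -- The family is treated one member at a time: e is multiplied by the support of the member
      -- unless the result is zero. The alternatives reached for the other members survive this
      -- multiplication.
      minimal : ∀ {n} (a : Fin n → Carrier) {e₀} → ¬ e₀ ≈ 0# → e₀ * e₀ ≈ e₀ →
        ∃ λ e → ¬ e ≈ 0# × e * e₀ ≈ e × IsMinimal a e
      minimal {zero} a {e₀} e₀≉0 idem = e₀ , e₀≉0 , idem , λ ()
      minimal {suc n} a {e₀} e₀≉0 idem with minimal (a ∘ Fin.suc) e₀≉0 idem
      ... | e , e≉0 , below , min with (e * support (a Fin.zero)) ≈? 0#
      ... | yes es≈0 = e , e≉0 , below , λ { Fin.zero → inj₁ es≈0 ; (Fin.suc i) → min i }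
      ... | no es≉0 = e * s , es≉0 , below′ , min′
        where
        s = support (a Fin.zero)
        xyz≈xzy : ∀ x y z → x * y * z ≈ x * z * y
        xyz≈xzy = solve 3 (λ x y z → x :* y :* z := x :* z :* y) refl
        below′ : e * s * e₀ ≈ e * s
        below′ = trans (xyz≈xzy e s e₀) (*-congʳ below)
        min′ : IsMinimal a (e * s)
        min′ Fin.zero = inj₂ (trans (*-assoc e s s) (*-congˡ (support-idempotent (a Fin.zero))))
        min′ (Fin.suc i) with min i
        ... | inj₁ eq = inj₁ (trans (xyz≈xzy e s (support (a (Fin.suc i)))) (trans (*-congʳ eq) (zeroˡ s)))
        ... | inj₂ eq = inj₂ (trans (xyz≈xzy e s (support (a (Fin.suc i)))) (*-congʳ eq))

  module Construction (p₂ r k′ : ℕ) (p-prime : Prime (suc (suc p₂)))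
    (q≡p^k : suc (suc r) ≡ suc (suc p₂) ℕ.^ suc k′) where
    open TruncatedPolynomials p₂ r
    module A = CommutativeRing commutativeRing
    open CommutativeSemiringExp A.commutativeSemiring
    open SemiringMult A.semiring using () renaming (_×_ to _·_)
    open PrimeCharacteristic commutativeRing

    ·≡copies : ∀ n f → n · f ≡ copies n f
    ·≡copies zero f = ≡.refl
    ·≡copies (suc n) f = ≡.cong (f ++_) (·≡copies n f)

    char : ∀ f → p · f ≈ []
    char f = A.trans (A.reflexive (·≡copies p f)) (p-copies f)

    X : List ℕ
    X = 1 ∷ []

    X^n≈ : ∀ n → X ^ n ≈ n ∷ []
    X^n≈ zero = A.refl
    X^n≈ (suc n) = A.*-congˡ {X} (X^n≈ n)

    X^q≈X : X ^ q ≈ X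
    X^q≈X = A.trans (X^n≈ q) (mk λ u per → ≡.cong (λ m → (m ℕ.+ 0) ℕ.% p)
      (≡.trans (≡.cong u (≡.sym (ℕ.+-identityʳ q))) (per 0)))

    monomial-power : ∀ i → (i ∷ []) ^ q ≈ i ∷ []
    monomial-power i = begin
      (i ∷ []) ^ q         ≈⟨ ^-congˡ q (X^n≈ i) ⟨
      (X ^ i) ^ q          ≈⟨ ^-assocʳ X i q ⟩
      X ^ (i ℕ.* q)        ≈⟨ ^-congʳ X (ℕ.*-comm i q) ⟩
      X ^ (q ℕ.* i)        ≈⟨ ^-assocʳ X q i ⟨
      (X ^ q) ^ i          ≈⟨ ^-congˡ i X^q≈X ⟩
      X ^ i                ≈⟨ X^n≈ i ⟩
      i ∷ []               ∎
      where open import Relation.Binary.Reasoning.Setoid A.setoid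

    -- The q-th power is additive because q is a power of p, and on monomials (X^i)^q = (X^q)^i =
    -- X^i. A list is a sum of monomials without scalars, so nothing else is needed.
    power : ∀ f → f ^ q ≈ f
    power [] = 0^n≈0 (suc r)
    power (i ∷ f) = begin
      ((i ∷ []) ++ f) ^ q                                              ≈⟨ ^-congʳ (i ∷ f) q≡p^k ⟩
      ((i ∷ []) ++ f) ^ (p ℕ.^ suc k′)                                 ≈⟨ frobenius^-+ p-prime char (suc k′) (i ∷ []) f ⟩
      (i ∷ []) ^ (p ℕ.^ suc k′) ++ f ^ (p ℕ.^ suc k′)                  ≈⟨ A.+-cong (^-congʳ (i ∷ []) q≡p^k) (^-congʳ f q≡p^k) ⟨
      (i ∷ []) ^ q ++ f ^ q                                            ≈⟨ A.+-cong (monomial-power i) (power f) ⟩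
      (i ∷ []) ++ f                                                    ∎
      where open import Relation.Binary.Reasoning.Setoid A.setoid

    -- f has degree N and leading coefficient 1, tested on the sequences vanishing below N.
    Monic : List ℕ → ℕ → Set
    Monic f N = ∀ u → (∀ {n} → n < N → u n ≡ 0) → sumOver f u ≡ u N

    -- For m ≤ M the inner sum over g reads off u (m + N). This vanishes for m < M, so f reads off u
    -- (M + N).
    monic-⊛ : ∀ {f g M N} → Monic f M → Monic g N → Monic (f ⊛ g) (M ℕ.+ N)
    monic-⊛ {f} {g} {M} {N} mf mg u vanish = ≡.trans (sumOver-⊛ f g u)
      (≡.trans (mf _ λ {m} m<M → ≡.trans (inner m (ℕ.<⇒≤ m<M)) (vanish (ℕ.+-monoˡ-< N m<M)))
               (inner M ℕ.≤-refl))
      where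
      inner : ∀ m → m ≤ M → sumOver g (λ j → u (m ℕ.+ j)) ≡ u (m ℕ.+ N)
      inner m m≤M = mg (λ j → u (m ℕ.+ j)) λ n<N → vanish (ℕ.+-mono-≤-< m≤M n<N)

    factor : ℕ → List ℕ
    factor d = (p ℕ.^ d ∷ []) ++ neg X

    monic-factor : ∀ d → Monic (factor (suc d)) (p ℕ.^ suc d)
    monic-factor d u vanish = begin
      u (p ℕ.^ suc d) ℕ.+ sumOver (neg X) u                ≡⟨ ≡.cong (u (p ℕ.^ suc d) ℕ.+_) (sumOver-copies (suc p₂) X u) ⟩
      u (p ℕ.^ suc d) ℕ.+ suc p₂ ℕ.* (u 1 ℕ.+ 0)           ≡⟨ ≡.cong (λ m → u (p ℕ.^ suc d) ℕ.+ suc p₂ ℕ.* (m ℕ.+ 0)) (vanish 1<p^d) ⟩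
      u (p ℕ.^ suc d) ℕ.+ suc p₂ ℕ.* 0                     ≡⟨ ≡.cong (u (p ℕ.^ suc d) ℕ.+_) (ℕ.*-zeroʳ (suc p₂)) ⟩
      u (p ℕ.^ suc d) ℕ.+ 0                                ≡⟨ ℕ.+-identityʳ _ ⟩
      u (p ℕ.^ suc d)                                      ∎
      where
      open ≡.≡-Reasoning
      1<p^d : 1 < p ℕ.^ suc d
      1<p^d = ℕ.≤-trans (s≤s (s≤s z≤n)) (ℕ.m≤m*n p (p ℕ.^ d) {{ℕ.m^n≢0 p d}})

    product : ℕ → List ℕ
    product zero = 0 ∷ []
    product (suc d) = product d ⊛ factor (suc d)

    degree : ℕ → ℕ
    degree zero = 0
    degree (suc d) = degree d ℕ.+ p ℕ.^ suc d

    monic-product : ∀ d → Monic (product d) (degree d)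
    monic-product zero u _ = ℕ.+-identityʳ (u 0)
    monic-product (suc d) = monic-⊛ {product d} {factor (suc d)} (monic-product d) (monic-factor d)

    degree< : ∀ d → degree d < p ℕ.^ suc d
    degree< zero = ℕ.≤-trans (s≤s z≤n) (ℕ.m≤m*n p 1)
    degree< (suc d) = ℕ.<-≤-trans (ℕ.+-monoˡ-< (p ℕ.^ suc d) (degree< d))
      (ℕ.≤-trans (ℕ.≤-reflexive (≡.cong (p ℕ.^ suc d ℕ.+_) (≡.sym (ℕ.+-identityʳ (p ℕ.^ suc d)))))
        (ℕ.*-monoˡ-≤ (p ℕ.^ suc d) {2} {p} (s≤s (s≤s z≤n))))

    -- The degree p + … + p^(k-1) is less than q, so X^q - X does not divide the product.
    product≉0 : ¬ product k′ ≈ []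
    product≉0 eq = contradiction (≡.trans (≡.sym (≡.cong (ℕ._% p) coefficient≡1)) (≈⇒coefficients eq N)) λ ()
      where
      N = degree k′
      N<q : N < q
      N<q = ≡.subst (N <_) (≡.sym q≡p^k) (degree< k′)
      coefficient≡1 : coefficient (product k′) N ≡ 1
      coefficient≡1 = ≡.trans
        (monic-product k′ (λ n → δ (reduce n) N) λ {n} n<N → δ-≢ λ eq → ℕ.<⇒≢ n<N
          (≡.trans (≡.sym (reduce-id (ℕ.<-trans n<N N<q))) eq))
        (δ-≡ (reduce-id N<q))

    open MinimalIdempotent commutativeRing r

    support≉0 : ∀ {f} → ¬ f ≈ [] → ¬ support f ≈ []
    support≉0 {f} f≉0 eq = f≉0 (A.trans (A.sym (power f)) (A.trans (A.*-congˡ {f} eq) (A.zeroʳ f)))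

    module AtIdempotent (e : List ℕ) (e≉0 : ¬ e ≈ []) (e-below : e ⊛ support (product k′) ≈ e)
      (e-minimal : IsMinimal _≈?_ power enumeration e) where
      open Localisation commutativeRing e
      module L = CommutativeRing localised
      module Lᴱ = CommutativeSemiringExp L.commutativeSemiring
      module Lᴹ = SemiringMult L.semiring

      -- Multiplication is the same in both rings, but the two power functions are separate
      -- instances, which agree by induction on the exponent.
      ^-localised : ∀ f n → f Lᴱ.^ n ≡ f ^ n
      ^-localised f zero = ≡.refl
      ^-localised f (suc n) = ≡.cong (f ⊛_) (^-localised f n)

      ·-localised : ∀ n f → n Lᴹ.× f ≡ n · f
      ·-localised zero f = ≡.refl
      ·-localised (suc n) f = ≡.cong (f ++_) (·-localised n f)

      1≉ₑ0 : ¬ (0 ∷ []) ≈ₑ []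
      1≉ₑ0 eq = e≉0 (A.trans (A.sym (A.*-identityʳ e)) (A.trans (times-e eq) (A.zeroʳ e)))

      -- Minimality leaves two cases for the support s of f. If e s = 0, then e f = e s f = 0; if e
      -- s = e, then s = f f^(q-2) becomes 1, which supplies the inverse.
      zero⊎unit : ∀ f → f ≈ₑ [] ⊎ support f ≈ₑ (0 ∷ [])
      zero⊎unit f with enumeration-complete f
      ... | j , f≈ with e-minimal j
      ... | inj₁ eq = inj₁ (mkₑ (begin
        e ⊛ f                          ≈⟨ A.*-congˡ {e} (power f) ⟨
        e ⊛ (f ⊛ support f)            ≈⟨ A.*-congˡ {e} (A.*-comm f (support f)) ⟩
        e ⊛ (support f ⊛ f)            ≈⟨ A.*-assoc e (support f) f ⟨
        (e ⊛ support f) ⊛ f            ≈⟨ A.*-congʳ (A.trans (A.*-congˡ {e} (^-congˡ (suc r) f≈)) eq) ⟩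
        [] ⊛ f                         ≈⟨ A.refl ⟩
        []                             ≈⟨ A.zeroʳ e ⟨
        e ⊛ []                         ∎))
        where open import Relation.Binary.Reasoning.Setoid A.setoid
      ... | inj₂ eq = inj₂ (mkₑ (A.trans (A.*-congˡ {e} (^-congˡ (suc r) f≈)) (A.trans eq (A.sym (A.*-identityʳ e)))))

      support-product : support (product k′) ≈ₑ (0 ∷ [])
      support-product = mkₑ (A.trans e-below (A.sym (A.*-identityʳ e)))

      product-zero : ∀ {d n} → 0 < d → d ≤ n → factor d ≈ₑ [] → product n ≈ₑ []
      product-zero {suc d} {zero} _ () _
      product-zero {d} {suc n} 0<d d≤n eq with d ℕ.≟ suc n
      ... | yes ≡.refl = L.trans (L.*-congˡ {product n} eq) (L.zeroʳ (product n))
      ... | no d≢n = L.trans (L.*-congʳ {factor (suc n)} (product-zero 0<d (ℕ.≤-pred (ℕ.≤∧≢⇒< d≤n d≢n)) eq)) (L.zeroˡ (factor (suc n)))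

      -- Otherwise factor d, and with it the whole product, would become zero, whereas e lies below
      -- the support of the product.
      conjugates : ∀ {d} → 0 < d → d ≤ k′ → ¬ X Lᴱ.^ (p ℕ.^ d) ≈ₑ X
      conjugates {d} 0<d d≤k′ eq = 1≉ₑ0 (L.trans (L.sym support-product)
        (L.trans (L.*-congʳ {product k′ ^ r} (product-zero 0<d d≤k′ factor≈0)) (L.zeroˡ (product k′ ^ r))))
        where
        factor≈0 : factor d ≈ₑ []
        factor≈0 = L.trans (L.+-congʳ {neg X} (L.trans (≈⇒≈ₑ (A.sym (X^n≈ (p ℕ.^ d))))
          (L.trans (L.reflexive (≡.sym (^-localised X (p ℕ.^ d)))) eq))) (L.-‿inverseʳ X)

      galoisSetoid : GaloisSetoid p k′
      galoisSetoid = record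
        { L = localised
        ; p-prime = p-prime
        ; char = λ f → L.trans (L.reflexive (·-localised p f)) (≈⇒≈ₑ (char f))
        ; _≈?_ = λ f g → map′ mkₑ times-e ((e ⊛ f) ≈? (e ⊛ g))
        ; 1≉0 = 1≉ₑ0
        ; inverse = λ {f} f≉0 → f ^ r , [ (λ f≈0 → contradiction f≈0 f≉0) , id ]′ (zero⊎unit f)
        ; power = λ f → L.trans (L.reflexive (≡.trans (^-localised f (p ℕ.^ suc k′)) (≡.cong (f ^_) (≡.sym q≡p^k)))) (≈⇒≈ₑ (power f))
        ; x = X
        ; conjugates = conjugates }

    galoisSetoid : GaloisSetoid p k′
    galoisSetoid = at-minimal (minimal _≈?_ power enumeration (support≉0 product≉0) (support-idempotent _≈?_ power (product k′)))
      where
      at-minimal : (∃ λ e → ¬ e ≈ [] × e ⊛ support (product k′) ≈ e × IsMinimal _≈?_ power enumeration e) → GaloisSetoid p k′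
      at-minimal (e , e≉0 , e-below , e-minimal) = AtIdempotent.galoisSetoid e e≉0 e-below e-minimal

  finiteField-exists : ∀ {p} → Prime p → ∀ k′ → FiniteField (p ℕ.^ suc k′)
  finiteField-exists {suc (suc p₂)} p-prime k′ = GaloisField.finiteField (Construction.galoisSetoid p₂ (p ℕ.^ suc k′ ∸ 2) k′ p-prime
    (ℕ.m+[n∸m]≡n {2} (ℕ.≤-trans (s≤s (s≤s z≤n)) (ℕ.m≤m*n p (p ℕ.^ k′) {{ℕ.m^n≢0 p k′}}))))
    where p = suc (suc p₂)

-- Numerical parameters and assembly.

open import Defs
open Counting
open Fields
open Spreads
open Planes
open FiniteFields
open Kirkman
open Existence
open import Data.Nat using (ℕ; suc; _*_; _∸_; _^_; _≤_; s≤s; z≤n; NonZero)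
import Data.Nat.Properties as ℕ
open import Data.Nat.Solver using (module +-*-Solver)
open import Data.Product using (_,_)
open import Relation.Nullary using (yes; no)
open import Relation.Binary.PropositionalEquality

-- With a = q - 1 the truncated subtractions become polynomial identities in a, and the quotients of
-- the statement follow by cancelling nonzero factors.
module Parameters (a : ℕ) where
  open +-*-Solver
  q rows labels cols : ℕ
  q = suc a
  rows = suc (suc q * q)
  labels = suc (q * q)
  cols = labels * suc q

  q²-1 : q ^ 2 ∸ 1 ≡ a * suc q
  q²-1 = cong (_∸ 1) (solve 1 (λ a → (con 1 :+ a) :^ 2 := con 1 :+ a :* (con 2 :+ a)) refl a)

  q³-1 : q ^ 3 ∸ 1 ≡ rows * a
  q³-1 = cong (_∸ 1) (solve 1 (λ a → (con 1 :+ a) :^ 3 := con 1 :+ (con 1 :+ (con 2 :+ a) :* (con 1 :+ a)) :* a) refl a)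

  q⁴-1 : q ^ 4 ∸ 1 ≡ cols * a
  q⁴-1 = cong (_∸ 1) (solve 1 (λ a → (con 1 :+ a) :^ 4 :=
    con 1 :+ (con 1 :+ (con 1 :+ a) :* (con 1 :+ a)) :* (con 2 :+ a) :* a) refl a)

  symbols-count : rows * labels * ((q ^ 2 ∸ 1) * a) ≡ (q ^ 4 ∸ 1) * (q ^ 3 ∸ 1)
  symbols-count = trans (cong (λ n → rows * labels * (n * a)) q²-1)
    (trans (rearrange rows labels a (suc q)) (sym (cong₂ _*_ q⁴-1 q³-1)))
    where
    rearrange : ∀ r l a s → r * l * (a * s * a) ≡ l * s * a * (r * a)
    rearrange = solve 4 (λ r l a s → r :* l :* (a :* s :* a) := l :* s :* a :* (r :* a)) refl

  module _ .{{_ : NonZero a}} where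
    rows≡ : ∀ {r} → r * a ≡ q ^ 3 ∸ 1 → rows ≡ r
    rows≡ {r} eq = ℕ.*-cancelʳ-≡ rows r a (sym (trans eq q³-1))

    cols≡ : ∀ {c} → c * a ≡ q ^ 4 ∸ 1 → cols ≡ c
    cols≡ {c} eq = ℕ.*-cancelʳ-≡ cols c a (sym (trans eq q⁴-1))

    symbols≡ : ∀ {v} → v * ((q ^ 2 ∸ 1) * a) ≡ (q ^ 4 ∸ 1) * (q ^ 3 ∸ 1) → rows * labels ≡ v
    symbols≡ {v} eq = ℕ.*-cancelʳ-≡ (rows * labels) v ((q ^ 2 ∸ 1) * a) {{nonZero}} (trans symbols-count (sym eq))
      where
      nonZero : NonZero ((q ^ 2 ∸ 1) * a)
      nonZero = subst (λ n → NonZero (n * a)) (sym q²-1) (ℕ.m*n≢0 (a * suc q) a {{ℕ.m*n≢0 a (suc q)}})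

design : ∀ {q} → 2 ≤ q → FiniteField q →
  ResolvedDesign (suc (suc q * q)) (suc (q * q)) (suc (q * q) * suc q) (suc q)
design {q} 2≤q FF with q ℕ.≟ 2
... | yes refl = kirkmanDesign
... | no q≢2 = Parallelism.resolvedDesign 𝔽 (Choice.spreadData FF (ℕ.≤∧≢⇒< 2≤q λ eq → q≢2 (sym eq))) enum
  where open FiniteField FF

finiteField⇒tripleArray : ∀ {q} → 2 ≤ q → FiniteField q →
  UnorderedTripleArray (suc (suc q * q)) (suc (q * q) * suc q) (suc (suc q * q) * suc (q * q))
finiteField⇒tripleArray {q} 2≤q FF = plane×design⇒tripleArray
  (PlaneOver.projectivePlane 𝔽 enum) (design 2≤q FF) (ℕ.*-comm (suc q) (suc (q * q)))
  where open FiniteField FF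

theorem7 : (q : ℕ) → IsPrimePower q → (r c v : ℕ)
    → r * (q ∸ 1) ≡ q ^ 3 ∸ 1
    → c * (q ∸ 1) ≡ q ^ 4 ∸ 1
    → v * ((q ^ 2 ∸ 1) * (q ∸ 1)) ≡ (q ^ 4 ∸ 1) * (q ^ 3 ∸ 1)
    → UnorderedTripleArray r c v
theorem7 q (p@(suc (suc _)) , suc k′ , p-prime , _ , q≡p^k) r c v r-eq c-eq v-eq =
  build q 2≤q (subst FiniteField (sym q≡p^k) (finiteField-exists p-prime k′)) r-eq c-eq v-eq
  where
  2≤q : 2 ≤ q
  2≤q = subst (2 ≤_) (sym q≡p^k) (ℕ.≤-trans (s≤s (s≤s z≤n)) (ℕ.m≤m*n p (p ^ k′) {{ℕ.m^n≢0 p k′}}))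

  -- q is taken afresh so that it can be matched as `suc a` with a nonzero, which reduces `q ∸ 1` to
  -- `a`.
  build : ∀ q → 2 ≤ q → FiniteField q → r * (q ∸ 1) ≡ q ^ 3 ∸ 1 → c * (q ∸ 1) ≡ q ^ 4 ∸ 1 →
    v * ((q ^ 2 ∸ 1) * (q ∸ 1)) ≡ (q ^ 4 ∸ 1) * (q ^ 3 ∸ 1) → UnorderedTripleArray r c v
  build (suc a@(suc _)) 2≤q@(s≤s (s≤s _)) FF r-eq c-eq v-eq =
    subst (λ v → UnorderedTripleArray r c v) (symbols≡ v-eq)
      (subst₂ (λ r c → UnorderedTripleArray r c (rows * labels)) (rows≡ r-eq) (cols≡ c-eq)
        (finiteField⇒tripleArray 2≤q FF))
    where open Parameters a
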